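{- Let $\lambda$ be a partition with $n$ parts, at least one equal to $0$, let $x_1,\dots,x_n>0$, $t\in[0,1)$, and fix $k<n$. Let $O$ be any observable (event or random variable) of the configuration of the multispecies $t$-PushTASEP with content $\lambda$ that depends only on the configuration in sites $1,2,\dots,k$. Then the expectation (or probability) $\langle O\rangle$ of $O$ in the stationary distribution is symmetric in the parameters $x_{k+1},\dots,x_n$.
   Context: Sites $1,\dots,n$ ($n\ge 2$) lie on a ring with clockwise order $1\to2\to\cdots\to n\to1$. For a partition $\lambda$, $S_\lambda$ is the set of compositions $\eta=(\eta_1,\dots,\eta_n)$ that are rearrangements of $\lambda$; $\eta_j$ is the species at site $j$, species $0$ meaning vacancy. Write $[m]_t=1+t+\dots+t^{m-1}$. The multispecies $t$-PushTASEP with content $\lambda$ is the continuous-time Markov chain on $S_\lambda$ in which each site $j$ has an independent exponential clock (bell) of rate $1/x_j$. When the bell at $j$ rings in configuration $\eta$: if $\eta_j=0$ nothing changes. Otherwise the particle at $j$ becomes active. An active particle of species $r$ at site $p$: let $m$ be the number of parts of $\lambda$ smaller than $r$; list the $m$ sites $i$ with $\eta_i<r$ (values before the bell rang) in clockwise order starting from the site after $p$; the particle moves to the $k$-th listed site with probability $t^{k-1}/[m]_t$, displacing the particle there; if the displaced species is nonzero that particle becomes active there and repeats, otherwise the procedure stops. Afterwards site $j$ is vacant, each site where an active particle settled holds it, other sites are unchanged; this is one transition. The stationary distribution is that of this (irreducible) chain.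
   Formalization: The parameters x_1,…,x_n and t, and the values of the observable O (hence also the stationary probabilities), are taken to be rational instead of real. -}

module Defs where

open import Data.Nat as ℕ using (ℕ; zero; suc)
open import Data.Fin as Fin using (Fin; toℕ)
open import Data.Fin.Permutation using (Permutation′; _⟨$⟩ʳ_)
open import Data.List as List using (List; []; _∷_; _++_; [_]; length; map; concatMap; filter; foldr; deduplicate; allFin)
open import Data.Vec as Vec using (Vec; lookup; _[_]≔_; toList)
open import Data.Vec.Properties using (≡-dec)
open import Data.Rational as ℚ using (ℚ; 0ℚ; 1ℚ; _+_; _*_; _÷_; ≢-nonZero)
open import Data.Rational.Properties using () renaming (_≟_ to _≟ℚ_)
open import Data.List.Membership.Propositional using (_∈_)
open import Data.Product using (_×_; _,_; proj₁; proj₂)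
open import Relation.Nullary using (yes; no)
open import Relation.Binary.PropositionalEquality using (_≡_)

-- A configuration of the ring with n sites: entry i (Fin n, i.e. site toℕ i + 1)
-- is the species at that site (0 = vacancy).
Config : ℕ → Set
Config n = Vec ℕ n

IsPartition : ∀ {n} → Vec ℕ n → Set
IsPartition {n} lam = (i j : Fin n) → i Fin.≤ j → lookup lam j ℕ.≤ lookup lam i

removeOne : ℕ → List ℕ → List ℕ
removeOne v [] = []
removeOne v (y ∷ ys) with v ℕ.≟ y
... | yes _ = ys
... | no  _ = y ∷ removeOne v ys

-- arrangements k xs : the distinct words of length k that are rearrangements of
-- the multiset xs (intended use: k = length xs).
arrangements : (k : ℕ) → List ℕ → List (Vec ℕ k)
arrangements zero    xs = [ Vec.[] ]
arrangements (suc k) xs =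
  concatMap (λ v → map (v Vec.∷_) (arrangements k (removeOne v xs)))
            (deduplicate ℕ._≟_ xs)

States : ∀ {n} → Vec ℕ n → List (Config n)
States {n} lam = arrangements n (toList lam)

-- total division; only ever applied to nonzero denominators under the
-- hypotheses of the theorem (x_j > 0, t ≥ 0).
_/'_ : ℚ → ℚ → ℚ
p /' q with q ≟ℚ 0ℚ
... | yes _  = 0ℚ
... | no q≢0 = _÷_ p q {{≢-nonZero q≢0}}

_^_ : ℚ → ℕ → ℚ
p ^ zero  = 1ℚ
p ^ suc k = p * (p ^ k)

qint : ℚ → ℕ → ℚ
qint t zero    = 0ℚ
qint t (suc m) = (t ^ m) + qint t m

sumℚ : List ℚ → ℚ
sumℚ = foldr _+_ 0ℚ

clockwiseFrom : ∀ {n} → Fin n → List (Fin n)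
clockwiseFrom {n} p =
  filter (λ i → p Fin.<? i) (allFin n) ++ filter (λ i → i Fin.≤? p) (allFin n)

-- Sites i (clockwise from the site after p) with η_i < r, η the configuration
-- before the bell rang.
lowerSites : ∀ {n} → Config n → Fin n → ℕ → List (Fin n)
lowerSites η p r = filter (λ i → lookup η i ℕ.<? r) (clockwiseFrom p)

Outcomes : ℕ → Set
Outcomes n = List (ℚ × Config n)

scale : ∀ {n} → ℚ → Outcomes n → Outcomes n
scale w = map (λ o → (w * proj₁ o , proj₂ o))

-- cascade f t η cur p r : an active particle of species r at site p, with η the
-- configuration before the bell rang and cur the current (partially updated)
-- configuration.  f is fuel; species strictly decrease along the cascade, so
-- fuel r suffices.
mutual
  cascade : ∀ {n} → ℕ → ℚ → Config n → Config n → Fin n → ℕ → Outcomes n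
  cascade zero    t η cur p r = []
  cascade (suc f) t η cur p r =
    choices f t η cur r (length (lowerSites η p r)) 0 (lowerSites η p r)

  choices : ∀ {n} → ℕ → ℚ → Config n → Config n → ℕ → ℕ → ℕ → List (Fin n) → Outcomes n
  choices f t η cur r m k []       = []
  choices f t η cur r m k (i ∷ is) =
    step f t η (cur [ i ]≔ r) i (lookup η i) ((t ^ k) /' qint t m)
    ++ choices f t η cur r m (suc k) is

  step : ∀ {n} → ℕ → ℚ → Config n → Config n → Fin n → ℕ → ℚ → Outcomes n
  step f t η cur' i zero      w = [ (w , cur') ]
  step f t η cur' i (suc r')  w = scale w (cascade f t η cur' i (suc r'))

ring : ∀ {n} → ℚ → Config n → Fin n → Outcomes n
ring t η j with lookup η j
... | zero  = [ (1ℚ , η) ]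
... | suc r = cascade (suc r) t η (η [ j ]≔ 0) j (suc r)

ringProb : ∀ {n} → ℚ → Fin n → Config n → Config n → ℚ
ringProb t j η η' = sumℚ (map proj₁ (filter (λ o → ≡-dec ℕ._≟_ (proj₂ o) η') (ring t η j)))

-- total rate of transitions η → η' (self-loops included)
rate : ∀ {n} → (Fin n → ℚ) → ℚ → Config n → Config n → ℚ
rate {n} x t η η' = sumℚ (map (λ j → (1ℚ /' x j) * ringProb t j η η') (allFin n))

-- total bell rate Σ_j 1/x_j (= total outgoing rate, self-loops included)
totalRate : ∀ {n} → (Fin n → ℚ) → ℚ
totalRate {n} x = sumℚ (map (λ j → 1ℚ /' x j) (allFin n))

IsStationary : ∀ {n} → Vec ℕ n → (Fin n → ℚ) → ℚ → (Config n → ℚ) → Set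
IsStationary lam x t π =
  ((η : _) → η ∈ States lam → 0ℚ ℚ.≤ π η)
  × sumℚ (map π (States lam)) ≡ 1ℚ
  × ((η' : _) → η' ∈ States lam →
       sumℚ (map (λ η → π η * rate x t η η') (States lam)) ≡ π η' * totalRate x)

expect : ∀ {n} → Vec ℕ n → (Config n → ℚ) → (Config n → ℚ) → ℚ
expect lam π O = sumℚ (map (λ η → π η * O η) (States lam))

DependsOnlyOnFirst : ∀ {n} → ℕ → (Config n → ℚ) → Set
DependsOnlyOnFirst {n} k O =
  (η η' : Config n) → ((i : Fin n) → toℕ i ℕ.< k → lookup η i ≡ lookup η' i) → O η ≡ O η'

FixesFirst : ∀ {n} → ℕ → Permutation′ n → Set
FixesFirst {n} k σ = (i : Fin n) → toℕ i ℕ.< k → σ ⟨$⟩ʳ i ≡ i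

{-# OPTIONS --safe #-}
-- Let E_j be the transition operator of a bell at site j and T the Hecke generator on two
-- adjacent sites i, i + 1. On configurations with a vacancy, T commutes with E_j for j ≠ i, i + 1,
-- while E_{i+1} T = T E_i and E_i T = T E_{i+1} + (1 - t)(E_{i+1} - E_i). These relations say that
-- Λ = (1 - t) x_{i+1} + (x_{i+1} - x_i) T intertwines the generators Σ_j E_j / x_j before and after
-- exchanging x_i and x_{i+1}; so Λ carries the stationary distribution of one chain to a multiple
-- of that of the other, and it multiplies observables that do not see sites i, i + 1 by
-- x_{i+1} - t x_i.
-- This factor is positive when x_i ≤ x_{i+1}, so from either set of rates one may sort the rates on
-- the sites beyond k, and the two resulting stationary functionals agree by uniqueness.
--
-- The commutation relations come from viewing a cascade as a strand travelling round the ring: at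
-- a site of lower species it settles with probability 1 - t and otherwise passes. Summing over the
-- number of turns gives t^(k-1)/[m]_t, so the expectation after a bell, as a function of the strand and
-- of the other sites, is the unique function harmonic for one turn of the strand with given values at
-- strand 0. One turn is a product of local operators, and those at two adjacent sites commute with
-- T by a Yang-Baxter relation.
module Submission where

open import Defs
import Data.Nat
open import Data.Bool using (true; false; if_then_else_) renaming (T to IsTrue)
open import Data.Empty using (⊥-elim)
open import Data.Fin as Fin using (Fin; toℕ)
open import Data.Fin.Permutation using (Permutation′; _⟨$⟩ʳ_; _⟨$⟩ˡ_; inverseˡ; inverseʳ)
open import Data.List as List using (List; []; _∷_; _++_; allFin; deduplicate; filter; length; map)
open import Data.List.Membership.Propositional using (_∈_; find; lose)
open import Data.List.Membership.Propositional.Properties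
  using (∈-++⁺ˡ; ∈-++⁺ʳ; ∈-++⁻; ∈-allFin; ∈-∃++; ∈-concatMap⁺; ∈-concatMap⁻; ∈-map⁺; ∈-map⁻; ∈-deduplicate⁺; ∈-deduplicate⁻)
open import Data.List.Membership.Propositional.Properties.WithK using (unique∧set⇒bag)
import Data.List.Properties as Listₚ
open import Data.List.Relation.Binary.BagAndSetEquality using (∼bag⇒↭)
open import Data.List.Relation.Binary.Permutation.Propositional using (_↭_; ↭-refl; ↭-sym; ↭-trans; ↭-prep; ↭-swap; ↭-reflexive)
import Data.List.Relation.Binary.Permutation.Propositional.Properties as Permₚ
open import Data.List.Relation.Unary.All as All using (All; []; _∷_)
import Data.List.Relation.Unary.All.Properties as Allₚ
open import Data.List.Relation.Unary.AllPairs as AllPairs using (AllPairs; []; _∷_)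
import Data.List.Relation.Unary.AllPairs.Properties as AllPairsₚ
open import Data.List.Relation.Unary.Any as Any using (Any; here; there)
open import Data.List.Relation.Unary.Unique.DecPropositional.Properties Data.Nat._≟_ using (deduplicate-!)
open import Data.List.Relation.Unary.Unique.Propositional using (Unique)
import Data.List.Relation.Unary.Unique.Propositional.Properties as Uniqueₚ
open import Data.Nat as ℕ using (ℕ; zero; suc; _<ᵇ_)
open import Data.Nat.Induction using (<-wellFounded)
import Data.Nat.Properties as ℕₚ
open import Data.Product using (_×_; _,_; proj₁; proj₂; ∃)
open import Data.Rational as ℚ using (ℚ; 0ℚ; 1ℚ; _+_; _*_; _-_; -_; _≤_; _<_)
import Data.Rational.Properties as ℚₚ
open import Data.Rational.Solver using (module +-*-Solver)
open import Data.Sum using (_⊎_; inj₁; inj₂)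
open import Data.Unit using (tt)
open import Data.Vec as Vec using (Vec; lookup; _[_]≔_; toList)
open import Data.Vec.Membership.Propositional.Properties using (∈-toList⁺)
import Data.Vec.Properties as Vecₚ
open import Data.Vec.Properties using (≡-dec; lookup∘update; lookup∘update′; []≔-idempotent; []≔-commutes; []≔-lookup)
import Data.Vec.Relation.Unary.Any as VecAny
open import Function using (_∘_; id; mk⇔)
open import Induction.WellFounded using (Acc; acc)
open import Relation.Binary.Definitions using (tri<; tri≈; tri>)
open import Relation.Binary.PropositionalEquality
open import Relation.Nullary using (¬_; Dec; does; yes; no)
open +-*-Solver using (solve; _:+_; _:*_; _:-_; :-_; _:=_; con)

-- Local exchange relations

-- Bells and T act on observables, and weights enter only through sums against a test function. The
-- weights that Λ transports are not known to be nonnegative, since T has a negative coefficient;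
-- hence stationarity is used in a weak form without a sign condition, and uniqueness is proved for
-- signed weights.
--
-- The obstacle in the strand picture is that a cascade chooses its sites by the configuration
-- before the bell, while a strand sees the current one. The choices agree away from the site of the
-- bell, where the ring is cut: a site that has been refilled carried before, and carries now, a
-- species not below the active one.
--
-- The vacancy is what makes a harmonic function determined by its values at strand 0: on each turn
-- an active strand would have to pass a vacancy, so it returns unchanged with probability at most t
-- < 1.
--
-- For bells at i and i + 1 themselves the cut separates the two sites, so that the Yang-Baxter
-- relation does not apply; there the required harmonic functions are written down explicitly.

<ᵇ-true⁻ : ∀ {m n} → (m <ᵇ n) ≡ true → m ℕ.< n
<ᵇ-true⁻ {m} {n} e = ℕₚ.<ᵇ⇒< m n (subst IsTrue (sym e) tt)

<ᵇ-true : ∀ {m n} → m ℕ.< n → (m <ᵇ n) ≡ true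
<ᵇ-true {m} {n} m<n with m <ᵇ n | ℕₚ.<⇒<ᵇ m<n
... | true | _ = refl

<ᵇ-false : ∀ {m n} → n ℕ.≤ m → (m <ᵇ n) ≡ false
<ᵇ-false {m} {n} n≤m with m <ᵇ n in e
... | false = refl
... | true  = ⊥-elim (ℕₚ.<⇒≱ (<ᵇ-true⁻ {m} {n} e) n≤m)

<ᵇ-false⁻ : ∀ {m n} → (m <ᵇ n) ≡ false → n ℕ.≤ m
<ᵇ-false⁻ {m} {n} e = ℕₚ.≮⇒≥ λ lt → absurd (trans (sym e) (<ᵇ-true lt))
  where
  absurd : false ≢ true
  absurd ()

<ᵇ-irrefl : ∀ m → (m <ᵇ m) ≡ false
<ᵇ-irrefl m = <ᵇ-false {m} {m} ℕₚ.≤-refl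

-- A strand of species r meets a site of species a; the arguments of Ψ are the
-- species of the outgoing strand and the new species of the site.
hop : ℚ → (ℕ → ℕ → ℚ) → ℕ → ℕ → ℚ
hop t Ψ r a = if a <ᵇ r then (1ℚ - t) * Ψ a r + t * Ψ r a else Ψ r a

-- The Hecke generator, with quadratic relation (T - t)(T + 1) = 0, acting on
-- functions of the species at two adjacent sites.
hecke : ℚ → (ℕ → ℕ → ℚ) → ℕ → ℕ → ℚ
hecke t Ψ a b = if a <ᵇ b then Ψ b a - (1ℚ - t) * Ψ a b else t * Ψ b a

hop-cong : ∀ t {Ψ Φ : ℕ → ℕ → ℚ} → (∀ r a → Ψ r a ≡ Φ r a) → ∀ r a → hop t Ψ r a ≡ hop t Φ r a
hop-cong t e r a with a <ᵇ r
... | true  = cong₂ _+_ (cong ((1ℚ - t) *_) (e a r)) (cong (t *_) (e r a))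
... | false = e r a

hecke-cong : ∀ t {Ψ Φ : ℕ → ℕ → ℚ} → (∀ a b → Ψ a b ≡ Φ a b) → ∀ a b → hecke t Ψ a b ≡ hecke t Φ a b
hecke-cong t e a b with a <ᵇ b
... | true  = cong₂ _-_ (e b a) (cong ((1ℚ - t) *_) (e a b))
... | false = cong (t *_) (e b a)

hop-linear : ∀ t α β (Ψ Φ : ℕ → ℕ → ℚ) r a →
  hop t (λ s v → α * Ψ s v + β * Φ s v) r a ≡ α * hop t Ψ r a + β * hop t Φ r a
hop-linear t α β Ψ Φ r a with a <ᵇ r
... | false = refl
... | true  = solve 7 (λ t α β p q u v →
    (con 1ℚ :- t) :* (α :* p :+ β :* u) :+ t :* (α :* q :+ β :* v)
    := α :* ((con 1ℚ :- t) :* p :+ t :* q) :+ β :* ((con 1ℚ :- t) :* u :+ t :* v))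
  refl t α β (Ψ a r) (Ψ r a) (Φ a r) (Φ r a)

hecke-linear : ∀ t α β (Ψ Φ : ℕ → ℕ → ℚ) a b →
  hecke t (λ s v → α * Ψ s v + β * Φ s v) a b ≡ α * hecke t Ψ a b + β * hecke t Φ a b
hecke-linear t α β Ψ Φ a b with a <ᵇ b
... | false = solve 5 (λ t α β p q → t :* (α :* p :+ β :* q) := α :* (t :* p) :+ β :* (t :* q))
  refl t α β (Ψ b a) (Φ b a)
... | true  = solve 7 (λ t α β p q u v →
    (α :* p :+ β :* u) :- (con 1ℚ :- t) :* (α :* q :+ β :* v)
    := α :* (p :- (con 1ℚ :- t) :* q) :+ β :* (u :- (con 1ℚ :- t) :* v))
  refl t α β (Ψ b a) (Ψ a b) (Φ b a) (Φ a b)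

hecke-hop-commute : ∀ t (Ψ : ℕ → ℕ → ℕ → ℕ → ℚ) r q a b →
  hop t (λ s v → hecke t (Ψ s v) a b) r q ≡ hecke t (λ a′ b′ → hop t (λ s v → Ψ s v a′ b′) r q) a b
hecke-hop-commute t Ψ r q a b with q <ᵇ r
... | false = refl
... | true  = sym (hecke-linear t (1ℚ - t) t (Ψ q r) (Ψ r q) a b)

-- hecke is t times the inverse of hop once strand and site are exchanged.
hecke∘hop : ∀ t (Γ : ℕ → ℕ → ℚ) a b → hecke t (hop t Γ) a b ≡ t * Γ b a
hecke∘hop t Γ a b with ℕₚ.<-cmp a b
... | tri< a<b _ _ rewrite <ᵇ-true a<b | <ᵇ-false {b} {a} (ℕₚ.<⇒≤ a<b) =
  solve 3 (λ t p q → ((con 1ℚ :- t) :* p :+ t :* q) :- (con 1ℚ :- t) :* p := t :* q)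
    refl t (Γ a b) (Γ b a)
... | tri≈ _ refl _ rewrite <ᵇ-irrefl a = refl
... | tri> _ _ b<a rewrite <ᵇ-false {a} {b} (ℕₚ.<⇒≤ b<a) = refl

module _ (t : ℚ) (Ψ : ℕ → ℕ → ℕ → ℚ) where

  private
    hop₁ hop₂ hecke₂ : (ℕ → ℕ → ℕ → ℚ) → ℕ → ℕ → ℕ → ℚ
    hop₁ Φ r a b = hop t (λ s v → Φ s v b) r a
    hop₂ Φ r a b = hop t (λ s v → Φ s a v) r b
    hecke₂ Φ r = hecke t (Φ r)

  -- There is one case for each of the 13 weak orderings of a, b and r. Once the comparisons are
  -- decided, both sides are combinations of values of `Ψ` at rearrangements of (r, a, b), and the
  -- coefficients agree as polynomials in t.
  yang-baxter : ∀ r a b → hop₁ (hop₂ (hecke₂ Ψ)) r a b ≡ hecke₂ (hop₁ (hop₂ Ψ)) r a b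
  yang-baxter r a b with ℕₚ.<-cmp a b | ℕₚ.<-cmp a r | ℕₚ.<-cmp b r
  ... | tri≈ _ refl _ | tri< a<r _ _ | _
      rewrite <ᵇ-irrefl a | <ᵇ-true a<r | <ᵇ-false {r} {a} (ℕₚ.<⇒≤ a<r) =
    solve 4 (λ t p q x → let c = con 1ℚ :- t in
        (c :* (t :* p) :+ t :* (c :* (q :- c :* p) :+ t :* (t :* x)))
        := (t :* (c :* q :+ t :* (c :* p :+ t :* x))))
      refl t (Ψ a a r) (Ψ a r a) (Ψ r a a)
  ... | tri≈ _ refl _ | tri≈ _ refl _ | _ rewrite <ᵇ-irrefl a = refl
  ... | tri≈ _ refl _ | tri> _ _ r<a | _ rewrite <ᵇ-false {a} {r} (ℕₚ.<⇒≤ r<a) | <ᵇ-irrefl a = refl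
  ... | tri< a<b _ _ | tri> _ _ r<a | _
      rewrite <ᵇ-false {a} {r} (ℕₚ.<⇒≤ r<a) | <ᵇ-false {b} {r} (ℕₚ.<⇒≤ (ℕₚ.<-trans r<a a<b)) | <ᵇ-true a<b = refl
  ... | tri< a<b _ _ | tri≈ _ refl _ | _
      rewrite <ᵇ-irrefl a | <ᵇ-false {b} {a} (ℕₚ.<⇒≤ a<b) | <ᵇ-true a<b = refl
  ... | tri< a<b _ _ | tri< a<r _ _ | tri> _ _ r<b
      rewrite <ᵇ-true a<b | <ᵇ-true a<r | <ᵇ-true r<b | <ᵇ-false {b} {a} (ℕₚ.<⇒≤ a<b) | <ᵇ-false {b} {r} (ℕₚ.<⇒≤ r<b) =
    solve 5 (λ t p q x y → let c = con 1ℚ :- t in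
        (c :* (p :- c :* q) :+ t :* (x :- c :* y))
        := ((c :* p :+ t :* x) :- c :* (c :* q :+ t :* y)))
      refl t (Ψ a b r) (Ψ a r b) (Ψ r b a) (Ψ r a b)
  ... | tri< a<b _ _ | tri< a<r _ _ | tri≈ _ refl _
      rewrite <ᵇ-true a<b | <ᵇ-irrefl b | <ᵇ-false {b} {a} (ℕₚ.<⇒≤ a<b) =
    solve 4 (λ t p q x → let c = con 1ℚ :- t in
        (c :* (t :* p) :+ t :* (q :- c :* x))
        := ((c :* p :+ t :* q) :- c :* (c :* p :+ t :* x)))
      refl t (Ψ a b b) (Ψ b b a) (Ψ b a b)
  ... | tri< a<b _ _ | tri< a<r _ _ | tri< b<r _ _
      rewrite <ᵇ-true a<b | <ᵇ-true a<r | <ᵇ-true b<r | <ᵇ-false {b} {a} (ℕₚ.<⇒≤ a<b) | <ᵇ-false {r} {b} (ℕₚ.<⇒≤ b<r) =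
    solve 7 (λ t p q x y z w → let c = con 1ℚ :- t in
        (c :* (t :* p) :+ t :* (c :* (q :- c :* x) :+ t :* (y :- c :* z)))
        := ((c :* (c :* w :+ t :* q) :+ t :* (c :* p :+ t :* y)) :- c :* (c :* w :+ t :* (c :* x :+ t :* z))))
      refl t (Ψ a b r) (Ψ b r a) (Ψ b a r) (Ψ r b a) (Ψ r a b) (Ψ a r b)
  ... | tri> _ _ b<a | _ | tri> _ _ r<b
      rewrite <ᵇ-false {a} {b} (ℕₚ.<⇒≤ b<a) | <ᵇ-false {a} {r} (ℕₚ.<⇒≤ (ℕₚ.<-trans r<b b<a)) | <ᵇ-false {b} {r} (ℕₚ.<⇒≤ r<b) = refl
  ... | tri> _ _ b<a | _ | tri≈ _ refl _
      rewrite <ᵇ-false {a} {b} (ℕₚ.<⇒≤ b<a) | <ᵇ-irrefl b = refl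
  ... | tri> _ _ b<a | tri> _ _ r<a | tri< b<r _ _
      rewrite <ᵇ-false {a} {b} (ℕₚ.<⇒≤ b<a) | <ᵇ-false {a} {r} (ℕₚ.<⇒≤ r<a) | <ᵇ-true b<r =
    solve 3 (λ t p q → let c = con 1ℚ :- t in
        (c :* (t :* p) :+ t :* (t :* q)) := (t :* (c :* p :+ t :* q)))
      refl t (Ψ b r a) (Ψ r b a)
  ... | tri> _ _ b<a | tri≈ _ refl _ | tri< b<r _ _
      rewrite <ᵇ-false {a} {b} (ℕₚ.<⇒≤ b<a) | <ᵇ-irrefl a | <ᵇ-true b<r =
    solve 3 (λ t p q → let c = con 1ℚ :- t in
        (c :* (t :* p) :+ t :* (t :* q)) := (t :* (c :* p :+ t :* q)))
      refl t (Ψ b a a) (Ψ a b a)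
  ... | tri> _ _ b<a | tri< a<r _ _ | tri< b<r _ _
      rewrite <ᵇ-false {a} {b} (ℕₚ.<⇒≤ b<a) | <ᵇ-true b<a | <ᵇ-true a<r | <ᵇ-true b<r
            | <ᵇ-false {r} {a} (ℕₚ.<⇒≤ a<r) | <ᵇ-false {r} {b} (ℕₚ.<⇒≤ b<r) =
    solve 5 (λ t p q x y → let c = con 1ℚ :- t in
        (c :* (c :* (t :* p) :+ t :* (t :* q)) :+ t :* (c :* (x :- c :* p) :+ t :* (t :* y)))
        := (t :* (c :* x :+ t :* (c :* q :+ t :* y))))
      refl t (Ψ b a r) (Ψ a b r) (Ψ b r a) (Ψ r b a)

-- Sweeps of a strand and the Hecke action on configurations

-- A function of the species of the active strand and of the configuration.
StrandFn : ℕ → Set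
StrandFn n = ℕ → Config n → ℚ

hopAt : ∀ {n} → ℚ → Fin n → StrandFn n → StrandFn n
hopAt t q F r η = hop t (λ s v → F s (η [ q ]≔ v)) r (lookup η q)

-- The head of the list is met first. The value is the expectation of `F` after the strand has
-- passed all the sites, as a function of the state before.
sweep : ∀ {n} → ℚ → StrandFn n → List (Fin n) → StrandFn n
sweep t F []       = F
sweep t F (q ∷ qs) = hopAt t q (sweep t F qs)

heckeAt : ∀ {n} → ℚ → Fin n → Fin n → (Config n → ℚ) → Config n → ℚ
heckeAt t i j G η = hecke t (λ a b → G ((η [ i ]≔ a) [ j ]≔ b)) (lookup η i) (lookup η j)

module _ {n : ℕ} (t : ℚ) where

  hopAt-cong : ∀ q {F G : StrandFn n} → (∀ r η → F r η ≡ G r η) → ∀ r η → hopAt t q F r η ≡ hopAt t q G r η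
  hopAt-cong q e r η = hop-cong t (λ s v → e s _) r (lookup η q)

  sweep-cong : ∀ qs {F G : StrandFn n} → (∀ r η → F r η ≡ G r η) → ∀ r η → sweep t F qs r η ≡ sweep t G qs r η
  sweep-cong []       e = e
  sweep-cong (q ∷ qs) e = hopAt-cong q (sweep-cong qs e)

  sweep-++ : ∀ ps qs (F : StrandFn n) r η → sweep t F (ps ++ qs) r η ≡ sweep t (sweep t F qs) ps r η
  sweep-++ []       qs F r η = refl
  sweep-++ (p ∷ ps) qs F r η = hopAt-cong p (sweep-++ ps qs F) r η

  sweep-linear : ∀ qs α β (F G : StrandFn n) r η →
    sweep t (λ s ξ → α * F s ξ + β * G s ξ) qs r η ≡ α * sweep t F qs r η + β * sweep t G qs r η
  sweep-linear []       α β F G r η = refl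
  sweep-linear (q ∷ qs) α β F G r η = trans
    (hopAt-cong q (sweep-linear qs α β F G) r η)
    (hop-linear t α β (λ s v → sweep t F qs s (η [ q ]≔ v)) (λ s v → sweep t G qs s (η [ q ]≔ v)) r (lookup η q))

  hopAt-keep : ∀ q (F : StrandFn n) r η → (lookup η q <ᵇ r) ≡ false → hopAt t q F r η ≡ F r η
  hopAt-keep q F r η eq rewrite eq = cong (F r) ([]≔-lookup η q)

  hopAt-swap : ∀ q (F : StrandFn n) r η → (lookup η q <ᵇ r) ≡ true →
    hopAt t q F r η ≡ (1ℚ - t) * F (lookup η q) (η [ q ]≔ r) + t * F r η
  hopAt-swap q F r η eq rewrite eq = cong (λ ξ → (1ℚ - t) * F (lookup η q) (η [ q ]≔ r) + t * F r ξ) ([]≔-lookup η q)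

  sweep-vacancy : ∀ qs (F : StrandFn n) η → sweep t F qs 0 η ≡ F 0 η
  sweep-vacancy []       F η = refl
  sweep-vacancy (q ∷ qs) F η = trans (hopAt-keep q (sweep t F qs) 0 η refl) (sweep-vacancy qs F η)

  -- Used for maps `f` that reset one site or copy one site into another: a sweep over sites that
  -- `f` neither changes nor reads commutes with `f`.
  sweep-substitute : ∀ qs (F : StrandFn n) (f : Config n → Config n) →
    (∀ η → All (λ q → lookup (f η) q ≡ lookup η q × (∀ v → f (η [ q ]≔ v) ≡ f η [ q ]≔ v)) qs) →
    ∀ r η → sweep t (λ s ξ → F s (f ξ)) qs r η ≡ sweep t F qs r (f η)
  sweep-substitute []       F f h r η = refl
  sweep-substitute (q ∷ qs) F f h r η with h η
  ... | (hl , hu) ∷ _ = trans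
    (hopAt-cong q (sweep-substitute qs F f (λ ξ → All.tail (h ξ))) r η)
    (trans (hop-cong t (λ s v → cong (sweep t F qs s) (hu v)) r (lookup η q))
           (cong (hop t (λ s v → sweep t F qs s (f η [ q ]≔ v)) r) (sym hl)))

  module _ {i j : Fin n} (i≢j : i ≢ j) where

    private
      j≢i : j ≢ i
      j≢i = i≢j ∘ sym

    lookup-i : ∀ (η : Config n) a b → lookup ((η [ i ]≔ a) [ j ]≔ b) i ≡ a
    lookup-i η a b = trans (lookup∘update′ i≢j (η [ i ]≔ a) b) (lookup∘update i η a)

    update-ij : ∀ (η : Config n) a b c d →
      (((η [ i ]≔ a) [ j ]≔ b) [ i ]≔ c) [ j ]≔ d ≡ (η [ i ]≔ c) [ j ]≔ d
    update-ij η a b c d =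
      trans (cong (_[ j ]≔ d) (trans ([]≔-commutes (η [ i ]≔ a) j i j≢i)
                                     (cong (_[ j ]≔ b) ([]≔-idempotent η i))))
            ([]≔-idempotent (η [ i ]≔ c) j)

    update-lookup : ∀ (η : Config n) → (η [ i ]≔ lookup η i) [ j ]≔ lookup η j ≡ η
    update-lookup η = trans (cong (_[ j ]≔ lookup η j) ([]≔-lookup η i)) ([]≔-lookup η j)

    heckeAt-update : ∀ G (η : Config n) a b →
      heckeAt t i j G ((η [ i ]≔ a) [ j ]≔ b) ≡ hecke t (λ c d → G ((η [ i ]≔ c) [ j ]≔ d)) a b
    heckeAt-update G η a b = trans
      (cong₂ (hecke t (λ c d → G ((((η [ i ]≔ a) [ j ]≔ b) [ i ]≔ c) [ j ]≔ d))) (lookup-i η a b) (lookup∘update j (η [ i ]≔ a) b))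
      (hecke-cong t (λ c d → cong G (update-ij η a b c d)) a b)

    hop-pair-update : ∀ (F : StrandFn n) r η a b →
      hopAt t i (hopAt t j F) r ((η [ i ]≔ a) [ j ]≔ b)
        ≡ hop t (λ s c → hop t (λ s′ d → F s′ ((η [ i ]≔ c) [ j ]≔ d)) s b) r a
    hop-pair-update F r η a b = trans
      (cong (hop t (λ s v → hopAt t j F s (((η [ i ]≔ a) [ j ]≔ b) [ i ]≔ v)) r) (lookup-i η a b))
      (hop-cong t (λ s v → trans
        (cong (hop t (λ s′ d → F s′ ((((η [ i ]≔ a) [ j ]≔ b) [ i ]≔ v) [ j ]≔ d)) s)
              (trans (lookup∘update′ j≢i ((η [ i ]≔ a) [ j ]≔ b) v) (lookup∘update j (η [ i ]≔ a) b)))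
        (hop-cong t (λ s′ d → cong (F s′) (update-ij η a b v d)) s b)) r a)

    heckeAt-pair : ∀ (F : StrandFn n) r η →
      hopAt t i (hopAt t j (λ s → heckeAt t i j (F s))) r η ≡ heckeAt t i j (hopAt t i (hopAt t j F) r) η
    heckeAt-pair F r η = trans
      (cong (hopAt t i (hopAt t j (λ s → heckeAt t i j (F s))) r) (sym (update-lookup η)))
      (trans (hop-pair-update (λ s → heckeAt t i j (F s)) r η a b)
      (trans (hop-cong t (λ s c → hop-cong t (λ s′ d → heckeAt-update (F s′) η c d) s b) r a)
      (trans (yang-baxter t (λ s c d → F s ((η [ i ]≔ c) [ j ]≔ d)) r a b)
             (sym (hecke-cong t (λ c d → hop-pair-update F r η c d) a b)))))
      where a = lookup η i
            b = lookup η j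

    heckeAt-hopAt : ∀ {q} → q ≢ i → q ≢ j → ∀ (F : StrandFn n) r η →
      hopAt t q (λ s → heckeAt t i j (F s)) r η ≡ heckeAt t i j (hopAt t q F r) η
    heckeAt-hopAt {q} q≢i q≢j F r η = trans
      (hop-cong t (λ s v → cong₂ (hecke t (λ a b → F s (((η [ q ]≔ v) [ i ]≔ a) [ j ]≔ b))) (lookup∘update′ (q≢i ∘ sym) η v) (lookup∘update′ (q≢j ∘ sym) η v)) r c)
      (trans (hecke-hop-commute t (λ s v a b → F s (((η [ q ]≔ v) [ i ]≔ a) [ j ]≔ b)) r c (lookup η i) (lookup η j))
             (hecke-cong t (λ a b → trans
               (hop-cong t (λ s v → cong (F s) (commute v a b)) r c)
               (cong (hop t (λ s v → F s (((η [ i ]≔ a) [ j ]≔ b) [ q ]≔ v)) r) (sym (lookup-far a b)))) _ _))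
      where
      c = lookup η q
      lookup-far : ∀ a b → lookup ((η [ i ]≔ a) [ j ]≔ b) q ≡ c
      lookup-far a b = trans (lookup∘update′ q≢j (η [ i ]≔ a) b) (lookup∘update′ q≢i η a)
      commute : ∀ v a b → ((η [ q ]≔ v) [ i ]≔ a) [ j ]≔ b ≡ ((η [ i ]≔ a) [ j ]≔ b) [ q ]≔ v
      commute v a b = trans (cong (_[ j ]≔ b) ([]≔-commutes η q i q≢i)) ([]≔-commutes (η [ i ]≔ a) q j q≢j)

    heckeAt-sweep-far : ∀ qs → All (λ q → q ≢ i × q ≢ j) qs → ∀ (F : StrandFn n) r η →
      sweep t (λ s → heckeAt t i j (F s)) qs r η ≡ heckeAt t i j (sweep t F qs r) η
    heckeAt-sweep-far []       []                F r η = refl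
    heckeAt-sweep-far (q ∷ qs) ((q≢i , q≢j) ∷ h) F r η = trans
      (hopAt-cong q (heckeAt-sweep-far qs h F) r η) (heckeAt-hopAt q≢i q≢j (sweep t F qs) r η)

    heckeAt-cong : ∀ {F G : Config n → ℚ} → (∀ η → F η ≡ G η) → ∀ η → heckeAt t i j F η ≡ heckeAt t i j G η
    heckeAt-cong e η = hecke-cong t (λ a b → e ((η [ i ]≔ a) [ j ]≔ b)) (lookup η i) (lookup η j)

    -- Yang-Baxter is needed only where the strand passes i and j in immediate succession; at all
    -- other sites the two operators act on disjoint coordinates. This covers a ring cut at any site
    -- other than these two.
    heckeAt-sweep : ∀ ps qs → All (λ q → q ≢ i × q ≢ j) ps → All (λ q → q ≢ i × q ≢ j) qs → ∀ (F : StrandFn n) r η →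
      sweep t (λ s → heckeAt t i j (F s)) (ps ++ i ∷ j ∷ qs) r η ≡ heckeAt t i j (sweep t F (ps ++ i ∷ j ∷ qs) r) η
    heckeAt-sweep ps qs hp hq F r η = trans (sweep-++ ps (i ∷ j ∷ qs) _ r η)
      (trans (sweep-cong ps (λ s ξ → trans
               (hopAt-cong i (hopAt-cong j (heckeAt-sweep-far qs hq F)) s ξ)
               (heckeAt-pair (sweep t F qs) s ξ)) r η)
      (trans (heckeAt-sweep-far ps hp (sweep t F (i ∷ j ∷ qs)) r η)
             (heckeAt-cong (λ ξ → sym (sweep-++ ps (i ∷ j ∷ qs) F r ξ)) η)))

-- Maximum principle for strand functions

+-nonNeg : ∀ {p q} → 0ℚ ≤ p → 0ℚ ≤ q → 0ℚ ≤ p + q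
+-nonNeg = ℚₚ.+-mono-≤

*-nonNeg : ∀ {p q} → 0ℚ ≤ p → 0ℚ ≤ q → 0ℚ ≤ p * q
*-nonNeg {p} {q} 0≤p 0≤q =
  subst (_≤ p * q) (ℚₚ.*-zeroʳ p) (ℚₚ.*-monoˡ-≤-nonNeg p {{ℚ.nonNegative 0≤p}} 0≤q)

*-pos : ∀ {p q} → 0ℚ < p → 0ℚ < q → 0ℚ < p * q
*-pos {p} {q} 0<p 0<q =
  subst (_< p * q) (ℚₚ.*-zeroʳ p) (ℚₚ.*-monoʳ-<-pos p {{ℚ.positive 0<p}} 0<q)

p≤q⇒0≤q-p : ∀ {p q} → p ≤ q → 0ℚ ≤ q - p
p≤q⇒0≤q-p {p} {q} p≤q = subst (_≤ q - p) (ℚₚ.+-inverseʳ p) (ℚₚ.+-monoˡ-≤ (- p) p≤q)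

p<q⇒0<q-p : ∀ {p q} → p < q → 0ℚ < q - p
p<q⇒0<q-p {p} {q} p<q = subst (_< q - p) (ℚₚ.+-inverseʳ p) (ℚₚ.+-monoˡ-< (- p) p<q)

0≤q-p⇒p≤q : ∀ {p q} → 0ℚ ≤ q - p → p ≤ q
0≤q-p⇒p≤q {p} {q} h = subst₂ _≤_ (ℚₚ.+-identityˡ p)
  (solve 2 (λ p q → (q :- p) :+ p := q) refl p q) (ℚₚ.+-monoˡ-≤ p h)

*-cancel-nonNeg : ∀ {r p} → 0ℚ < r → 0ℚ ≤ r * p → 0ℚ ≤ p
*-cancel-nonNeg {r} {p} 0<r h =
  ℚₚ.*-cancelˡ-≤-pos r {{ℚ.positive 0<r}} (subst (_≤ r * p) (sym (ℚₚ.*-zeroʳ r)) h)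

*-cancel-zero : ∀ {r p} → r ≢ 0ℚ → r * p ≡ 0ℚ → p ≡ 0ℚ
*-cancel-zero {r} {p} r≢0 h = begin
  p                   ≡⟨ sym (ℚₚ.*-identityˡ p) ⟩
  1ℚ * p              ≡⟨ cong (_* p) (sym (ℚₚ.*-inverseˡ r)) ⟩
  (ℚ.1/ r) * r * p    ≡⟨ ℚₚ.*-assoc (ℚ.1/ r) r p ⟩
  (ℚ.1/ r) * (r * p)  ≡⟨ cong ((ℚ.1/ r) *_) h ⟩
  (ℚ.1/ r) * 0ℚ       ≡⟨ ℚₚ.*-zeroʳ (ℚ.1/ r) ⟩
  0ℚ                  ∎
  where
  open ≡-Reasoning
  instance _ = ℚ.≢-nonZero r≢0

-- `Dom` will be the condition of fixed content. Hops preserve it, and while the strand is active it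
-- guarantees a vacancy among the sites of `qs`, so that a turn loses mass.
module _ {n : ℕ} (t : ℚ) (0≤t : 0ℚ ≤ t) (t<1 : t < 1ℚ) (qs : List (Fin n))
  (Dom : ℕ → Config n → Set)
  (Dom-hop : ∀ {s η q} → q ∈ qs → lookup η q ℕ.< s → Dom s η → Dom (lookup η q) (η [ q ]≔ s))
  (Dom-vacancy : ∀ {s η} → Dom (suc s) η → Any (λ q → lookup η q ≡ 0) qs)
  where

  private
    0≤1-t : 0ℚ ≤ 1ℚ - t
    0≤1-t = p≤q⇒0≤q-p (ℚₚ.<⇒≤ t<1)

  NonNegBelow : (ℕ → Set) → StrandFn n → Set
  NonNegBelow P F = ∀ {s η} → P s → Dom s η → 0ℚ ≤ F s η

  sweep-nonNeg : ∀ (F : StrandFn n) ps → All (_∈ qs) ps → ∀ {s η} → NonNegBelow (ℕ._≤ s) F → Dom s η →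
    0ℚ ≤ sweep t F ps s η
  sweep-nonNeg F []       []         h d = h ℕₚ.≤-refl d
  sweep-nonNeg F (q ∷ ps) (q∈ ∷ ps⊆) {s} {η} h d with lookup η q <ᵇ s in eq
  ... | false rewrite []≔-lookup η q = sweep-nonNeg F ps ps⊆ h d
  ... | true rewrite []≔-lookup η q = +-nonNeg
    (*-nonNeg 0≤1-t (sweep-nonNeg F ps ps⊆ (λ le → h (ℕₚ.≤-trans le (ℕₚ.<⇒≤ q<s))) (Dom-hop q∈ q<s d)))
    (*-nonNeg 0≤t (sweep-nonNeg F ps ps⊆ h d))
    where q<s = <ᵇ-true⁻ eq

  -- The strand returns unchanged with some probability c; whenever it can meet a
  -- vacancy, it does so with probability at most t.
  record Return (F : StrandFn n) (ps : List (Fin n)) (s : ℕ) (η : Config n) : Set where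
    field
      X c     : ℚ
      0≤X     : 0ℚ ≤ X
      c≤1     : c ≤ 1ℚ
      c≤t     : 0 ℕ.< s → Any (λ q → lookup η q ≡ 0) ps → c ≤ t
      split   : sweep t F ps s η ≡ X + c * F s η

  -- A strand that settles leaves with a smaller species and cannot regain s, so its share belongs
  -- to `X` and is nonnegative by hypothesis. Passing a lower site costs a factor t, and a vacancy
  -- is lower than any active strand, whence c ≤ t.
  sweep-return : ∀ (F : StrandFn n) ps → All (_∈ qs) ps → ∀ {s η} → NonNegBelow (ℕ._< s) F → Dom s η →
    Return F ps s η
  sweep-return F [] [] {s} {η} h d = record
    { X = 0ℚ ; c = 1ℚ ; 0≤X = ℚₚ.≤-refl ; c≤1 = ℚₚ.≤-refl
    ; c≤t = λ _ () ; split = solve 1 (λ f → f := con 0ℚ :+ con 1ℚ :* f) refl (F s η) }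
  sweep-return F (q ∷ ps) (q∈ ∷ ps⊆) {s} {η} h d with lookup η q <ᵇ s in eq | sweep-return F ps ps⊆ h d
  ... | false | R = record
    { Return R ; c≤t = λ { 0<s (here e) → ⊥-elim (contra 0<s e) ; 0<s (there v) → Return.c≤t R 0<s v }
    ; split = trans (hopAt-keep t q (sweep t F ps) s η eq) (Return.split R) }
    where
    contra : 0 ℕ.< s → lookup η q ≢ 0
    contra 0<s e with trans (sym eq) (<ᵇ-true (subst (ℕ._< s) (sym e) 0<s))
    ... | ()
  ... | true | R = record
    { X = (1ℚ - t) * Y + t * X ; c = t * c
    ; 0≤X = +-nonNeg (*-nonNeg 0≤1-t 0≤Y) (*-nonNeg 0≤t 0≤X)
    ; c≤1 = ℚₚ.≤-trans tc≤t (ℚₚ.<⇒≤ t<1) ; c≤t = λ _ _ → tc≤t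
    ; split = trans (hopAt-swap t q (sweep t F ps) s η eq)
        (trans (cong (λ z → (1ℚ - t) * Y + t * z) split)
          (solve 5 (λ t Y X c f → (con 1ℚ :- t) :* Y :+ t :* (X :+ c :* f)
                    := ((con 1ℚ :- t) :* Y :+ t :* X) :+ (t :* c) :* f) refl t Y X c (F s η))) }
    where
    open Return R using (X; c; 0≤X; c≤1; split)
    q<s = <ᵇ-true⁻ eq
    Y = sweep t F ps (lookup η q) (η [ q ]≔ s)
    0≤Y : 0ℚ ≤ Y
    0≤Y = sweep-nonNeg F ps ps⊆ (λ le → h (ℕₚ.≤-<-trans le q<s)) (Dom-hop q∈ q<s d)
    tc≤t : t * c ≤ t
    tc≤t = subst (t * c ≤_) (ℚₚ.*-identityʳ t) (ℚₚ.*-monoˡ-≤-nonNeg t {{ℚ.nonNegative 0≤t}} c≤1)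

  Harmonic : StrandFn n → Set
  Harmonic F = ∀ {s η} → Dom s η → F s η ≡ sweep t F qs s η

  -- Strong induction on the species s. The induction hypothesis is what `sweep-return` asks for
  -- below s, so harmonicity reads f = X + c f with X ≥ 0 and c ≤ t < 1, and (1 - c) f = X gives the
  -- sign.
  minimum-principle : ∀ (F : StrandFn n) → Harmonic F → NonNegBelow (_≡ 0) F → ∀ {s η} → Dom s η → 0ℚ ≤ F s η
  minimum-principle F fix h₀ {s} = go s (<-wellFounded s)
    where
    go : ∀ s → Acc ℕ._<_ s → ∀ {η} → Dom s η → 0ℚ ≤ F s η
    go zero    _         d = h₀ refl d
    go (suc s) (acc rec) {η} d = *-cancel-nonNeg (p<q⇒0<q-p (ℚₚ.≤-<-trans (c≤t (ℕ.s≤s ℕ.z≤n) (Dom-vacancy d)) t<1))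
      (subst (0ℚ ≤_) (begin
        X                                ≡⟨ solve 3 (λ X c f → X := (X :+ c :* f) :- c :* f) refl X c f ⟩
        (X + c * f) - c * f              ≡⟨ cong (_- c * f) (sym (trans (fix d) split)) ⟩
        f - c * f                        ≡⟨ solve 2 (λ c f → f :- c :* f := (con 1ℚ :- c) :* f) refl c f ⟩
        (1ℚ - c) * f                     ∎) 0≤X)
      where
      open ≡-Reasoning
      f = F (suc s) η
      open Return (sweep-return F qs (All.tabulate id) (λ {s′} lt → go s′ (rec lt)) d)

  harmonic-unique : ∀ (F G : StrandFn n) → Harmonic F → Harmonic G → (∀ {η} → Dom 0 η → F 0 η ≡ G 0 η) →
    ∀ {s η} → Dom s η → F s η ≡ G s η
  harmonic-unique F G hF hG h₀ d = ℚₚ.≤-antisym (one-sided F G hF hG h₀ d) (one-sided G F hG hF (sym ∘ h₀) d)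
    where
    one-sided : ∀ (F G : StrandFn n) → Harmonic F → Harmonic G → (∀ {η} → Dom 0 η → F 0 η ≡ G 0 η) →
      ∀ {s η} → Dom s η → F s η ≤ G s η
    one-sided F G hF hG h₀ {s} {η} d = 0≤q-p⇒p≤q (subst (0ℚ ≤_) (comb (G s η) (F s η))
      -- The difference G - F, in the shape that `sweep-linear` handles.
      (minimum-principle (λ s η → 1ℚ * G s η + (- 1ℚ) * F s η)
        (λ {s} {η} d → trans (cong₂ (λ x y → 1ℚ * x + (- 1ℚ) * y) (hG d) (hF d))
                             (sym (sweep-linear t qs 1ℚ (- 1ℚ) G F s η)))
        (λ { {_} {η} refl d → subst (0ℚ ≤_) (zeroed (h₀ d)) ℚₚ.≤-refl }) d))
      where
      comb : ∀ x y → 1ℚ * x + (- 1ℚ) * y ≡ x - y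
      comb = solve 2 (λ x y → con 1ℚ :* x :+ con (- 1ℚ) :* y := x :- y) refl
      zeroed : ∀ {x y} → y ≡ x → 0ℚ ≡ 1ℚ * x + (- 1ℚ) * y
      zeroed {x} refl = solve 1 (λ x → con 0ℚ := con 1ℚ :* x :+ con (- 1ℚ) :* x) refl x

-- The cascade as a harmonic strand function

mean : ∀ {n} → Outcomes n → (Config n → ℚ) → ℚ
mean []             g = 0ℚ
mean ((w , ζ) ∷ os) g = w * g ζ + mean os g

mean-++ : ∀ {n} (os os′ : Outcomes n) g → mean (os ++ os′) g ≡ mean os g + mean os′ g
mean-++ []             os′ g = sym (ℚₚ.+-identityˡ (mean os′ g))
mean-++ ((w , ζ) ∷ os) os′ g = trans (cong (w * g ζ +_) (mean-++ os os′ g)) (sym (ℚₚ.+-assoc (w * g ζ) (mean os g) (mean os′ g)))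

mean-scale : ∀ {n} w (os : Outcomes n) g → mean (scale w os) g ≡ w * mean os g
mean-scale w []             g = sym (ℚₚ.*-zeroʳ w)
mean-scale w ((v , ζ) ∷ os) g = trans (cong₂ _+_ (ℚₚ.*-assoc w v (g ζ)) (mean-scale w os g)) (sym (ℚₚ.*-distribˡ-+ w (v * g ζ) (mean os g)))

/'-* : ∀ p {q} → q ≢ 0ℚ → (p /' q) * q ≡ p
/'-* p {q} q≢0 with q ℚₚ.≟ 0ℚ
... | yes q≡0 = ⊥-elim (q≢0 q≡0)
... | no  q≢0 = trans (ℚₚ.*-assoc p (ℚ.1/ q) q) (trans (cong (p *_) (ℚₚ.*-inverseˡ q)) (ℚₚ.*-identityʳ p))
  where instance _ = ℚ.≢-nonZero q≢0

^-+ : ∀ t a b → t ^ (a ℕ.+ b) ≡ t ^ a * t ^ b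
^-+ t zero    b = sym (ℚₚ.*-identityˡ (t ^ b))
^-+ t (suc a) b = trans (cong (t *_) (^-+ t a b)) (sym (ℚₚ.*-assoc t (t ^ a) (t ^ b)))

^-nonNeg : ∀ {t} → 0ℚ ≤ t → ∀ m → 0ℚ ≤ t ^ m
^-nonNeg 0≤t zero    = ℚₚ.<⇒≤ (ℚₚ.positive⁻¹ 1ℚ)
^-nonNeg 0≤t (suc m) = *-nonNeg 0≤t (^-nonNeg 0≤t m)

qint-telescope : ∀ t m → (1ℚ - t) * qint t m ≡ 1ℚ - t ^ m
qint-telescope t zero    = ℚₚ.*-zeroʳ (1ℚ - t)
qint-telescope t (suc m) = trans (ℚₚ.*-distribˡ-+ (1ℚ - t) (t ^ m) (qint t m))
  (trans (cong ((1ℚ - t) * t ^ m +_) (qint-telescope t m))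
    (solve 2 (λ t u → (con 1ℚ :- t) :* u :+ (con 1ℚ :- u) := con 1ℚ :- t :* u) refl t (t ^ m)))

qint-positive : ∀ {t} → 0ℚ ≤ t → ∀ m → 0ℚ < qint t (suc m)
qint-positive {t} 0≤t zero    = subst (0ℚ <_) (sym (ℚₚ.+-identityʳ 1ℚ)) (ℚₚ.positive⁻¹ 1ℚ)
qint-positive {t} 0≤t (suc m) = ℚₚ.+-mono-≤-< (^-nonNeg 0≤t (suc m)) (qint-positive 0≤t m)

lower : ∀ {n} → Config n → ℕ → List (Fin n) → List (Fin n)
lower η r = filter (λ i → lookup η i ℕ.<? r)

lower-++ : ∀ {n} (η : Config n) r ps qs → lower η r (ps ++ qs) ≡ lower η r ps ++ lower η r qs
lower-++ η r = Listₚ.filter-++ (λ i → lookup η i ℕ.<? r)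

lower-reject : ∀ {n} (η : Config n) r q ps → r ℕ.≤ lookup η q → lower η r (q ∷ ps) ≡ lower η r ps
lower-reject η r q ps r≤ = Listₚ.filter-reject (λ i → lookup η i ℕ.<? r) {x = q} {xs = ps} (ℕₚ.≤⇒≯ r≤)

lower-cong : ∀ {n} (η ξ : Config n) r ps → All (λ q → (lookup η q <ᵇ r) ≡ (lookup ξ q <ᵇ r)) ps → lower η r ps ≡ lower ξ r ps
lower-cong η ξ r []       []      = refl
lower-cong η ξ r (q ∷ ps) (e ∷ es) with lookup η q <ᵇ r | lookup ξ q <ᵇ r | e
... | true  | _ | refl = cong (q ∷_) (lower-cong η ξ r ps es)
... | false | _ | refl = lower-cong η ξ r ps es

mean-choices-++ : ∀ {n} f t (η cur : Config n) r m k is js g →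
  mean (choices f t η cur r m k (is ++ js)) g
    ≡ mean (choices f t η cur r m k is) g + mean (choices f t η cur r m (k ℕ.+ length is) js) g
mean-choices-++ f t η cur r m k []       js g rewrite ℕₚ.+-identityʳ k = sym (ℚₚ.+-identityˡ _)
mean-choices-++ f t η cur r m k (i ∷ is) js g rewrite ℕₚ.+-suc k (length is) =
  trans (mean-++ (step f t η (cur [ i ]≔ r) i (lookup η i) ((t ^ k) /' qint t m)) _ g)
  (trans (cong (x +_) (mean-choices-++ f t η cur r m (suc k) is js g))
  (trans (sym (ℚₚ.+-assoc x y _))
         (cong (_+ _) (sym (mean-++ (step f t η (cur [ i ]≔ r) i (lookup η i) ((t ^ k) /' qint t m)) _ g)))))
  where
  x = mean (step f t η (cur [ i ]≔ r) i (lookup η i) ((t ^ k) /' qint t m)) g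
  y = mean (choices f t η cur r m (suc k) is) g

-- Σ over the sites q of ps that the strand may occupy, the k-th one weighted by
-- t^(k-1), of the sweep that the particle displaced from q makes over the sites of ps
-- and qs after q.
landing : ∀ {n} → ℚ → StrandFn n → List (Fin n) → List (Fin n) → StrandFn n
landing t F qs []       r η = 0ℚ
landing t F qs (q ∷ ps) r η =
  if lookup η q <ᵇ r then sweep t F (ps ++ qs) (lookup η q) (η [ q ]≔ r) + t * landing t F qs ps r η
                     else landing t F qs ps r η

-- The strand settles at the k-th lower site of `ps` with probability (1 - t) t^(k-1), and passes
-- them all with probability t to the power of their number.
sweep-landing : ∀ {n} t (F : StrandFn n) qs ps r η →
  sweep t F (ps ++ qs) r η ≡ (1ℚ - t) * landing t F qs ps r η + t ^ length (lower η r ps) * sweep t F qs r η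
sweep-landing t F qs [] r η = solve 2 (λ t x → x := (con 1ℚ :- t) :* con 0ℚ :+ con 1ℚ :* x) refl t (sweep t F qs r η)
sweep-landing t F qs (q ∷ ps) r η rewrite []≔-lookup η q with lookup η q <ᵇ r
... | false = sweep-landing t F qs ps r η
... | true  = (trans (cong (λ z → (1ℚ - t) * y + t * z) (sweep-landing t F qs ps r η))
    (solve 5 (λ t y l u f → (con 1ℚ :- t) :* y :+ t :* ((con 1ℚ :- t) :* l :+ u :* f)
                         := (con 1ℚ :- t) :* (y :+ t :* l) :+ (t :* u) :* f)
      refl t y (landing t F qs ps r η) (t ^ length (lower η r ps)) (sweep t F qs r η)))
  where y = sweep t F (ps ++ qs) (lookup η q) (η [ q ]≔ r)

landing-++ : ∀ {n} t (F : StrandFn n) qs ps ps′ r η →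
  landing t F qs (ps ++ ps′) r η ≡ landing t F (ps′ ++ qs) ps r η + t ^ length (lower η r ps) * landing t F qs ps′ r η
landing-++ t F qs [] ps′ r η = solve 1 (λ x → x := con 0ℚ :+ con 1ℚ :* x) refl (landing t F qs ps′ r η)
landing-++ t F qs (q ∷ ps) ps′ r η with lookup η q <ᵇ r
... | false = landing-++ t F qs ps ps′ r η
... | true rewrite Listₚ.++-assoc ps ps′ qs | landing-++ t F qs ps ps′ r η =
  solve 5 (λ t y l u f → y :+ t :* (l :+ u :* f) := (y :+ t :* l) :+ (t :* u) :* f)
    refl t (sweep t F (ps ++ ps′ ++ qs) (lookup η q) (η [ q ]≔ r)) (landing t F (ps′ ++ qs) ps r η)
    (t ^ length (lower η r ps)) (landing t F qs ps′ r η)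

private
  divide-out : ∀ {q x y} → q ≢ 0ℚ → x * q ≡ y * q → x ≡ y
  divide-out {q} {x} {y} q≢0 h = begin
    x             ≡⟨ solve 2 (λ x y → x := (x :- y) :+ y) refl x y ⟩
    (x - y) + y   ≡⟨ cong (_+ y) (*-cancel-zero {q} q≢0 (trans
                       (solve 3 (λ q x y → q :* (x :- y) := x :* q :- y :* q) refl q x y)
                       (trans (cong (_- y * q) h) (ℚₚ.+-inverseʳ (y * q))))) ⟩
    0ℚ + y        ≡⟨ ℚₚ.+-identityˡ y ⟩
    y             ∎
    where open ≡-Reasoning

-- Two families of sites in cyclic order, with landing sums B and A and numbers of
-- admissible sites encoded by u = t^b and v = t^a; q is [a + b]_t.
full-turn : ∀ t q u v B A V F → q ≢ 0ℚ → (1ℚ - t) * q ≡ 1ℚ - u * v →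
  V * q ≡ B + u * A → F * q ≡ A + v * B → V ≡ (1ℚ - t) * B + u * F
full-turn t q u v B A V F q≢0 tel hV hF = divide-out q≢0 (begin
  V * q                                            ≡⟨ hV ⟩
  B + u * A                                        ≡⟨ solve 4 (λ u v B A → B :+ u :* A := (con 1ℚ :- u :* v) :* B :+ u :* (A :+ v :* B)) refl u v B A ⟩
  (1ℚ - u * v) * B + u * (A + v * B)               ≡⟨ cong₂ (λ x y → x * B + u * y) (sym tel) (sym hF) ⟩
  (1ℚ - t) * q * B + u * (F * q)                   ≡⟨ solve 5 (λ t q B u F → (con 1ℚ :- t) :* q :* B :+ u :* (F :* q) := ((con 1ℚ :- t) :* B :+ u :* F) :* q) refl t q B u F ⟩
  ((1ℚ - t) * B + u * F) * q                       ∎)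
  where open ≡-Reasoning

++-∷ : ∀ {A : Set} (xs : List A) y zs → xs ++ y ∷ zs ≡ (xs ++ y ∷ []) ++ zs
++-∷ xs y zs = sym (Listₚ.++-assoc xs (y ∷ []) zs)

-- cur agrees with η on the sites, other than j, that a particle of species s can reach.
record Agree {n} (j : Fin n) (s : ℕ) (η cur : Config n) : Set where
  field
    vacated : lookup cur j ≡ 0
    upper   : s ℕ.≤ lookup η j
    below-η : ∀ {q} → q ≢ j → lookup η q ℕ.< s → lookup cur q ≡ lookup η q
    below-c : ∀ {q} → q ≢ j → lookup cur q ℕ.< s → lookup cur q ≡ lookup η q

open Agree

agree-start : ∀ {n} (j : Fin n) s cur → lookup cur j ≡ 0 → Agree j s (cur [ j ]≔ s) cur
agree-start j s cur cj = record
  { vacated = cj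
  ; upper   = ℕₚ.≤-reflexive (sym (lookup∘update j cur s))
  ; below-η = λ q≢j _ → sym (lookup∘update′ q≢j cur s)
  ; below-c = λ q≢j _ → sym (lookup∘update′ q≢j cur s) }

-- After the landing at q the threshold falls to the displaced species. Then q counts as lower in
-- neither configuration, and their disagreement there does no harm.
agree-step : ∀ {n} {j q : Fin n} {s η cur} → q ≢ j → lookup η q ℕ.< s → Agree j s η cur →
  Agree j (lookup η q) η (cur [ q ]≔ s)
agree-step {j = j} {q} {s} {η} {cur} q≢j q<s c = record
  { vacated = trans (lookup∘update′ (q≢j ∘ sym) cur s) (vacated c)
  ; upper   = ℕₚ.<⇒≤ (ℕₚ.<-≤-trans q<s (upper c))
  ; below-η = λ {p} p≢j lt → trans (lookup∘update′ (p≢q-η lt) cur s) (below-η c p≢j (ℕₚ.<-trans lt q<s))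
  ; below-c = λ {p} p≢j lt → trans (lookup∘update′ (p≢q-c lt) cur s)
      (below-c c p≢j (subst (ℕ._< s) (lookup∘update′ (p≢q-c lt) cur s) (ℕₚ.<-trans lt q<s))) }
  where
  p≢q-η : ∀ {p} → lookup η p ℕ.< lookup η q → p ≢ q
  p≢q-η lt refl = ℕₚ.<-irrefl refl lt
  p≢q-c : ∀ {p} → lookup (cur [ q ]≔ s) p ℕ.< lookup η q → p ≢ q
  p≢q-c lt refl = ℕₚ.<-irrefl refl (ℕₚ.<-trans (subst (ℕ._< lookup η q) (lookup∘update q cur s) lt) q<s)

agree-<ᵇ : ∀ {n} {j q : Fin n} {s η cur} → Agree j s η cur → q ≢ j → (lookup η q <ᵇ s) ≡ (lookup cur q <ᵇ s)
agree-<ᵇ {q = q} {s} {η} {cur} c q≢j with lookup η q ℕ.<? s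
... | yes lt = cong (_<ᵇ s) (sym (below-η c q≢j lt))
... | no ¬lt with lookup cur q ℕ.<? s
...   | yes lt = cong (_<ᵇ s) (sym (below-c c q≢j lt))
...   | no ¬lt′ = trans (<ᵇ-false (ℕₚ.≮⇒≥ ¬lt)) (sym (<ᵇ-false (ℕₚ.≮⇒≥ ¬lt′)))

-- `qs` lists the sites other than j clockwise from j. A particle at p, with `qs` = A p B, looks at
-- B, then j, then A; but j is never available, because η still shows the rung particle there, whose
-- species is at least that of any active one.
module Cascade {n : ℕ} (t : ℚ) (0≤t : 0ℚ ≤ t) (j : Fin n) (qs : List (Fin n))
  (clockwise-j : clockwiseFrom j ≡ qs ++ j ∷ [])
  (clockwise-p : ∀ A p B → qs ≡ A ++ p ∷ B → clockwiseFrom p ≡ B ++ j ∷ A ++ p ∷ [])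
  (qs≢j : All (_≢ j) qs)
  (g : Config n → ℚ) where

  -- The strand takes the place of the particle at j: the entry of η at j is overwritten, so the
  -- value depends only on the strand and the other sites.
  ringMean : StrandFn n
  ringMean s η = mean (ring t (η [ j ]≔ s) j) g

  ringMean-vacancy : ∀ η → ringMean 0 η ≡ g (η [ j ]≔ 0)
  ringMean-vacancy η rewrite lookup∘update j η 0 = solve 1 (λ x → con 1ℚ :* x :+ con 0ℚ := x) refl (g (η [ j ]≔ 0))

  -- What the induction on species supplies for a landing at q: the displaced particle continues as
  -- a strand over the rest B of the turn and then counts as a particle freshly rung at j.
  StepMean : ℕ → ℕ → Config n → Config n → Set
  StepMean f s η cur = ∀ A q B → qs ≡ A ++ q ∷ B → lookup η q ℕ.< s → ∀ w →
    mean (step f t η (cur [ q ]≔ s) q (lookup η q) w) g ≡ w * sweep t ringMean B (lookup η q) (cur [ q ]≔ s)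

  split-≢ : ∀ {A q B} → qs ≡ A ++ q ∷ B → q ≢ j
  split-≢ {A} e = All.lookup qs≢j (subst (_ ∈_) (sym e) (∈-++⁺ʳ A (here refl)))

  -- Multiplying by [m]_t clears the denominators of the choice probabilities. `P` and `T` are the
  -- sites of `qs` before and after the block `ps`; a particle displaced within the block still has
  -- to pass the rest of the block and `T`.
  mean-choices : ∀ {f s η cur} → StepMean f s η cur → Agree j s η cur → ∀ m → qint t m ≢ 0ℚ →
    ∀ T P ps k → qs ≡ P ++ ps ++ T →
    mean (choices f t η cur s m k (lower η s ps)) g * qint t m ≡ t ^ k * landing t ringMean T ps s cur
  mean-choices ok c m q≢0 T P [] k e = trans (ℚₚ.*-zeroˡ (qint t m)) (sym (ℚₚ.*-zeroʳ (t ^ k)))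
  mean-choices {f} {s} {η} {cur} ok c m q≢0 T P (q ∷ ps) k e
    with lookup η q <ᵇ s in eq | lookup cur q <ᵇ s | agree-<ᵇ {q = q} c (split-≢ {P} e)
  ... | false | _ | refl = mean-choices ok c m q≢0 T (P ++ q ∷ []) ps k (trans e (++-∷ P q (ps ++ T)))
  ... | true  | _ | refl = begin
    mean (step f t η (cur [ q ]≔ s) q (lookup η q) w ++ rest) g * Q
      ≡⟨ cong (_* Q) (mean-++ (step f t η (cur [ q ]≔ s) q (lookup η q) w) rest g) ⟩
    (mean (step f t η (cur [ q ]≔ s) q (lookup η q) w) g + mean rest g) * Q
      ≡⟨ cong (λ z → (z + mean rest g) * Q) (ok P q (ps ++ T) e q<s w) ⟩
    (w * sweep t ringMean (ps ++ T) (lookup η q) (cur [ q ]≔ s) + mean rest g) * Q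
      ≡⟨ cong (λ a → (w * sweep t ringMean (ps ++ T) a (cur [ q ]≔ s) + mean rest g) * Q) (sym (below-η c (split-≢ {P} e) q<s)) ⟩
    (w * y + mean rest g) * Q
      ≡⟨ solve 4 (λ w y r Q → (w :* y :+ r) :* Q := (w :* Q) :* y :+ r :* Q) refl w y (mean rest g) Q ⟩
    w * Q * y + mean rest g * Q
      ≡⟨ cong₂ (λ a b → a * y + b) (/'-* (t ^ k) q≢0)
           (mean-choices ok c m q≢0 T (P ++ q ∷ []) ps (suc k) (trans e (++-∷ P q (ps ++ T)))) ⟩
    t ^ k * y + t * t ^ k * l
      ≡⟨ solve 4 (λ t u y l → u :* y :+ (t :* u) :* l := u :* (y :+ t :* l)) refl t (t ^ k) y l ⟩
    t ^ k * (y + t * l) ∎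
    where
    open ≡-Reasoning
    Q = qint t m
    w = (t ^ k) /' Q
    q<s = <ᵇ-true⁻ eq
    rest = choices f t η cur s m (suc k) (lower η s ps)
    y = sweep t ringMean (ps ++ T) (lookup cur q) (cur [ q ]≔ s)
    l = landing t ringMean T ps s cur

  lowerSites-p : ∀ {A p B s η cur} → qs ≡ A ++ p ∷ B → s ℕ.≤ lookup η p → Agree j s η cur →
    lowerSites η p s ≡ lower η s B ++ lower η s A
  lowerSites-p {A} {p} {B} {s} {η} e s≤p c = begin
    lower η s (clockwiseFrom p)                     ≡⟨ cong (lower η s) (clockwise-p A p B e) ⟩
    lower η s (B ++ j ∷ A ++ p ∷ [])                ≡⟨ lower-++ η s B (j ∷ A ++ p ∷ []) ⟩
    lower η s B ++ lower η s (j ∷ A ++ p ∷ [])      ≡⟨ cong (lower η s B ++_) (lower-reject η s j (A ++ p ∷ []) (upper c)) ⟩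
    lower η s B ++ lower η s (A ++ p ∷ [])          ≡⟨ cong (lower η s B ++_) (lower-++ η s A (p ∷ [])) ⟩
    lower η s B ++ lower η s A ++ lower η s (p ∷ []) ≡⟨ cong (λ l → lower η s B ++ lower η s A ++ l) (lower-reject η s p [] s≤p) ⟩
    lower η s B ++ lower η s A ++ []                ≡⟨ cong (lower η s B ++_) (Listₚ.++-identityʳ _) ⟩
    lower η s B ++ lower η s A                      ∎
    where open ≡-Reasoning

  lowerSites-j : ∀ {s η cur} → Agree j s η cur → lowerSites η j s ≡ lower η s qs
  lowerSites-j {s} {η} c = trans (cong (lower η s) clockwise-j) (trans (lower-++ η s qs (j ∷ []))
    (trans (cong (lower η s qs ++_) (lower-reject η s j [] (upper c))) (Listₚ.++-identityʳ _)))

  agree-all : ∀ {s η cur ps} → Agree j s η cur → All (_≢ j) ps → lower η s ps ≡ lower cur s ps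
  agree-all {s} {η} {cur} {ps} c h = lower-cong η cur s ps (All.map (agree-<ᵇ c) h)

  -- From p the sites of B come first and those of A only beyond j, so the latter carry a factor
  -- t^b; a particle displaced in A passes the rest of A, then p and B, before it reaches j. The
  -- case m = 0 is kept apart, since [0]_t = 0 and the cascade then has no outcomes.
  cascade-p : ∀ {f s η cur A p B} → qs ≡ A ++ p ∷ B → s ℕ.≤ lookup η p → Agree j s η cur → StepMean f s η cur →
    let b = length (lower cur s B) ; m = b ℕ.+ length (lower cur s A) in
    (m ≡ 0 → mean (cascade (suc f) t η cur p s) g ≡ 0ℚ) ×
    (qint t m ≢ 0ℚ → mean (cascade (suc f) t η cur p s) g * qint t m
       ≡ landing t ringMean [] B s cur + t ^ b * landing t ringMean (p ∷ B) A s cur)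
  cascade-p {f} {s} {η} {cur} {A} {p} {B} e s≤p c ok
    rewrite lowerSites-p {A} e s≤p c | sym (agree-all c (Allₚ.++⁻ʳ (A ++ p ∷ []) (subst (All (_≢ j)) (trans e (++-∷ A p B)) qs≢j)))
          | sym (agree-all c (Allₚ.++⁻ˡ A (subst (All (_≢ j)) e qs≢j))) | Listₚ.length-++ (lower η s B) {lower η s A}
    = empty (lower η s B) (lower η s A) , λ q≢0 → begin
      mean (choices f t η cur s m 0 (lower η s B ++ lower η s A)) g * Q
        ≡⟨ cong (_* Q) (mean-choices-++ f t η cur s m 0 (lower η s B) (lower η s A) g) ⟩
      (mean (choices f t η cur s m 0 (lower η s B)) g + mean (choices f t η cur s m b (lower η s A)) g) * Q
        ≡⟨ ℚₚ.*-distribʳ-+ Q (mean (choices f t η cur s m 0 (lower η s B)) g) (mean (choices f t η cur s m b (lower η s A)) g) ⟩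
      mean (choices f t η cur s m 0 (lower η s B)) g * Q + mean (choices f t η cur s m b (lower η s A)) g * Q
        ≡⟨ cong₂ _+_
             (mean-choices ok c m q≢0 [] (A ++ p ∷ []) B 0
               (trans e (trans (++-∷ A p B) (cong ((A ++ p ∷ []) ++_) (sym (Listₚ.++-identityʳ B))))))
             (mean-choices ok c m q≢0 (p ∷ B) [] A b e) ⟩
      1ℚ * landing t ringMean [] B s cur + t ^ b * landing t ringMean (p ∷ B) A s cur
        ≡⟨ cong (_+ t ^ b * landing t ringMean (p ∷ B) A s cur) (ℚₚ.*-identityˡ (landing t ringMean [] B s cur)) ⟩
      landing t ringMean [] B s cur + t ^ b * landing t ringMean (p ∷ B) A s cur ∎
    where
    open ≡-Reasoning
    b = length (lower η s B)
    m = b ℕ.+ length (lower η s A)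
    Q = qint t m
    empty : ∀ is js → length is ℕ.+ length js ≡ 0 → mean (choices f t η cur s (length is ℕ.+ length js) 0 (is ++ js)) g ≡ 0ℚ
    empty [] [] _ = refl

  cascade-j : ∀ {f s η cur} → Agree j s η cur → StepMean f s η cur →
    let m = length (lower cur s qs) in
    (m ≡ 0 → mean (cascade (suc f) t η cur j s) g ≡ 0ℚ) ×
    (qint t m ≢ 0ℚ → mean (cascade (suc f) t η cur j s) g * qint t m ≡ landing t ringMean [] qs s cur)
  cascade-j {f} {s} {η} {cur} c ok rewrite lowerSites-j c | sym (agree-all c qs≢j)
    = empty (lower η s qs) , λ q≢0 → trans
        (mean-choices ok c (length (lower η s qs)) q≢0 [] [] qs 0 (sym (Listₚ.++-identityʳ qs)))
        (ℚₚ.*-identityˡ _)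
    where
    empty : ∀ is → length is ≡ 0 → mean (choices f t η cur s (length is) 0 is) g ≡ 0ℚ
    empty [] _ = refl

  Bridge : ℕ → Set
  Bridge s = ∀ f η cur A p B → 0 ℕ.< s → s ℕ.≤ f → qs ≡ A ++ p ∷ B → s ℕ.≤ lookup η p → Agree j s η cur →
    mean (cascade f t η cur p s) g ≡ sweep t ringMean B s cur

  update-vacated : ∀ (cur : Config n) → lookup cur j ≡ 0 → cur [ j ]≔ 0 ≡ cur
  update-vacated cur e = trans (cong (cur [ j ]≔_) (sym e)) ([]≔-lookup cur j)

  stepMean : ∀ {f s η cur} → s ℕ.≤ suc f → Agree j s η cur → (∀ {r} → r ℕ.< s → Bridge r) → StepMean f s η cur
  stepMean {f} {s} {η} {cur} s≤f c IH A q B e lt w with agree-step (split-≢ {A} e) lt c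
  ... | c′ with lookup η q in eq
  ... | zero = begin
    w * g cur′ + 0ℚ                      ≡⟨ ℚₚ.+-identityʳ (w * g cur′) ⟩
    w * g cur′                           ≡⟨ cong (λ ξ → w * g ξ) (sym (update-vacated cur′ (vacated c′))) ⟩
    w * g (cur′ [ j ]≔ 0)                ≡⟨ cong (w *_) (sym (ringMean-vacancy cur′)) ⟩
    w * ringMean 0 cur′                  ≡⟨ cong (w *_) (sym (sweep-vacancy t B ringMean cur′)) ⟩
    w * sweep t ringMean B 0 cur′        ∎
    where
    open ≡-Reasoning
    cur′ = cur [ q ]≔ s
  ... | suc r = trans (mean-scale w (cascade f t η (cur [ q ]≔ s) q (suc r)) g)
    (cong (w *_) (IH lt f η (cur [ q ]≔ s) A q B (ℕ.s≤s ℕ.z≤n) (ℕₚ.≤-pred (ℕₚ.≤-trans lt s≤f)) e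
      (ℕₚ.≤-reflexive (sym eq)) c′))

  qint≢0 : ∀ m → qint t (suc m) ≢ 0ℚ
  qint≢0 m e = ℚₚ.<⇒≢ (qint-positive 0≤t m) (sym e)

  ringMean-active : ∀ s cur → lookup cur j ≡ 0 →
    ringMean (suc s) cur ≡ mean (cascade (suc s) t (cur [ j ]≔ suc s) cur j (suc s)) g
  ringMean-active s cur cj rewrite lookup∘update j cur (suc s) =
    cong (λ ξ → mean (cascade (suc s) t (cur [ j ]≔ suc s) ξ j (suc s)) g)
         (trans ([]≔-idempotent cur j) (update-vacated cur cj))

  landing-upper : ∀ T p B {s cur} → s ℕ.≤ lookup cur p → landing t ringMean T (p ∷ B) s cur ≡ landing t ringMean T B s cur
  landing-upper T p B {s} {cur} h rewrite <ᵇ-false {lookup cur p} {s} h = refl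

  landing-none : ∀ ps {s cur} → length (lower cur s ps) ≡ 0 → landing t ringMean [] ps s cur ≡ 0ℚ
  landing-none []       h = refl
  landing-none (q ∷ ps) {s} {cur} h with lookup cur q <ᵇ s
  landing-none (q ∷ ps) h  | false = landing-none ps h
  landing-none (q ∷ ps) () | true

  -- `full-turn` is applied with the lower sites of B and of A as the two families: the cascade from
  -- p meets B before A, a bell at j meets A before B. This eliminates A and leaves precisely the
  -- expansion of a sweep over B followed by a fresh start at j.
  bridge : ∀ s → Acc ℕ._<_ s → Bridge s
  bridge (suc s) (acc rec) (suc f) η cur A p B 0<s s≤f e s≤p c =
    trans (go b+a refl) (sym (trans (cong (λ l → sweep t ringMean l S cur) (sym (Listₚ.++-identityʳ B)))
                                    (sweep-landing t ringMean [] B S cur)))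
    where
    open ≡-Reasoning
    S = suc s
    IH : ∀ {r} → r ℕ.< S → Bridge r
    IH {r} r<S = bridge r (rec r<S)
    b = length (lower cur S B)
    a = length (lower cur S A)
    b+a = b ℕ.+ a
    lB = landing t ringMean [] B S cur
    lA = landing t ringMean (p ∷ B) A S cur
    V = mean (cascade (suc f) t η cur p S) g
    F = ringMean S cur
    V-facts = cascade-p {A = A} {p} {B} e s≤p c (stepMean s≤f c IH)
    cj = vacated c
    S≤cur-p : S ℕ.≤ lookup cur p
    S≤cur-p with lookup cur p ℕ.<? S
    ... | no ¬lt = ℕₚ.≮⇒≥ ¬lt
    ... | yes lt = ⊥-elim (ℕₚ.<⇒≱ (subst (ℕ._< S) (below-c c (split-≢ {A} e) lt) lt) s≤p)
    count : length (lower cur S qs) ≡ b+a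
    count = begin
      length (lower cur S qs)                              ≡⟨ cong (λ l → length (lower cur S l)) e ⟩
      length (lower cur S (A ++ p ∷ B))                    ≡⟨ cong length (lower-++ cur S A (p ∷ B)) ⟩
      length (lower cur S A ++ lower cur S (p ∷ B))        ≡⟨ Listₚ.length-++ (lower cur S A) ⟩
      a ℕ.+ length (lower cur S (p ∷ B))                   ≡⟨ cong (λ l → a ℕ.+ length l) (lower-reject cur S p B S≤cur-p) ⟩
      a ℕ.+ b                                              ≡⟨ ℕₚ.+-comm a b ⟩
      b+a                                                  ∎
    landing-qs : landing t ringMean [] qs S cur ≡ lA + t ^ a * lB
    landing-qs = begin
      landing t ringMean [] qs S cur                       ≡⟨ cong (λ l → landing t ringMean [] l S cur) e ⟩
      landing t ringMean [] (A ++ p ∷ B) S cur             ≡⟨ landing-++ t ringMean [] A (p ∷ B) S cur ⟩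
      landing t ringMean ((p ∷ B) ++ []) A S cur + t ^ a * landing t ringMean [] (p ∷ B) S cur
        ≡⟨ cong₂ (λ l x → landing t ringMean l A S cur + t ^ a * x) (Listₚ.++-identityʳ (p ∷ B)) (landing-upper [] p B S≤cur-p) ⟩
      lA + t ^ a * lB                                      ∎
    F-facts = cascade-j {s} {S} {cur [ j ]≔ S} {cur} (agree-start j S cur cj) (stepMean ℕₚ.≤-refl (agree-start j S cur cj) IH)
    F≡ : F ≡ mean (cascade S t (cur [ j ]≔ S) cur j S) g
    F≡ = ringMean-active s cur cj
    go : ∀ m → m ≡ b+a → V ≡ (1ℚ - t) * lB + t ^ b * F
    -- Without a lower site the cascade yields the empty list, and both sides are 0. Covering this
    -- case lets the harmonic equation hold without a condition on the content.
    go zero 0≡m = begin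
      V                                  ≡⟨ proj₁ V-facts (sym 0≡m) ⟩
      0ℚ                                 ≡⟨ solve 2 (λ c u → con 0ℚ := c :* con 0ℚ :+ u :* con 0ℚ) refl (1ℚ - t) (t ^ b) ⟩
      (1ℚ - t) * 0ℚ + t ^ b * 0ℚ         ≡⟨ cong₂ (λ x y → (1ℚ - t) * x + t ^ b * y)
                                              (sym (landing-none B (ℕₚ.m+n≡0⇒m≡0 b (sym 0≡m))))
                                              (sym (trans F≡ (proj₁ F-facts (trans count (sym 0≡m))))) ⟩
      (1ℚ - t) * lB + t ^ b * F          ∎
    go (suc m) m≡ = full-turn t (qint t b+a) (t ^ b) (t ^ a) lB lA V F q≢0
      (trans (qint-telescope t b+a) (cong (λ z → 1ℚ - z) (^-+ t b a)))
      (proj₂ V-facts q≢0)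
      (trans (cong (_* qint t b+a) F≡) (trans (subst (λ k → X * qint t k ≡ landing t ringMean [] qs S cur) count
          (proj₂ F-facts (subst (λ k → qint t k ≢ 0ℚ) (sym count) q≢0))) landing-qs))
      where
      X = mean (cascade S t (cur [ j ]≔ S) cur j S) g
      q≢0 : qint t b+a ≢ 0ℚ
      q≢0 = subst (λ k → qint t k ≢ 0ℚ) m≡ (qint≢0 m)

  ringMean-local : ∀ s η → ringMean s (η [ j ]≔ 0) ≡ ringMean s η
  ringMean-local s η = cong (λ ξ → mean (ring t ξ j) g) ([]≔-idempotent η j)

  ringMean-harmonic : ∀ s η → ringMean s η ≡ sweep t ringMean qs s η
  ringMean-harmonic zero    η = sym (sweep-vacancy t qs ringMean η)
  ringMean-harmonic (suc s) η = begin
    ringMean S η                                   ≡⟨ sym (ringMean-local S η) ⟩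
    F                                              ≡⟨ go m refl ⟩
    (1ℚ - t) * l + t ^ m * F                       ≡⟨ sym (sweep-landing t ringMean [] qs S cur) ⟩
    sweep t ringMean (qs ++ []) S cur              ≡⟨ cong (λ l → sweep t ringMean l S cur) (Listₚ.++-identityʳ qs) ⟩
    sweep t ringMean qs S cur                      ≡⟨ sym (sweep-substitute t qs ringMean (_[ j ]≔ 0) far S η) ⟩
    sweep t (λ r ξ → ringMean r (ξ [ j ]≔ 0)) qs S η ≡⟨ sweep-cong t qs ringMean-local S η ⟩
    sweep t ringMean qs S η                        ∎
    where
    open ≡-Reasoning
    S = suc s
    cur = η [ j ]≔ 0
    cj = lookup∘update j η 0
    F = ringMean S cur
    m = length (lower cur S qs)
    l = landing t ringMean [] qs S cur
    far : ∀ η → All (λ q → lookup (η [ j ]≔ 0) q ≡ lookup η q × (∀ v → (η [ q ]≔ v) [ j ]≔ 0 ≡ (η [ j ]≔ 0) [ q ]≔ v)) qs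
    far η = All.map (λ q≢j → lookup∘update′ q≢j η 0 , λ v → []≔-commutes η _ j q≢j) qs≢j
    X = mean (cascade S t (cur [ j ]≔ S) cur j S) g
    F≡ : F ≡ X
    F≡ = ringMean-active s cur cj
    F-facts = cascade-j {s} {S} {cur [ j ]≔ S} {cur} (agree-start j S cur cj)
      (stepMean ℕₚ.≤-refl (agree-start j S cur cj) (λ {r} _ → bridge r (<-wellFounded r)))
    go : ∀ k → k ≡ m → F ≡ (1ℚ - t) * l + t ^ m * F
    go zero    0≡m = begin
      F                           ≡⟨ trans F≡ (proj₁ F-facts (sym 0≡m)) ⟩
      0ℚ                          ≡⟨ solve 2 (λ c u → con 0ℚ := c :* con 0ℚ :+ u :* con 0ℚ) refl (1ℚ - t) (t ^ m) ⟩
      (1ℚ - t) * 0ℚ + t ^ m * 0ℚ  ≡⟨ cong₂ (λ x y → (1ℚ - t) * x + t ^ m * y) (sym (landing-none qs (sym 0≡m))) (sym (trans F≡ (proj₁ F-facts (sym 0≡m)))) ⟩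
      (1ℚ - t) * l + t ^ m * F    ∎
    -- The second family of sites is empty: its landing sum is 0, its power of t is 1, and the two
    -- starting points coincide.
    go (suc k) k≡ = full-turn t (qint t m) (t ^ m) 1ℚ l 0ℚ F F q≢0
      (trans (qint-telescope t m) (cong (λ z → 1ℚ - z) (sym (ℚₚ.*-identityʳ (t ^ m)))))
      (trans hF (solve 2 (λ l u → l := l :+ u :* con 0ℚ) refl l (t ^ m)))
      (trans hF (solve 1 (λ l → l := con 0ℚ :+ con 1ℚ :* l) refl l))
      where
      q≢0 : qint t m ≢ 0ℚ
      q≢0 = subst (λ k → qint t k ≢ 0ℚ) k≡ (qint≢0 k)
      hF : F * qint t m ≡ l
      hF = trans (cong (_* qint t m) F≡) (proj₂ F-facts q≢0)

-- Cyclic order of the sites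

allPairs-split : ∀ {A : Set} {R : A → A → Set} U {p W} → AllPairs R (U ++ p ∷ W) → All (λ u → R u p) U × All (R p) W
allPairs-split []      (r ∷ rs) = [] , r
allPairs-split (u ∷ U) (r ∷ rs) with allPairs-split U rs
... | l , m = (All.head (Allₚ.++⁻ʳ U r) ∷ l) , m

split-++ : ∀ {X : Set} (W : List X) {U} A {p B} → W ++ U ≡ A ++ p ∷ B →
  (∃ λ W₂ → W ≡ A ++ p ∷ W₂ × B ≡ W₂ ++ U) ⊎ (∃ λ U₁ → A ≡ W ++ U₁ × U ≡ U₁ ++ p ∷ B)
split-++ []      A       e = inj₂ (A , refl , e)
split-++ (w ∷ W) []      e = inj₁ (W , cong (_∷ W) (Listₚ.∷-injectiveˡ e) , sym (Listₚ.∷-injectiveʳ e))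
split-++ (w ∷ W) (a ∷ A) e with Listₚ.∷-injectiveˡ e | split-++ W A (Listₚ.∷-injectiveʳ e)
... | refl | inj₁ (W₂ , h , k) = inj₁ (W₂ , cong (w ∷_) h , k)
... | refl | inj₂ (U₁ , h , k) = inj₂ (U₁ , cong (w ∷_) h , k)

allFin-< : ∀ n → AllPairs Fin._<_ (allFin n)
allFin-< n = AllPairsₚ.tabulate⁺-< id

module _ {n : ℕ} where

  clockwiseFrom-split : ∀ U {p : Fin n} W → allFin n ≡ U ++ p ∷ W → clockwiseFrom p ≡ (W ++ U) ++ p ∷ []
  clockwiseFrom-split U {p} W e = begin
    filter P? (allFin n) ++ filter Q? (allFin n)        ≡⟨ cong (λ l → filter P? l ++ filter Q? l) e ⟩
    filter P? (U ++ p ∷ W) ++ filter Q? (U ++ p ∷ W)    ≡⟨ cong₂ _++_ after before ⟩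
    W ++ U ++ p ∷ []                                    ≡⟨ sym (Listₚ.++-assoc W U (p ∷ [])) ⟩
    (W ++ U) ++ p ∷ []                                  ∎
    where
    open ≡-Reasoning
    P? = λ i → p Fin.<? i
    Q? = λ i → i Fin.≤? p
    U<p×p<W = allPairs-split U (subst (AllPairs Fin._<_) e (allFin-< n))
    U<p = proj₁ U<p×p<W
    p<W = proj₂ U<p×p<W
    after : filter P? (U ++ p ∷ W) ≡ W
    after = trans (Listₚ.filter-++ P? U (p ∷ W)) (cong₂ _++_
      (Listₚ.filter-none P? (All.map ℕₚ.<-asym U<p))
      (trans (Listₚ.filter-reject P? {x = p} {xs = W} (ℕₚ.<-irrefl refl)) (Listₚ.filter-all P? p<W)))
    before : filter Q? (U ++ p ∷ W) ≡ U ++ p ∷ []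
    before = trans (Listₚ.filter-++ Q? U (p ∷ W)) (cong₂ _++_
      (Listₚ.filter-all Q? (All.map ℕₚ.<⇒≤ U<p))
      (trans (Listₚ.filter-accept Q? {x = p} {xs = W} ℕₚ.≤-refl) (cong (p ∷_) (Listₚ.filter-none Q? (All.map ℕₚ.<⇒≱ p<W)))))

  module Cyclic {j : Fin n} (U W : List (Fin n)) (e : allFin n ≡ U ++ j ∷ W) where

    -- Two cases, according to the side of j on which p lies in the linear order of sites; the
    -- cyclic word is the same in both.
    clockwise-p : ∀ A p B → W ++ U ≡ A ++ p ∷ B → clockwiseFrom p ≡ B ++ j ∷ A ++ p ∷ []
    clockwise-p A p B h with split-++ W A h
    ... | inj₁ (W₂ , refl , refl) = trans
      (clockwiseFrom-split (U ++ j ∷ A) W₂ (trans e (sym (Listₚ.++-assoc U (j ∷ A) (p ∷ W₂)))))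
      (trans (Listₚ.++-assoc W₂ (U ++ j ∷ A) (p ∷ [])) (trans (cong (W₂ ++_) (Listₚ.++-assoc U (j ∷ A) (p ∷ [])))
        (sym (Listₚ.++-assoc W₂ U (j ∷ A ++ p ∷ [])))))
    ... | inj₂ (U₁ , refl , refl) = trans
      (clockwiseFrom-split U₁ (B ++ j ∷ W) (trans e (Listₚ.++-assoc U₁ (p ∷ B) (j ∷ W))))
      (trans (cong (_++ p ∷ []) (Listₚ.++-assoc B (j ∷ W) U₁)) (Listₚ.++-assoc B (j ∷ W ++ U₁) (p ∷ [])))

    others-≢ : All (_≢ j) (W ++ U)
    others-≢ = Allₚ.++⁺ (All.map (λ lt eq → ℕₚ.<-irrefl (cong toℕ (sym eq)) lt) (proj₂ s))
                        (All.map (λ lt eq → ℕₚ.<-irrefl (cong toℕ eq) lt) (proj₁ s))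
      where s = allPairs-split U (subst (AllPairs Fin._<_) e (allFin-< n))

    others-complete : ∀ {q} → q ≢ j → q ∈ W ++ U
    others-complete {q} q≢j with ∈-++⁻ U (subst (q ∈_) e (∈-allFin q))
    ... | inj₁ q∈U         = ∈-++⁺ʳ W q∈U
    ... | inj₂ (here q≡j)  = ⊥-elim (q≢j q≡j)
    ... | inj₂ (there q∈W) = ∈-++⁺ˡ q∈W

-- Content carried by the strand and the ring

toList-update : ∀ {n} (η : Config n) i v → lookup η i ∷ toList (η [ i ]≔ v) ↭ v ∷ toList η
toList-update (x Vec.∷ η) Fin.zero    v = ↭-swap x v ↭-refl
toList-update (x Vec.∷ η) (Fin.suc i) v =
  ↭-trans (↭-swap (lookup η i) x ↭-refl) (↭-trans (↭-prep x (toList-update η i v)) (↭-swap x v ↭-refl))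

toList-transpose : ∀ {n} (η : Config n) i j → toList ((η [ i ]≔ lookup η j) [ j ]≔ lookup η i) ↭ toList η
toList-transpose η i j = Permₚ.drop-∷ {x = lookup η j} (↭-trans
  (↭-trans (↭-reflexive (cong (_∷ toList ((η [ i ]≔ lookup η j) [ j ]≔ lookup η i)) (sym (lookup-j i j))))
           (toList-update (η [ i ]≔ lookup η j) j (lookup η i)))
  (toList-update η i (lookup η j)))
  where
  lookup-j : ∀ i j → lookup (η [ i ]≔ lookup η j) j ≡ lookup η j
  lookup-j i j with j Fin.≟ i
  ... | yes refl = lookup∘update i η (lookup η j)
  ... | no j≢i   = lookup∘update′ j≢i η (lookup η j)

toList-∈ : ∀ {n} {v} (η : Config n) → v ∈ toList η → ∃ λ q → lookup η q ≡ v
toList-∈ (x Vec.∷ η) (here v≡x) = Fin.zero , sym v≡x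
toList-∈ (x Vec.∷ η) (there v∈) with toList-∈ η v∈
... | q , e = Fin.suc q , e

-- The ring of sites, cut at j, carrying the content L, which includes a vacancy.
module AtSite {n : ℕ} (t : ℚ) (0≤t : 0ℚ ≤ t) (t<1 : t < 1ℚ) (L : List ℕ) (0∈L : 0 ∈ L)
  {j : Fin n} (U W : List (Fin n)) (e : allFin n ≡ U ++ j ∷ W) where

  open Cyclic U W e

  -- With the strand written at j, a hop is a transposition of two entries, and an active strand
  -- leaves the vacancy to one of the other sites. These are the two requirements on `Dom`.
  Content : ℕ → Config n → Set
  Content s η = toList (η [ j ]≔ s) ↭ L

  content-hop : ∀ {s η q} → q ∈ W ++ U → lookup η q ℕ.< s → Content s η → Content (lookup η q) (η [ q ]≔ s)
  content-hop {s} {η} {q} q∈ _ d = ↭-trans (↭-trans (↭-reflexive (cong toList (begin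
    (η [ q ]≔ s) [ j ]≔ lookup η q                               ≡⟨ sym ([]≔-idempotent (η [ q ]≔ s) j) ⟩
    ((η [ q ]≔ s) [ j ]≔ s) [ j ]≔ lookup η q                    ≡⟨ cong (_[ j ]≔ lookup η q) ([]≔-commutes η q j q≢j) ⟩
    (ξ [ q ]≔ s) [ j ]≔ lookup η q                               ≡⟨ cong₂ (λ a b → (ξ [ q ]≔ a) [ j ]≔ b)
                                                                      (sym (lookup∘update j η s)) (sym (lookup∘update′ q≢j η s)) ⟩
    (ξ [ q ]≔ lookup ξ j) [ j ]≔ lookup ξ q                      ∎))) (toList-transpose ξ q j)) d
    where
    open ≡-Reasoning
    q≢j = All.lookup others-≢ q∈
    ξ = η [ j ]≔ s

  content-vacancy : ∀ {s η} → Content (suc s) η → Any (λ q → lookup η q ≡ 0) (W ++ U)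
  content-vacancy {s} {η} d with toList-∈ (η [ j ]≔ suc s) (Permₚ.∈-resp-↭ (↭-sym d) 0∈L)
  ... | q , eq with q Fin.≟ j
  ...   | no q≢j   = Any.map (λ { refl → trans (sym (lookup∘update′ q≢j η (suc s))) eq }) (others-complete q≢j)
  ...   | yes refl with trans (sym (lookup∘update j η (suc s))) eq
  ...     | ()

  open Cascade t 0≤t j (W ++ U) (clockwiseFrom-split U W e) clockwise-p others-≢ public

  module _ (g : Config n → ℚ) where

    -- The tool behind the identities for bells below: it suffices to exhibit a strand function that
    -- satisfies the harmonic equation and has the right values at strand 0.
    ringMean-unique : ∀ (F : StrandFn n) → (∀ s η → F s η ≡ sweep t F (W ++ U) s η) →
      (∀ {η} → Content 0 η → F 0 η ≡ g (η [ j ]≔ 0)) →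
      ∀ {η} → toList η ↭ L → F (lookup η j) η ≡ mean (ring t η j) g
    ringMean-unique F hF h₀ {η} d = trans
      (harmonic-unique t 0≤t t<1 (W ++ U) Content content-hop content-vacancy F (ringMean g)
        (λ {s} {η} _ → hF s η) (λ {s} {η} _ → ringMean-harmonic g s η)
        (λ d → trans (h₀ d) (sym (ringMean-vacancy g _)))
        (subst (λ ξ → toList ξ ↭ L) (sym ([]≔-lookup η j)) d))
      (cong (λ ξ → mean (ring t ξ j) g) ([]≔-lookup η j))

-- Commutation of the bells with the Hecke generator

bell : ∀ {n} → ℚ → Fin n → (Config n → ℚ) → Config n → ℚ
bell t j g η = mean (ring t η j) g

hop-scale : ∀ t α (Ψ : ℕ → ℕ → ℚ) r a → hop t (λ s v → α * Ψ s v) r a ≡ α * hop t Ψ r a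
hop-scale t α Ψ r a with a <ᵇ r
... | false = refl
... | true  = solve 4 (λ t α p q → (con 1ℚ :- t) :* (α :* p) :+ t :* (α :* q) := α :* ((con 1ℚ :- t) :* p :+ t :* q))
  refl t α (Ψ a r) (Ψ r a)

sweep-scale : ∀ {n} t qs α (F : StrandFn n) r η → sweep t (λ s ξ → α * F s ξ) qs r η ≡ α * sweep t F qs r η
sweep-scale t []       α F r η = refl
sweep-scale t (q ∷ qs) α F r η = trans (hopAt-cong t q (sweep-scale t qs α F) r η)
  (hop-scale t α (λ s v → sweep t F qs s (η [ q ]≔ v)) r (lookup η q))

-- The two branches of `hecke` agree at equal species, so the first one is valid for b = 0 as well.
hecke-vacancy : ∀ t (Ψ : ℕ → ℕ → ℚ) b → hecke t Ψ 0 b ≡ Ψ b 0 - (1ℚ - t) * Ψ 0 b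
hecke-vacancy t Ψ zero    = solve 2 (λ t p → t :* p := p :- (con 1ℚ :- t) :* p) refl t (Ψ 0 0)
hecke-vacancy t Ψ (suc b) = refl

-- By the quadratic relation, t times the inverse of T is T + (1 - t); this is `hecke∘hop` solved
-- for `hop`.
hop-hecke : ∀ t (Φ : ℕ → ℕ → ℚ) a b → hop t Φ a b ≡ hecke t (λ x y → Φ y x) a b + (1ℚ - t) * Φ b a
hop-hecke t Φ a b with ℕₚ.<-cmp a b
... | tri< a<b _ _ rewrite <ᵇ-true a<b | <ᵇ-false {b} {a} (ℕₚ.<⇒≤ a<b) =
  solve 3 (λ t p q → p := (p :- (con 1ℚ :- t) :* q) :+ (con 1ℚ :- t) :* q) refl t (Φ a b) (Φ b a)
... | tri≈ _ refl _ rewrite <ᵇ-irrefl a = solve 2 (λ t p → p := t :* p :+ (con 1ℚ :- t) :* p) refl t (Φ a a)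
... | tri> _ _ b<a rewrite <ᵇ-true b<a | <ᵇ-false {a} {b} (ℕₚ.<⇒≤ b<a) =
  solve 3 (λ t p q → (con 1ℚ :- t) :* q :+ t :* p := t :* p :+ (con 1ℚ :- t) :* q) refl t (Φ a b) (Φ b a)

module Adjacent {n : ℕ} (t : ℚ) (0≤t : 0ℚ ≤ t) (t<1 : t < 1ℚ) (L : List ℕ) (0∈L : 0 ∈ L)
  {i i′ : Fin n} (C D : List (Fin n)) (e : allFin n ≡ C ++ i ∷ i′ ∷ D) where

  private
    sorted : AllPairs Fin._<_ (C ++ i ∷ i′ ∷ D)
    sorted = subst (AllPairs Fin._<_) e (allFin-< n)

    e′ : allFin n ≡ (C ++ i ∷ []) ++ i′ ∷ D
    e′ = trans e (++-∷ C i (i′ ∷ D))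

    split = allPairs-split C sorted
    split′ = allPairs-split (C ++ i ∷ []) (subst (AllPairs Fin._<_) e′ (allFin-< n))

    <⇒≢ : ∀ {p q : Fin n} → p Fin.< q → p ≢ q
    <⇒≢ lt refl = ℕₚ.<-irrefl refl lt

  i≢i′ : i ≢ i′
  i≢i′ = <⇒≢ (All.head (proj₂ split))

  private
    i′≢i : i′ ≢ i
    i′≢i = i≢i′ ∘ sym

  C-far : All (λ q → q ≢ i × q ≢ i′) C
  C-far = All.zip (All.map <⇒≢ (proj₁ split) , All.map <⇒≢ (Allₚ.++⁻ˡ C (proj₁ split′)))

  D-far : All (λ q → q ≢ i × q ≢ i′) D
  D-far = All.zip (All.map (λ lt → <⇒≢ lt ∘ sym) (All.tail (proj₂ split)) , All.map (λ lt → <⇒≢ lt ∘ sym) (proj₂ split′))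

  T : (Config n → ℚ) → Config n → ℚ
  T = heckeAt t i i′

  private
    -- T applied to the harmonic function of g is again harmonic by `heckeAt-sweep`, as i and i′
    -- stay consecutive in the turn from j, and at strand 0 it gives T g. Uniqueness then identifies
    -- it.
    bell-hecke-at : ∀ {j} U W (s : allFin n ≡ U ++ j ∷ W) P R → W ++ U ≡ P ++ i ∷ i′ ∷ R →
      All (λ q → q ≢ i × q ≢ i′) P → All (λ q → q ≢ i × q ≢ i′) R → j ≢ i → j ≢ i′ →
      ∀ g {η} → toList η ↭ L → bell t j (T g) η ≡ T (bell t j g) η
    bell-hecke-at {j} U W s P R eq hP hR j≢i j≢i′ g {η} d = trans
      (sym (ringMean-unique (T g) (λ r → T (ringMean g r)) harmonic boundary d))
      (hecke-cong t (λ a b → cong (λ ξ → mean (ring t ξ j) g) (trans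
        (cong (((η [ i ]≔ a) [ i′ ]≔ b) [ j ]≔_) (sym (trans (lookup∘update′ j≢i′ (η [ i ]≔ a) b) (lookup∘update′ j≢i η a))))
        ([]≔-lookup _ j))) (lookup η i) (lookup η i′))
      where
      open AtSite t 0≤t t<1 L 0∈L U W s
      harmonic : ∀ r ξ → T (ringMean g r) ξ ≡ sweep t (λ r → T (ringMean g r)) (W ++ U) r ξ
      harmonic r ξ = trans (heckeAt-cong t i≢i′ (ringMean-harmonic g r) ξ)
        (trans (cong (λ l → T (sweep t (ringMean g) l r) ξ) eq)
        (trans (sym (heckeAt-sweep t i≢i′ P R hP hR (ringMean g) r ξ))
               (cong (λ l → sweep t (λ r → T (ringMean g r)) l r ξ) (sym eq))))
      boundary : ∀ {ξ} → Content 0 ξ → T (ringMean g 0) ξ ≡ T g (ξ [ j ]≔ 0)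
      boundary {ξ} _ = trans
        (hecke-cong t (λ a b → trans (ringMean-vacancy g ((ξ [ i ]≔ a) [ i′ ]≔ b)) (cong g (trans
          ([]≔-commutes (ξ [ i ]≔ a) i′ j (j≢i′ ∘ sym)) (cong (_[ i′ ]≔ b) ([]≔-commutes ξ i j (j≢i ∘ sym))))))
          (lookup ξ i) (lookup ξ i′))
        (cong₂ (hecke t (λ a b → g (((ξ [ j ]≔ 0) [ i ]≔ a) [ i′ ]≔ b)))
          (sym (lookup∘update′ (j≢i ∘ sym) ξ 0)) (sym (lookup∘update′ (j≢i′ ∘ sym) ξ 0)))

  bell-hecke-far : ∀ {j} → j ∈ C ++ D → ∀ g {η} → toList η ↭ L → bell t j (T g) η ≡ T (bell t j g) η
  bell-hecke-far {j} j∈ with ∈-++⁻ C j∈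
  ... | inj₁ j∈C with ∈-∃++ j∈C | All.lookup C-far j∈C
  ...   | C₁ , C₂ , refl | j≢i , j≢i′ = bell-hecke-at C₁ (C₂ ++ i ∷ i′ ∷ D)
    (trans e (Listₚ.++-assoc C₁ (j ∷ C₂) (i ∷ i′ ∷ D)))
    C₂ (D ++ C₁) (Listₚ.++-assoc C₂ (i ∷ i′ ∷ D) C₁)
    (All.tail (Allₚ.++⁻ʳ C₁ C-far)) (Allₚ.++⁺ D-far (Allₚ.++⁻ˡ C₁ C-far)) j≢i j≢i′
  bell-hecke-far {j} j∈ | inj₂ j∈D with ∈-∃++ j∈D | All.lookup D-far j∈D
  ...   | D₁ , D₂ , refl | j≢i , j≢i′ = bell-hecke-at (C ++ i ∷ i′ ∷ D₁) D₂
    (trans e (sym (Listₚ.++-assoc C (i ∷ i′ ∷ D₁) (j ∷ D₂))))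
    (D₂ ++ C) D₁ (sym (Listₚ.++-assoc D₂ C (i ∷ i′ ∷ D₁)))
    (Allₚ.++⁺ (All.tail (Allₚ.++⁻ʳ D₁ D-far)) C-far) (Allₚ.++⁻ˡ D₁ D-far) j≢i j≢i′

  private
    module I  = AtSite t 0≤t t<1 L 0∈L C (i′ ∷ D) e
    module I′ = AtSite t 0≤t t<1 L 0∈L (C ++ i ∷ []) D e′

    R : List (Fin n)
    R = D ++ C

    R-far : All (λ q → q ≢ i × q ≢ i′) R
    R-far = Allₚ.++⁺ D-far C-far

    I′-order : D ++ C ++ i ∷ [] ≡ R ++ i ∷ []
    I′-order = sym (Listₚ.++-assoc D C (i ∷ []))

  module _ (g : Config n → ℚ) where

    private
      -- `H` and `Q` are the right-hand sides of the two relations below as strand functions, cut at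
      -- i′ and at i. By `hecke∘hop`, T of a bell at i is t `G` with the two species exchanged,
      -- which gives `H`; by `hop-hecke`, `P` is T + (1 - t) applied to a bell at i′, and
      -- subtracting (1 - t) `F` leaves `Q`.
      F F′ G H P Q : StrandFn n
      F = I.ringMean g
      F′ = I′.ringMean g
      G = sweep t F R
      H s ξ = t * G s (ξ [ i′ ]≔ lookup ξ i)
      P s ξ = hopAt t i F′ s (ξ [ i ]≔ lookup ξ i′)
      Q s ξ = 1ℚ * P s ξ + (- (1ℚ - t)) * F s ξ

      F-harmonic : ∀ s ξ → F s ξ ≡ hopAt t i′ G s ξ
      F-harmonic = I.ringMean-harmonic g

      F′-harmonic : ∀ s ξ → F′ s ξ ≡ sweep t (hopAt t i F′) R s ξ
      F′-harmonic s ξ = trans (I′.ringMean-harmonic g s ξ)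
        (trans (cong (λ l → sweep t F′ l s ξ) I′-order) (sweep-++ t R (i ∷ []) F′ s ξ))

      F-local : ∀ s ξ v → F s (ξ [ i ]≔ v) ≡ F s ξ
      F-local s ξ v = cong (λ ζ → mean (ring t ζ i) g) ([]≔-idempotent ξ i)

      F′-local : ∀ s ξ v → F′ s (ξ [ i′ ]≔ v) ≡ F′ s ξ
      F′-local s ξ v = cong (λ ζ → mean (ring t ζ i′) g) ([]≔-idempotent ξ i′)

      G-local : ∀ s ξ v → G s (ξ [ i ]≔ v) ≡ G s ξ
      G-local s ξ v = trans
        (sym (sweep-substitute t R F (_[ i ]≔ v)
          (λ ζ → All.map (λ (q≢i , _) → lookup∘update′ q≢i ζ v , λ w → []≔-commutes ζ _ i q≢i) R-far) s ξ))
        (sweep-cong t R (λ r ζ → F-local r ζ v) s ξ)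

      copy-substitute : ∀ {p q} (h : All (λ r → r ≢ p × r ≢ q) R) (X : StrandFn n) s ξ →
        sweep t (λ r ζ → X r (ζ [ q ]≔ lookup ζ p)) R s ξ ≡ sweep t X R s (ξ [ q ]≔ lookup ξ p)
      copy-substitute {p} {q} h X = sweep-substitute t R X (λ ζ → ζ [ q ]≔ lookup ζ p)
        (λ ζ → All.map (λ (r≢p , r≢q) → lookup∘update′ r≢q ζ (lookup ζ p) ,
          λ v → trans (cong ((ζ [ _ ]≔ v) [ q ]≔_) (lookup∘update′ (r≢p ∘ sym) ζ v)) ([]≔-commutes ζ _ q r≢q)) h)

      F-copy : ∀ s ξ a → F s (ξ [ i′ ]≔ a) ≡ hop t (λ r v → G r (ξ [ i′ ]≔ v)) s a
      F-copy s ξ a = trans (F-harmonic s (ξ [ i′ ]≔ a)) (trans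
        (cong (hop t (λ r v → G r ((ξ [ i′ ]≔ a) [ i′ ]≔ v)) s) (lookup∘update i′ ξ a))
        (hop-cong t (λ r v → cong (G r) ([]≔-idempotent ξ i′)) s a))

      H-hop : ∀ s ξ → hopAt t i H s ξ ≡ t * F s (ξ [ i′ ]≔ lookup ξ i)
      H-hop s ξ = trans
        (hop-cong t (λ r v → cong (t *_) (trans
          (cong (λ a → G r ((ξ [ i ]≔ v) [ i′ ]≔ a)) (lookup∘update i ξ v))
          (trans (cong (G r) ([]≔-commutes ξ i i′ i≢i′)) (G-local r (ξ [ i′ ]≔ v) v)))) s (lookup ξ i))
        (trans (hop-scale t t (λ r v → G r (ξ [ i′ ]≔ v)) s (lookup ξ i)) (cong (t *_) (sym (F-copy s ξ (lookup ξ i)))))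

      -- The turn from i′ ends at i. Hopping there turns `H` into t `F` with the species of i copied
      -- to i′, by harmonicity of `F`, and the sweep over R turns `F` back into `G`.
      H-harmonic : ∀ s ξ → H s ξ ≡ sweep t H (D ++ C ++ i ∷ []) s ξ
      H-harmonic s ξ = sym (trans (cong (λ l → sweep t H l s ξ) I′-order)
        (trans (sweep-++ t R (i ∷ []) H s ξ)
        (trans (sweep-cong t R H-hop s ξ)
        (trans (sweep-scale t R t (λ r ζ → F r (ζ [ i′ ]≔ lookup ζ i)) s ξ)
               (cong (t *_) (copy-substitute R-far F s ξ))))))

      H-boundary : ∀ {ξ} → I′.Content 0 ξ → H 0 ξ ≡ T g (ξ [ i′ ]≔ 0)
      H-boundary {ξ} _ = begin
        t * G 0 (ξ [ i′ ]≔ a)                              ≡⟨ cong (t *_) (sweep-vacancy t R F (ξ [ i′ ]≔ a)) ⟩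
        t * F 0 (ξ [ i′ ]≔ a)                              ≡⟨ cong (t *_) (I.ringMean-vacancy g (ξ [ i′ ]≔ a)) ⟩
        t * g ((ξ [ i′ ]≔ a) [ i ]≔ 0)                     ≡⟨ cong (λ ζ → t * g ζ) vectors ⟩
        -- `a <ᵇ 0` computes to false, so only the branch with the factor t occurs.
        hecke t K a 0                                      ≡⟨ cong₂ (hecke t K) (sym (lookup∘update′ i≢i′ ξ 0)) (sym (lookup∘update i′ ξ 0)) ⟩
        T g (ξ [ i′ ]≔ 0)                                  ∎
        where
        open ≡-Reasoning
        a = lookup ξ i
        K : ℕ → ℕ → ℚ
        K x y = g (((ξ [ i′ ]≔ 0) [ i ]≔ x) [ i′ ]≔ y)
        vectors : (ξ [ i′ ]≔ a) [ i ]≔ 0 ≡ ((ξ [ i′ ]≔ 0) [ i ]≔ 0) [ i′ ]≔ a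
        vectors = trans ([]≔-commutes ξ i′ i i′≢i) (sym (trans
          (cong (_[ i′ ]≔ a) ([]≔-commutes ξ i′ i i′≢i)) ([]≔-idempotent (ξ [ i ]≔ 0) i′)))

    bell-hecke-right : ∀ {η} → toList η ↭ L → bell t i′ (T g) η ≡ T (bell t i g) η
    bell-hecke-right {η} d = trans (sym (I′.ringMean-unique (T g) H H-harmonic H-boundary d)) (sym (trans
      (hecke-cong t (λ a b → trans (cong (λ ζ → mean (ring t ζ i) g) ([]≔-commutes η i i′ i≢i′)) (F-copy a η b))
        (lookup η i) (lookup η i′))
      (hecke∘hop t (λ r v → G r (η [ i′ ]≔ v)) (lookup η i) (lookup η i′))))

    private
      P-hop : ∀ s ξ → P s ξ ≡ hop t (λ r v → F′ r (ξ [ i ]≔ v)) s (lookup ξ i′)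
      P-hop s ξ = trans
        (cong (hop t (λ r v → F′ r ((ξ [ i ]≔ lookup ξ i′) [ i ]≔ v)) s) (lookup∘update i ξ (lookup ξ i′)))
        (hop-cong t (λ r v → cong (F′ r) ([]≔-idempotent ξ i)) s (lookup ξ i′))

      -- The turn from i begins at i′. The sweep over R followed by a hop at i is a full turn from
      -- i′, which reproduces `F′`, and the first hop then yields `P` again.
      P-harmonic : ∀ s ξ → sweep t P (i′ ∷ R) s ξ ≡ P s ξ
      P-harmonic s ξ = trans
        (hopAt-cong t i′ (λ r ζ → trans (copy-substitute (All.map (λ (a , b) → b , a) R-far) (hopAt t i F′) r ζ)
                                        (sym (F′-harmonic r (ζ [ i ]≔ lookup ζ i′)))) s ξ)
        (trans (hop-cong t (λ r v → trans
                 (cong (λ a → F′ r ((ξ [ i′ ]≔ v) [ i ]≔ a)) (lookup∘update i′ ξ v))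
                 (trans (cong (F′ r) ([]≔-commutes ξ i′ i i′≢i)) (F′-local r (ξ [ i ]≔ v) v))) s (lookup ξ i′))
               (sym (P-hop s ξ)))

      Q-harmonic : ∀ s ξ → Q s ξ ≡ sweep t Q (i′ ∷ R) s ξ
      Q-harmonic s ξ = sym (trans (sweep-linear t (i′ ∷ R) 1ℚ (- (1ℚ - t)) P F s ξ)
        (cong₂ (λ x y → 1ℚ * x + (- (1ℚ - t)) * y) (P-harmonic s ξ) (sym (F-harmonic s ξ))))

      Q-boundary : ∀ {ξ} → I.Content 0 ξ → Q 0 ξ ≡ T g (ξ [ i ]≔ 0)
      Q-boundary {ξ} _ = begin
        1ℚ * P 0 ξ + (- (1ℚ - t)) * F 0 ξ
          ≡⟨ cong₂ (λ x y → 1ℚ * x + (- (1ℚ - t)) * y)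
               (trans (P-hop 0 ξ) (I′.ringMean-vacancy g (ξ [ i ]≔ b))) (I.ringMean-vacancy g ξ) ⟩
        1ℚ * g ((ξ [ i ]≔ b) [ i′ ]≔ 0) + (- (1ℚ - t)) * g (ξ [ i ]≔ 0)
          ≡⟨ solve 3 (λ t x y → con 1ℚ :* x :+ (:- (con 1ℚ :- t)) :* y := x :- (con 1ℚ :- t) :* y)
               refl t (g ((ξ [ i ]≔ b) [ i′ ]≔ 0)) (g (ξ [ i ]≔ 0)) ⟩
        g ((ξ [ i ]≔ b) [ i′ ]≔ 0) - (1ℚ - t) * g (ξ [ i ]≔ 0)
          ≡⟨ cong₂ (λ x y → g x - (1ℚ - t) * g y)
               (cong (_[ i′ ]≔ 0) (sym ([]≔-idempotent ξ i)))
               (sym (trans (cong (_[ i′ ]≔ b) ([]≔-idempotent ξ i))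
                    (trans ([]≔-commutes ξ i i′ i≢i′) (cong (_[ i ]≔ 0) ([]≔-lookup ξ i′))))) ⟩
        K b 0 - (1ℚ - t) * K 0 b
          ≡⟨ sym (hecke-vacancy t K b) ⟩
        hecke t K 0 b
          ≡⟨ cong₂ (hecke t K) (sym (lookup∘update i ξ 0)) (sym (lookup∘update′ i′≢i ξ 0)) ⟩
        T g (ξ [ i ]≔ 0) ∎
        where
        open ≡-Reasoning
        b = lookup ξ i′
        K : ℕ → ℕ → ℚ
        K x y = g (((ξ [ i ]≔ 0) [ i ]≔ x) [ i′ ]≔ y)

    bell-hecke-left : ∀ {η} → toList η ↭ L →
      bell t i (T g) η ≡ T (bell t i′ g) η + (1ℚ - t) * (bell t i′ g η - bell t i g η)
    bell-hecke-left {η} d = begin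
      bell t i (T g) η
        ≡⟨ sym (I.ringMean-unique (T g) Q Q-harmonic Q-boundary d) ⟩
      1ℚ * P a η + (- (1ℚ - t)) * F a η
        ≡⟨ cong₂ (λ x y → 1ℚ * x + (- (1ℚ - t)) * y)
             (trans (P-hop a η) (hop-hecke t Φ a b)) (cong (λ ζ → mean (ring t ζ i) g) ([]≔-lookup η i)) ⟩
      1ℚ * (hecke t (λ x y → Φ y x) a b + (1ℚ - t) * Φ b a) + (- (1ℚ - t)) * bell t i g η
        ≡⟨ cong (λ z → 1ℚ * (hecke t (λ x y → Φ y x) a b + (1ℚ - t) * z) + (- (1ℚ - t)) * bell t i g η)
             (cong (λ ζ → mean (ring t ζ i′) g) (update-lookup t i≢i′ η)) ⟩
      1ℚ * (T (bell t i′ g) η + (1ℚ - t) * bell t i′ g η) + (- (1ℚ - t)) * bell t i g η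
        ≡⟨ solve 4 (λ t x y z → con 1ℚ :* (x :+ (con 1ℚ :- t) :* y) :+ (:- (con 1ℚ :- t)) :* z
                     := x :+ (con 1ℚ :- t) :* (y :- z))
               refl t (T (bell t i′ g) η) (bell t i′ g η) (bell t i g η) ⟩
      T (bell t i′ g) η + (1ℚ - t) * (bell t i′ g η - bell t i g η) ∎
      where
      open ≡-Reasoning
      a = lookup η i
      b = lookup η i′
      Φ : ℕ → ℕ → ℚ
      Φ r v = F′ r (η [ i ]≔ v)

-- Configurations and sums over them

removeOne-↭ : ∀ {v xs} → v ∈ xs → v ∷ removeOne v xs ↭ xs
removeOne-↭ {v} {y ∷ ys} v∈ with v ℕ.≟ y
... | yes refl = ↭-refl
removeOne-↭ {v} {y ∷ ys} (here v≡y)  | no v≢y = ⊥-elim (v≢y v≡y)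
removeOne-↭ {v} {y ∷ ys} (there v∈) | no v≢y = ↭-trans (↭-swap v y ↭-refl) (↭-prep y (removeOne-↭ v∈))

∈-arrangements⁻ : ∀ k xs → length xs ≡ k → ∀ {η : Config k} → η ∈ arrangements k xs → toList η ↭ xs
∈-arrangements⁻ zero    []       _ (here refl) = ↭-refl
∈-arrangements⁻ (suc k) xs       l {η} η∈
  with find (∈-concatMap⁻ (λ v → map (v Vec.∷_) (arrangements k (removeOne v xs))) {deduplicate ℕ._≟_ xs} η∈)
... | v , v∈ , h with ∈-map⁻ (v Vec.∷_) h
...   | ξ , ξ∈ , refl = ↭-trans (↭-prep v (∈-arrangements⁻ k (removeOne v xs) l′ ξ∈)) p
  where
  p = removeOne-↭ (∈-deduplicate⁻ ℕ._≟_ xs v∈)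
  l′ = ℕₚ.suc-injective (trans (Permₚ.↭-length p) l)

∈-arrangements⁺ : ∀ k xs {η : Config k} → toList η ↭ xs → η ∈ arrangements k xs
∈-arrangements⁺ zero    xs {Vec.[]}    p = here refl
∈-arrangements⁺ (suc k) xs {v Vec.∷ η} p =
  ∈-concatMap⁺ (λ v → map (v Vec.∷_) (arrangements k (removeOne v xs))) {deduplicate ℕ._≟_ xs}
    (lose (∈-deduplicate⁺ ℕ._≟_ v∈) (∈-map⁺ (v Vec.∷_) (∈-arrangements⁺ k (removeOne v xs)
      (Permₚ.drop-∷ (↭-trans p (↭-sym (removeOne-↭ v∈)))))))
  where v∈ = Permₚ.∈-resp-↭ p (here refl)

arrangements-unique : ∀ k xs → Unique (arrangements k xs)
arrangements-unique zero    xs = [] ∷ []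
arrangements-unique (suc k) xs = Uniqueₚ.concat⁺
  (Allₚ.map⁺ (All.tabulate (λ {v} _ → Uniqueₚ.map⁺ (λ e → proj₂ (Vecₚ.∷-injective e)) (arrangements-unique k (removeOne v xs)))))
  (AllPairsₚ.map⁺ (AllPairs.map disjoint (deduplicate-! xs)))
  where
  disjoint : ∀ {v w} → v ≢ w → ∀ {η} →
    η ∈ map (v Vec.∷_) (arrangements k (removeOne v xs)) × η ∈ map (w Vec.∷_) (arrangements k (removeOne w xs)) → _
  disjoint {v} {w} v≢w (h , h′) with ∈-map⁻ (v Vec.∷_) h | ∈-map⁻ (w Vec.∷_) h′
  ... | _ , _ , e | _ , _ , e′ = v≢w (proj₁ (Vecₚ.∷-injective (trans (sym e) e′)))

length-toList : ∀ {n} (η : Config n) → length (toList η) ≡ n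
length-toList Vec.[]      = refl
length-toList (x Vec.∷ η) = cong suc (length-toList η)

∈-States⁻ : ∀ {n} (lam : Vec ℕ n) {η} → η ∈ States lam → toList η ↭ toList lam
∈-States⁻ {n} lam = ∈-arrangements⁻ n (toList lam) (length-toList lam)

∈-States⁺ : ∀ {n} (lam : Vec ℕ n) {η} → toList η ↭ toList lam → η ∈ States lam
∈-States⁺ {n} lam = ∈-arrangements⁺ n (toList lam)

∑ : ∀ {A : Set} → List A → (A → ℚ) → ℚ
∑ xs f = sumℚ (map f xs)

module _ {A : Set} where

  ∑-cong : ∀ (xs : List A) {f g : A → ℚ} → (∀ {x} → x ∈ xs → f x ≡ g x) → ∑ xs f ≡ ∑ xs g
  ∑-cong []       e = refl
  ∑-cong (x ∷ xs) e = cong₂ _+_ (e (here refl)) (∑-cong xs (e ∘ there))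

  ∑-linear : ∀ (xs : List A) α β (f g : A → ℚ) → ∑ xs (λ x → α * f x + β * g x) ≡ α * ∑ xs f + β * ∑ xs g
  ∑-linear []       α β f g = solve 2 (λ α β → con 0ℚ := α :* con 0ℚ :+ β :* con 0ℚ) refl α β
  ∑-linear (x ∷ xs) α β f g = trans (cong (α * f x + β * g x +_) (∑-linear xs α β f g))
    (solve 6 (λ α β a b s r → (α :* a :+ β :* b) :+ (α :* s :+ β :* r) := α :* (a :+ s) :+ β :* (b :+ r))
      refl α β (f x) (g x) (∑ xs f) (∑ xs g))

  ∑-scale : ∀ (xs : List A) α (f : A → ℚ) → ∑ xs (λ x → α * f x) ≡ α * ∑ xs f
  ∑-scale []       α f = sym (ℚₚ.*-zeroʳ α)
  ∑-scale (x ∷ xs) α f = trans (cong (α * f x +_) (∑-scale xs α f)) (sym (ℚₚ.*-distribˡ-+ α (f x) (∑ xs f)))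

  ∑-++ : ∀ (xs ys : List A) (f : A → ℚ) → ∑ (xs ++ ys) f ≡ ∑ xs f + ∑ ys f
  ∑-++ []       ys f = sym (ℚₚ.+-identityˡ (∑ ys f))
  ∑-++ (x ∷ xs) ys f = trans (cong (f x +_) (∑-++ xs ys f)) (sym (ℚₚ.+-assoc (f x) (∑ xs f) (∑ ys f)))

  ∑-nonNeg : ∀ (xs : List A) {f : A → ℚ} → (∀ {x} → x ∈ xs → 0ℚ ≤ f x) → 0ℚ ≤ ∑ xs f
  ∑-nonNeg []       h = ℚₚ.≤-refl
  ∑-nonNeg (x ∷ xs) h = +-nonNeg (h (here refl)) (∑-nonNeg xs (h ∘ there))

  ∑-zero⁻ : ∀ (xs : List A) {f : A → ℚ} → (∀ {x} → x ∈ xs → 0ℚ ≤ f x) → ∑ xs f ≡ 0ℚ → ∀ {x} → x ∈ xs → f x ≡ 0ℚ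
  ∑-zero⁻ (y ∷ xs) {f} h s = λ { (here refl) → y≡0 ; (there x∈) → ∑-zero⁻ xs (h ∘ there) rest≡0 x∈ }
    where
    0≤rest = ∑-nonNeg xs (h ∘ there)
    y≡0 : f y ≡ 0ℚ
    y≡0 = ℚₚ.≤-antisym (subst₂ _≤_ (ℚₚ.+-identityʳ (f y)) s (ℚₚ.+-monoʳ-≤ (f y) 0≤rest)) (h (here refl))
    rest≡0 : ∑ xs f ≡ 0ℚ
    rest≡0 = trans (sym (ℚₚ.+-identityˡ (∑ xs f))) (trans (cong (_+ ∑ xs f) (sym y≡0)) s)

δ : ∀ {n} → Config n → Config n → ℚ
δ ζ η = if does (≡-dec ℕ._≟_ η ζ) then 1ℚ else 0ℚ

module _ {n : ℕ} where

  ∑-δ-∉ : ∀ (xs : List (Config n)) (f : Config n → ℚ) η → All (η ≢_) xs → ∑ xs (λ ζ → f ζ * δ ζ η) ≡ 0ℚ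
  ∑-δ-∉ []       f η []      = refl
  ∑-δ-∉ (ζ ∷ xs) f η (h ∷ hs) with ≡-dec ℕ._≟_ η ζ
  ... | yes e = ⊥-elim (h e)
  ... | no _  = trans (cong₂ _+_ (ℚₚ.*-zeroʳ (f ζ)) (∑-δ-∉ xs f η hs)) (ℚₚ.+-identityˡ 0ℚ)

  ∑-δ : ∀ {xs : List (Config n)} → Unique xs → ∀ (f : Config n → ℚ) {η} → η ∈ xs → ∑ xs (λ ζ → f ζ * δ ζ η) ≡ f η
  ∑-δ {ζ ∷ xs} (h ∷ _) f {η} (here refl) with ≡-dec ℕ._≟_ η η
  ... | yes _ = trans (cong₂ _+_ (ℚₚ.*-identityʳ (f η)) (∑-δ-∉ xs f η h)) (ℚₚ.+-identityʳ (f η))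
  ... | no c  = ⊥-elim (c refl)
  ∑-δ {ζ ∷ xs} (h ∷ u) f {η} (there η∈) with ≡-dec ℕ._≟_ η ζ
  ... | yes e = ⊥-elim (All.lookup h η∈ (sym e))
  ... | no _  = trans (cong₂ _+_ (ℚₚ.*-zeroʳ (f ζ)) (∑-δ u f η∈)) (ℚₚ.+-identityˡ (f η))

  mean-δ : ∀ (os : Outcomes n) ζ → sumℚ (map proj₁ (filter (λ o → ≡-dec ℕ._≟_ (proj₂ o) ζ) os)) ≡ mean os (δ ζ)
  mean-δ []             ζ = refl
  mean-δ ((w , ξ) ∷ os) ζ with does (≡-dec ℕ._≟_ ξ ζ)
  ... | true  = cong₂ _+_ (sym (ℚₚ.*-identityʳ w)) (mean-δ os ζ)
  ... | false = trans (mean-δ os ζ) (sym (trans (cong (_+ mean os (δ ζ)) (ℚₚ.*-zeroʳ w)) (ℚₚ.+-identityˡ (mean os (δ ζ)))))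

  mean-linear : ∀ (os : Outcomes n) α β f g → mean os (λ η → α * f η + β * g η) ≡ α * mean os f + β * mean os g
  mean-linear []             α β f g = solve 2 (λ α β → con 0ℚ := α :* con 0ℚ :+ β :* con 0ℚ) refl α β
  mean-linear ((w , ζ) ∷ os) α β f g = trans (cong (w * (α * f ζ + β * g ζ) +_) (mean-linear os α β f g))
    (solve 7 (λ w α β a b s r → w :* (α :* a :+ β :* b) :+ (α :* s :+ β :* r) := α :* (w :* a :+ s) :+ β :* (w :* b :+ r))
      refl w α β (f ζ) (g ζ) (mean os f) (mean os g))

  -- The balance equations test only the indicators `δ`, whereas the operators have to be applied to
  -- arbitrary observables; `expand` passes from the former to the latter.
  record Functional (xs : List (Config n)) (φ : (Config n → ℚ) → ℚ) : Set where
    field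
      linear : ∀ α β f g → φ (λ η → α * f η + β * g η) ≡ α * φ f + β * φ g
      local  : ∀ {f g} → (∀ {η} → η ∈ xs → f η ≡ g η) → φ f ≡ φ g

    vanish : φ (λ _ → 0ℚ) ≡ 0ℚ
    vanish = trans (linear 0ℚ 0ℚ (λ _ → 0ℚ) (λ _ → 0ℚ)) (solve 1 (λ x → con 0ℚ :* x :+ con 0ℚ :* x := con 0ℚ) refl (φ (λ _ → 0ℚ)))

    commute-∑ : ∀ {A : Set} (ys : List A) (c : A → ℚ) (h : A → Config n → ℚ) →
      φ (λ η → ∑ ys (λ y → c y * h y η)) ≡ ∑ ys (λ y → c y * φ (h y))
    commute-∑ []       c h = vanish
    commute-∑ (y ∷ ys) c h = begin
      φ (λ η → c y * h y η + r η)             ≡⟨ local (λ {η} _ → cong (c y * h y η +_) (sym (ℚₚ.*-identityˡ (r η)))) ⟩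
      φ (λ η → c y * h y η + 1ℚ * r η)        ≡⟨ linear (c y) 1ℚ (h y) r ⟩
      c y * φ (h y) + 1ℚ * φ r                ≡⟨ cong (c y * φ (h y) +_) (trans (ℚₚ.*-identityˡ (φ r)) (commute-∑ ys c h)) ⟩
      c y * φ (h y) + ∑ ys (λ y → c y * φ (h y)) ∎
      where
      open ≡-Reasoning
      r = λ η → ∑ ys (λ y → c y * h y η)

    expand : Unique xs → ∀ g → φ g ≡ ∑ xs (λ ζ → g ζ * φ (δ ζ))
    expand u g = trans (local (λ η∈ → sym (∑-δ u g η∈))) (commute-∑ xs g δ)

-- Reachability of the sorted configuration

sorted-↭⇒≡ : ∀ {A : Set} {R : A → A → Set} → (∀ {x y} → R x y → R y x → x ≡ y) →
  ∀ {xs ys} → AllPairs R xs → AllPairs R ys → xs ↭ ys → xs ≡ ys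
sorted-↭⇒≡ anti {[]}     {ys}     _        _        p = sym (Permₚ.↭-empty-inv (↭-sym p))
sorted-↭⇒≡ anti {x ∷ xs} {[]}     _        _        p = Permₚ.↭-empty-inv p
sorted-↭⇒≡ {R = R} anti {x ∷ xs} {y ∷ ys} (rx ∷ sx) (ry ∷ sy) p =
  cong₂ _∷_ x≡y (sorted-↭⇒≡ anti sx sy (Permₚ.drop-∷ (subst (λ z → x ∷ xs ↭ z ∷ ys) (sym x≡y) p)))
  where
  x≡y : x ≡ y
  x≡y with Permₚ.∈-resp-↭ p (here refl) | Permₚ.∈-resp-↭ (↭-sym p) (here refl)
  ... | here e   | _        = e
  ... | there _  | here e   = sym e
  ... | there x∈ | there y∈ = anti (All.lookup rx y∈) (All.lookup ry x∈)

zipAny : ∀ {A : Set} {P Q : A → Set} {xs} → All P xs → Any Q xs → Any (λ x → P x × Q x) xs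
zipAny (p ∷ _)  (here q)  = here (p , q)
zipAny (_ ∷ ps) (there q) = there (zipAny ps q)

allPairs-++⁻ : ∀ {A : Set} {R : A → A → Set} xs {ys} → AllPairs R (xs ++ ys) →
  AllPairs R xs × AllPairs R ys × All (λ x → All (R x) ys) xs
allPairs-++⁻ []       rs       = [] , rs , []
allPairs-++⁻ (x ∷ xs) (r ∷ rs) with allPairs-++⁻ xs rs
... | a , b , c = (Allₚ.++⁻ˡ xs r ∷ a) , b , (Allₚ.++⁻ʳ xs r ∷ c)

-- The trajectory in which a strand settles at every site where it can.
push : ∀ {n} → List (Fin n) → ℕ → Config n → ℕ × Config n
push []       r η = r , η
push (q ∷ qs) r η = if lookup η q <ᵇ r then push qs (lookup η q) (η [ q ]≔ r) else push qs r η

module _ {n : ℕ} where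

  push-++ : ∀ ps qs r (η : Config n) → push (ps ++ qs) r η ≡ push qs (proj₁ (push ps r η)) (proj₂ (push ps r η))
  push-++ []       qs r η = refl
  push-++ (p ∷ ps) qs r η with lookup η p <ᵇ r
  ... | true  = push-++ ps qs (lookup η p) (η [ p ]≔ r)
  ... | false = push-++ ps qs r η

  push-other : ∀ qs r (η : Config n) {q} → All (q ≢_) qs → lookup (proj₂ (push qs r η)) q ≡ lookup η q
  push-other []       r η []       = refl
  push-other (p ∷ qs) r η (h ∷ hs) with lookup η p <ᵇ r
  ... | true  = trans (push-other qs (lookup η p) (η [ p ]≔ r) hs) (lookup∘update′ h η r)
  ... | false = push-other qs r η hs

  private
    lookup-update-all : ∀ {qs} {q : Fin n} (η : Config n) v → All (q ≢_) qs →
      All (λ p → lookup (η [ q ]≔ v) p ≡ lookup η p) qs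
    lookup-update-all η v = All.map (λ q≢p → lookup∘update′ (q≢p ∘ sym) η v)

  push-≤ : ∀ qs r (η : Config n) → proj₁ (push qs r η) ℕ.≤ r
  push-≤ []       r η = ℕₚ.≤-refl
  push-≤ (q ∷ qs) r η with lookup η q <ᵇ r in eq
  ... | true  = ℕₚ.≤-trans (push-≤ qs (lookup η q) (η [ q ]≔ r)) (ℕₚ.<⇒≤ (<ᵇ-true⁻ eq))
  ... | false = push-≤ qs r η

  push-bound : ∀ qs r (η : Config n) {b} → Unique qs → b ℕ.≤ r → All (λ q → b ℕ.≤ lookup η q) qs → b ℕ.≤ proj₁ (push qs r η)
  push-bound []       r η _       b≤r []      = b≤r
  push-bound (q ∷ qs) r η (q≢ ∷ u) b≤r (h ∷ hs) with lookup η q <ᵇ r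
  ... | true  = push-bound qs (lookup η q) (η [ q ]≔ r) u h
    (All.zipWith (λ (e , le) → ℕₚ.≤-trans le (ℕₚ.≤-reflexive (sym e))) (lookup-update-all η r q≢ , hs))
  ... | false = push-bound qs r η u b≤r hs

  push-min : ∀ qs r (η : Config n) → Unique qs → All (λ q → proj₁ (push qs r η) ℕ.≤ lookup (proj₂ (push qs r η)) q) qs
  push-min []       r η _       = []
  push-min (q ∷ qs) r η (q≢ ∷ u) with lookup η q <ᵇ r in eq
  ... | true  = ℕₚ.≤-trans (ℕₚ.≤-trans (push-≤ qs (lookup η q) (η [ q ]≔ r)) (ℕₚ.<⇒≤ (<ᵇ-true⁻ eq)))
      (ℕₚ.≤-reflexive (sym (trans (push-other qs (lookup η q) (η [ q ]≔ r) q≢) (lookup∘update q η r))))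
    ∷ push-min qs (lookup η q) (η [ q ]≔ r) u
  ... | false = ℕₚ.≤-trans (ℕₚ.≤-trans (push-≤ qs r η) (<ᵇ-false⁻ eq)) (ℕₚ.≤-reflexive (sym (push-other qs r η q≢)))
    ∷ push-min qs r η u

  -- Meeting a vacancy leaves the strand with species 0, and no site is lower than that.
  push-vacancy : ∀ qs r (η : Config n) → Unique qs → r ≡ 0 ⊎ Any (λ q → lookup η q ≡ 0) qs → proj₁ (push qs r η) ≡ 0
  push-vacancy qs       r η u       (inj₁ refl)      = ℕₚ.n≤0⇒n≡0 (push-≤ qs 0 η)
  push-vacancy (q ∷ qs) r η (q≢ ∷ u) (inj₂ v) with lookup η q <ᵇ r in eq
  push-vacancy (q ∷ qs) r η (q≢ ∷ u) (inj₂ (here e))  | true  = push-vacancy qs (lookup η q) (η [ q ]≔ r) u (inj₁ e)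
  push-vacancy (q ∷ qs) r η (q≢ ∷ u) (inj₂ (there v)) | true  = push-vacancy qs (lookup η q) (η [ q ]≔ r) u
    (inj₂ (Any.map (λ (e , z) → trans e z) (zipAny (lookup-update-all η r q≢) v)))
  push-vacancy (q ∷ qs) r η (q≢ ∷ u) (inj₂ (here e))  | false = push-vacancy qs r η u
    (inj₁ (ℕₚ.n≤0⇒n≡0 (subst (r ℕ.≤_) e (<ᵇ-false⁻ eq))))
  push-vacancy (q ∷ qs) r η (q≢ ∷ u) (inj₂ (there v)) | false = push-vacancy qs r η u (inj₂ v)

  -- A strand entering a decreasing row from above settles at each strictly smaller entry and so
  -- shifts the row by one place. At a tie it passes instead, but then strand and entry are equal
  -- and the resulting word is the same.
  push-shift : ∀ qs r (η : Config n) → Unique qs → AllPairs ℕ._≥_ (r ∷ map (lookup η) qs) →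
    map (lookup (proj₂ (push qs r η))) qs ++ proj₁ (push qs r η) ∷ [] ≡ r ∷ map (lookup η) qs
  push-shift []       r η _       _ = refl
  push-shift (q ∷ qs) r η (q≢ ∷ u) ((r≥q ∷ r≥) ∷ q≥ ∷ s) with lookup η q <ᵇ r in eq
  ... | true  = cong₂ _∷_ (trans (push-other qs (lookup η q) (η [ q ]≔ r) q≢) (lookup∘update q η r))
    (trans (push-shift qs (lookup η q) (η [ q ]≔ r) u (subst (λ l → AllPairs ℕ._≥_ (lookup η q ∷ l)) (sym same) (q≥ ∷ s)))
           (cong (lookup η q ∷_) same))
    where
    same : map (lookup (η [ q ]≔ r)) qs ≡ map (lookup η) qs
    same = Listₚ.map-cong-local (lookup-update-all η r q≢)
  ... | false = cong₂ _∷_ (trans (push-other qs r η q≢) (sym r≡q))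
    (trans (push-shift qs r η u (r≥ ∷ s)) (cong (_∷ map (lookup η) qs) r≡q))
    where
    r≡q : r ≡ lookup η q
    r≡q = ℕₚ.≤-antisym (<ᵇ-false⁻ eq) r≥q

  settle : Fin n → List (Fin n) → Config n → Config n
  settle j qs η = proj₂ (push qs (lookup η j) η) [ j ]≔ 0

map-lookup-allFin : ∀ {n} (η : Config n) → map (lookup η) (allFin n) ≡ toList η
map-lookup-allFin Vec.[]      = refl
map-lookup-allFin (x Vec.∷ η) = cong (x ∷_) (trans
  (trans (Listₚ.map-tabulate Fin.suc (lookup (x Vec.∷ η))) (sym (Listₚ.map-tabulate id (lookup η)))) (map-lookup-allFin η))

sorted-partition : ∀ {n} (lam : Vec ℕ n) → IsPartition lam → AllPairs ℕ._≥_ (toList lam)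
sorted-partition {n} lam p = subst (AllPairs ℕ._≥_) (map-lookup-allFin lam)
  (AllPairsₚ.map⁺ (AllPairs.map (λ {i} {j} i<j → p i j (ℕₚ.<⇒≤ i<j)) (allFin-< n)))

toList-injective : ∀ {n} (η ξ : Config n) → toList η ≡ toList ξ → η ≡ ξ
toList-injective Vec.[]      Vec.[]      _ = refl
toList-injective (x Vec.∷ η) (y Vec.∷ ξ) e = cong₂ Vec._∷_ (Listₚ.∷-injectiveˡ e) (toList-injective η ξ (Listₚ.∷-injectiveʳ e))

module _ {n : ℕ} {j : Fin n} (U W : List (Fin n)) (e : allFin n ≡ U ++ j ∷ W) where

  open Cyclic U W e

  private
    unique = allPairs-++⁻ U (subst Unique e (Uniqueₚ.allFin⁺ n))

  before-unique : Unique U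
  before-unique = proj₁ unique

  after-unique : Unique W
  after-unique = AllPairs.tail (proj₁ (proj₂ unique))

  before≢after : ∀ {u w} → u ∈ U → w ∈ W → u ≢ w
  before≢after u∈ w∈ = All.lookup (All.tail (All.lookup (proj₂ (proj₂ unique)) u∈)) w∈

  others-unique : Unique (W ++ U)
  others-unique = AllPairsₚ.++⁺ after-unique before-unique
    (All.tabulate (λ w∈ → All.tabulate (λ u∈ → before≢after u∈ w∈ ∘ sym)))

  push-ends : ∀ η → 0 ∈ toList η → proj₁ (push (W ++ U) (lookup η j) η) ≡ 0
  push-ends η 0∈ = push-vacancy (W ++ U) (lookup η j) η others-unique vacancy
    where
    vacancy : lookup η j ≡ 0 ⊎ Any (λ q → lookup η q ≡ 0) (W ++ U)
    vacancy with toList-∈ η 0∈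
    ... | q , z with q Fin.≟ j
    ...   | yes refl = inj₁ z
    ...   | no q≢j   = inj₂ (Any.map (λ { refl → z }) (others-complete q≢j))

-- Ringing the bells of sites 1, …, n in turn, with every strand settling where it can,
-- is an insertion sort: after j bells, sites 1, …, j carry the j smallest species in
-- decreasing order.
module Sweep {n : ℕ} (lam : Vec ℕ n) (part : IsPartition lam) (0∈lam : 0 ∈ toList lam)
  (P : Config n → Set)
  (P-content : ∀ {η} → P η → toList η ↭ toList lam)
  (P-settle : ∀ {η j} U W → allFin n ≡ U ++ j ∷ W → P η → P (settle j (W ++ U) η))
  where

  Sorted : List (Fin n) → List (Fin n) → Config n → Set
  Sorted U V η = AllPairs ℕ._≥_ (map (lookup η) U) × All (λ v → All (λ u → u ℕ.≤ lookup η v) (map (lookup η) U)) V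

  -- The strand from j first visits the sites W not yet rung and emerges with the smallest species m
  -- present there or at j; m is at least every species in U. It then shifts the decreasing row U by
  -- one place and returns to j with species 0, so U and j together read m followed by the old row.
  sorted-settle : ∀ {j} U W → allFin n ≡ U ++ j ∷ W → ∀ {η} → toList η ↭ toList lam →
    Sorted U (j ∷ W) η → Sorted (U ++ j ∷ []) W (settle j (W ++ U) η)
  sorted-settle {j} U W e {η} d (dec , U≤j ∷ U≤W) =
    subst (AllPairs ℕ._≥_) (sym values) decreasing ,
    All.tabulate (λ {w} w∈ → subst (All (ℕ._≤ lookup η₃ w)) (sym values)
      (subst (m ℕ.≤_) (sym (η₃-W w∈)) (All.lookup (push-min W (lookup η j) η W!) w∈)
       ∷ All.map (λ b≤m → ℕₚ.≤-trans b≤m (subst (m ℕ.≤_) (sym (η₃-W w∈)) (All.lookup (push-min W (lookup η j) η W!) w∈))) U≤m))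
    where
    open Cyclic U W e
    W! = after-unique U W e
    U≢W : ∀ {u w} → u ∈ U → w ∈ W → u ≢ w
    U≢W = before≢after U W e
    m = proj₁ (push W (lookup η j) η)
    η₁ = proj₂ (push W (lookup η j) η)
    η₂ = proj₂ (push (W ++ U) (lookup η j) η)
    η₃ = settle j (W ++ U) η
    whole : push (W ++ U) (lookup η j) η ≡ push U m η₁
    whole = push-++ W U (lookup η j) η
    η₁-U : All (λ u → lookup η₁ u ≡ lookup η u) U
    η₁-U = All.tabulate (λ u∈ → push-other W (lookup η j) η (All.tabulate (U≢W u∈)))
    η₃-W : ∀ {w} → w ∈ W → lookup η₃ w ≡ lookup η₁ w
    η₃-W {w} w∈ = trans (lookup∘update′ (All.lookup others-≢ (∈-++⁺ˡ w∈)) η₂ 0)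
      (trans (cong (λ z → lookup (proj₂ z) w) whole) (push-other U m η₁ (All.tabulate (λ u∈ → U≢W u∈ w∈ ∘ sym))))
    U≤m : All (ℕ._≤ m) (map (lookup η) U)
    U≤m = All.tabulate (λ b∈ → push-bound W (lookup η j) η W! (All.lookup U≤j b∈) (All.map (λ h → All.lookup h b∈) U≤W))
    decreasing : AllPairs ℕ._≥_ (m ∷ map (lookup η) U)
    decreasing = U≤m ∷ dec
    values : map (lookup η₃) (U ++ j ∷ []) ≡ m ∷ map (lookup η) U
    values = begin
      map (lookup η₃) (U ++ j ∷ [])             ≡⟨ Listₚ.map-++ (lookup η₃) U (j ∷ []) ⟩
      map (lookup η₃) U ++ lookup η₃ j ∷ []     ≡⟨ cong₂ (λ l c → l ++ c ∷ [])
                                                     (Listₚ.map-cong-local (All.map (λ u≢j → lookup∘update′ u≢j η₂ 0) (Allₚ.++⁻ʳ W others-≢)))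
                                                     (trans (lookup∘update j η₂ 0) (sym (push-ends U W e η (Permₚ.∈-resp-↭ (↭-sym d) 0∈lam)))) ⟩
      map (lookup η₂) U ++ proj₁ (push (W ++ U) (lookup η j) η) ∷ []
                                                ≡⟨ cong (λ z → map (lookup (proj₂ z)) U ++ proj₁ z ∷ []) whole ⟩
      map (lookup (proj₂ (push U m η₁))) U ++ proj₁ (push U m η₁) ∷ []
                                                ≡⟨ push-shift U m η₁ (before-unique U W e) (subst (λ l → AllPairs ℕ._≥_ (m ∷ l)) (sym same) decreasing) ⟩
      m ∷ map (lookup η₁) U                     ≡⟨ cong (m ∷_) same ⟩
      m ∷ map (lookup η) U                      ∎
      where
      open ≡-Reasoning
      same : map (lookup η₁) U ≡ map (lookup η) U
      same = Listₚ.map-cong-local η₁-U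

  all-rung : ∀ V U → allFin n ≡ U ++ V → ∀ {η} → Sorted U V η → P η → P lam
  all-rung [] U e {η} (dec , _) pη = subst P (toList-injective η lam
    (sorted-↭⇒≡ (λ x≥y y≥x → ℕₚ.≤-antisym y≥x x≥y)
      (subst (AllPairs ℕ._≥_) (trans (cong (map (lookup η)) (trans (sym (Listₚ.++-identityʳ U)) (sym e))) (map-lookup-allFin η)) dec)
      (sorted-partition lam part) (P-content pη))) pη
  all-rung (j ∷ W) U e {η} s pη = all-rung W (U ++ j ∷ []) (trans e (++-∷ U j W))
    (sorted-settle U W e (P-content pη) s) (P-settle U W e pη)

  reaches-lam : ∀ {η} → P η → P lam
  reaches-lam = all-rung (allFin n) [] refl ([] , All.tabulate (λ _ → []))

-- Bells as averaging operators

module Chain {n : ℕ} (t : ℚ) (0≤t : 0ℚ ≤ t) (t<1 : t < 1ℚ) (lam : Vec ℕ n) (0∈lam : 0 ∈ toList lam) where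

  private
    L = toList lam

    0<1-t : 0ℚ < 1ℚ - t
    0<1-t = p<q⇒0<q-p t<1

  S : List (Config n)
  S = States lam

  S! : Unique S
  S! = arrangements-unique n L

  module BellAt {j : Fin n} (U W : List (Fin n)) (e : allFin n ≡ U ++ j ∷ W) where

    open AtSite t 0≤t t<1 L 0∈lam U W e public
    open Cyclic U W e

    ringMean-bell : ∀ g η → ringMean g (lookup η j) η ≡ bell t j g η
    ringMean-bell g η = cong (λ ξ → mean (ring t ξ j) g) ([]≔-lookup η j)

    -- If f = g on the given content, the harmonic function of f has the boundary values of g, so
    -- uniqueness identifies the two means; the outcomes of the cascade need not be traced.
    bell-functional : ∀ {η} → toList η ↭ L → Functional S (λ g → bell t j g η)
    bell-functional {η} d = record
      { linear = mean-linear (ring t η j)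
      ; local  = λ {f} {g} f≡g → trans (sym (ringMean-bell f η))
          (ringMean-unique g (ringMean f) (ringMean-harmonic f)
            (λ {ξ} c → trans (ringMean-vacancy f ξ) (f≡g (∈-States⁺ lam c))) d) }

    -- The constant 1 is harmonic, because a strand settles or passes with total probability 1;
    -- uniqueness then gives the total weight of the cascade.
    bell-one : ∀ {η} → toList η ↭ L → bell t j (λ _ → 1ℚ) η ≡ 1ℚ
    bell-one d = sym (ringMean-unique (λ _ → 1ℚ) (λ _ _ → 1ℚ) (λ s η → sym (sweep-one (W ++ U) s η)) (λ _ → refl) d)
      where
      sweep-one : ∀ qs s (η : Config n) → sweep t (λ _ _ → 1ℚ) qs s η ≡ 1ℚ
      sweep-one []       s η = refl
      sweep-one (q ∷ qs) s η with lookup η q <ᵇ s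
      ... | true  = trans (cong₂ (λ x y → (1ℚ - t) * x + t * y) (sweep-one qs _ _) (sweep-one qs _ _))
                          (solve 1 (λ t → (con 1ℚ :- t) :* con 1ℚ :+ t :* con 1ℚ := con 1ℚ) refl t)
      ... | false = sweep-one qs s _

    content-push : ∀ qs → All (_∈ W ++ U) qs → ∀ {s η} → Content s η → Content (proj₁ (push qs s η)) (proj₂ (push qs s η))
    content-push []       []       c = c
    content-push (q ∷ qs) (q∈ ∷ h) {s} {η} c with lookup η q <ᵇ s in eq
    ... | true  = content-push qs h (content-hop q∈ (<ᵇ-true⁻ eq) c)
    ... | false = content-push qs h c

    content-self : ∀ {η} → toList η ↭ L → Content (lookup η j) η
    content-self {η} d = subst (λ ξ → toList ξ ↭ L) (sym ([]≔-lookup η j)) d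

    private
      ends : ∀ {η} → toList η ↭ L → proj₁ (push (W ++ U) (lookup η j) η) ≡ 0
      ends {η} d = push-ends U W e η (Permₚ.∈-resp-↭ (↭-sym d) 0∈lam)

    settle-content : ∀ {η} → toList η ↭ L → toList (settle j (W ++ U) η) ↭ L
    settle-content {η} d = subst (λ r → Content r (proj₂ (push (W ++ U) (lookup η j) η))) (ends d)
      (content-push (W ++ U) (All.tabulate id) (content-self d))

    module _ (g : Config n → ℚ) (0≤g : ∀ {η} → toList η ↭ L → 0ℚ ≤ g η) where

      ringMean-nonNeg : ∀ {s η} → Content s η → 0ℚ ≤ ringMean g s η
      ringMean-nonNeg = minimum-principle t 0≤t t<1 (W ++ U) Content content-hop content-vacancy (ringMean g)
        (λ {s} {η} _ → ringMean-harmonic g s η)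
        (λ { {_} {η} refl c → subst (0ℚ ≤_) (sym (ringMean-vacancy g η)) (0≤g c) })

      bell-nonNeg : ∀ {η} → toList η ↭ L → 0ℚ ≤ bell t j g η
      bell-nonNeg {η} d = subst (0ℚ ≤_) (ringMean-bell g η) (ringMean-nonNeg (content-self d))

      -- Only the trajectory that settles at every lower site is kept; its probability `ε` is a
      -- power of 1 - t. The discarded branches are nonnegative.
      sweep-push : ∀ qs → All (_∈ W ++ U) qs → ∀ {s η} → Content s η →
        ∃ λ ε → 0ℚ < ε × ε * ringMean g (proj₁ (push qs s η)) (proj₂ (push qs s η)) ≤ sweep t (ringMean g) qs s η
      sweep-push [] [] {s} {η} c = 1ℚ , ℚₚ.positive⁻¹ 1ℚ , ℚₚ.≤-reflexive (ℚₚ.*-identityˡ (ringMean g s η))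
      sweep-push (q ∷ qs) (q∈ ∷ h) {s} {η} c rewrite []≔-lookup η q with lookup η q <ᵇ s in eq
      ... | false = sweep-push qs h c
      ... | true with content-hop q∈ (<ᵇ-true⁻ eq) c
      ...   | c′ with sweep-push qs h c′
      ...     | ε , 0<ε , le = (1ℚ - t) * ε , *-pos 0<1-t 0<ε , (begin
        (1ℚ - t) * ε * X               ≡⟨ ℚₚ.*-assoc (1ℚ - t) ε X ⟩
        (1ℚ - t) * (ε * X)             ≤⟨ ℚₚ.*-monoˡ-≤-nonNeg (1ℚ - t) {{ℚ.nonNegative (ℚₚ.<⇒≤ 0<1-t)}} le ⟩
        (1ℚ - t) * Y                   ≡⟨ sym (ℚₚ.+-identityʳ ((1ℚ - t) * Y)) ⟩
        (1ℚ - t) * Y + 0ℚ              ≤⟨ ℚₚ.+-monoʳ-≤ ((1ℚ - t) * Y) (*-nonNeg 0≤t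
                                            (sweep-nonNeg t 0≤t t<1 (W ++ U) Content content-hop content-vacancy (ringMean g) qs h (λ _ → ringMean-nonNeg) c)) ⟩
        (1ℚ - t) * Y + t * sweep t (ringMean g) qs s η ∎)
        where
        open ℚₚ.≤-Reasoning
        X = ringMean g (proj₁ (push qs (lookup η q) (η [ q ]≔ s))) (proj₂ (push qs (lookup η q) (η [ q ]≔ s)))
        Y = sweep t (ringMean g) qs (lookup η q) (η [ q ]≔ s)

      bell-settle : ∀ {η} → toList η ↭ L → bell t j g η ≡ 0ℚ → g (settle j (W ++ U) η) ≡ 0ℚ
      bell-settle {η} d z with sweep-push (W ++ U) (All.tabulate id) (content-self d)
      ... | ε , 0<ε , le = ℚₚ.≤-antisym g≤0 (0≤g (settle-content d))
        where
        ξ = proj₂ (push (W ++ U) (lookup η j) η)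
        g≤0 : g (settle j (W ++ U) η) ≤ 0ℚ
        g≤0 = ℚₚ.*-cancelˡ-≤-pos ε {{ℚ.positive 0<ε}} (begin
          ε * g (ξ [ j ]≔ 0)                             ≡⟨ cong (ε *_) (sym (ringMean-vacancy g ξ)) ⟩
          ε * ringMean g 0 ξ                             ≡⟨ cong (λ r → ε * ringMean g r ξ) (sym (ends d)) ⟩
          ε * ringMean g (proj₁ (push (W ++ U) (lookup η j) η)) ξ ≤⟨ le ⟩
          sweep t (ringMean g) (W ++ U) (lookup η j) η   ≡⟨ sym (ringMean-harmonic g (lookup η j) η) ⟩
          ringMean g (lookup η j) η                      ≡⟨ trans (ringMean-bell g η) z ⟩
          0ℚ                                             ≡⟨ sym (ℚₚ.*-zeroʳ ε) ⟩
          ε * 0ℚ                                         ∎)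
          where open ℚₚ.≤-Reasoning

-- Uniqueness of the stationary distribution

indicator : ∀ {A : Set} → Dec A → ℚ
indicator (yes _) = 1ℚ
indicator (no _)  = 0ℚ

module _ {A : Set} where

  indicator-yes : (p : Dec A) → A → indicator p ≡ 1ℚ
  indicator-yes (yes _) a = refl
  indicator-yes (no ¬a) a = ⊥-elim (¬a a)

  indicator-no : (p : Dec A) → ¬ A → indicator p ≡ 0ℚ
  indicator-no (yes a) ¬a = ⊥-elim (¬a a)
  indicator-no (no _)  ¬a = refl

  0≤indicator : (p : Dec A) → 0ℚ ≤ indicator p
  0≤indicator (yes _) = ℚₚ.<⇒≤ (ℚₚ.positive⁻¹ 1ℚ)
  0≤indicator (no _)  = ℚₚ.≤-refl

  0≤complement : (p : Dec A) → 0ℚ ≤ 1ℚ * 1ℚ + (- 1ℚ) * indicator p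
  0≤complement (yes _) = ℚₚ.≤-refl
  0≤complement (no _)  = ℚₚ.<⇒≤ (ℚₚ.positive⁻¹ 1ℚ)

  complement-zero : (p : Dec A) → 1ℚ * 1ℚ + (- 1ℚ) * indicator p ≡ 0ℚ → A
  complement-zero (yes a) _ = a

functional-∑ : ∀ {n} {xs : List (Config n)} {A : Set} (as : List A) (c : A → ℚ) {φ : A → (Config n → ℚ) → ℚ} →
  (∀ {a} → a ∈ as → Functional xs (φ a)) → Functional xs (λ g → ∑ as (λ a → c a * φ a g))
functional-∑ as c {φ} h = record
  { linear = λ α β f g → trans
      (∑-cong as (λ {a} a∈ → trans (cong (c a *_) (Functional.linear (h a∈) α β f g))
        (solve 5 (λ c α β x y → c :* (α :* x :+ β :* y) := α :* (c :* x) :+ β :* (c :* y)) refl (c a) α β (φ a f) (φ a g))))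
      (∑-linear as α β (λ a → c a * φ a f) (λ a → c a * φ a g))
  ; local = λ f≡g → ∑-cong as (λ {a} a∈ → cong (c a *_) (Functional.local (h a∈) f≡g)) }

module Stationarity {n : ℕ} (t : ℚ) (0≤t : 0ℚ ≤ t) (t<1 : t < 1ℚ) (lam : Vec ℕ n) (0∈lam : 0 ∈ toList lam)
  (part : IsPartition lam) where

  open Chain t 0≤t t<1 lam 0∈lam public

  private
    L = toList lam

    cut : ∀ (j : Fin n) → ∃ λ U → ∃ λ W → allFin n ≡ U ++ j ∷ W
    cut j = ∈-∃++ (∈-allFin j)

  gen : (Fin n → ℚ) → (Config n → ℚ) → Config n → ℚ
  gen c g η = ∑ (allFin n) (λ j → c j * bell t j g η)

  -- Balance tested against all observables, with neither sign nor normalisation: the form that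
  -- survives transport by `Λ` and taking differences.
  Stationary : (Fin n → ℚ) → (Config n → ℚ) → Set
  Stationary c d = ∀ g → ∑ S (λ η → d η * gen c g η) ≡ ∑ (allFin n) c * ∑ S (λ η → d η * g η)

  gen-functional : ∀ c {η} → η ∈ S → Functional S (λ g → gen c g η)
  gen-functional c η∈ = functional-∑ (allFin n) c (λ {j} _ → let U , W , e = cut j in BellAt.bell-functional U W e (∈-States⁻ lam η∈))

  gen-one : ∀ c {η} → η ∈ S → gen c (λ _ → 1ℚ) η ≡ ∑ (allFin n) c
  gen-one c η∈ = ∑-cong (allFin n) (λ {j} _ → let U , W , e = cut j in
    trans (cong (c j *_) (BellAt.bell-one U W e (∈-States⁻ lam η∈))) (ℚₚ.*-identityʳ (c j)))

  isStationary⇒stationary : ∀ x (π : Config n → ℚ) → IsStationary lam x t π → Stationary (λ j → 1ℚ /' x j) π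
  isStationary⇒stationary x π (_ , _ , balance) g = begin
    ∑ S (λ η → π η * gen c g η)                       ≡⟨ Functional.expand Φ-functional S! g ⟩
    ∑ S (λ ζ → g ζ * ∑ S (λ η → π η * gen c (δ ζ) η)) ≡⟨ ∑-cong S (λ {ζ} ζ∈ → cong (g ζ *_) (trans
                                                            (∑-cong S (λ {η} _ → cong (π η *_) (gen-δ η ζ))) (balance ζ ζ∈))) ⟩
    ∑ S (λ ζ → g ζ * (π ζ * R))                       ≡⟨ ∑-cong S (λ {ζ} _ → solve 3 (λ g p r → g :* (p :* r) := r :* (p :* g)) refl (g ζ) (π ζ) R) ⟩
    ∑ S (λ ζ → R * (π ζ * g ζ))                       ≡⟨ ∑-scale S R (λ ζ → π ζ * g ζ) ⟩
    R * ∑ S (λ ζ → π ζ * g ζ)                         ∎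
    where
    open ≡-Reasoning
    c = λ j → 1ℚ /' x j
    R = ∑ (allFin n) c
    Φ-functional : Functional S (λ g → ∑ S (λ η → π η * gen c g η))
    Φ-functional = functional-∑ S π (gen-functional c)
    gen-δ : ∀ η ζ → gen c (δ ζ) η ≡ rate x t η ζ
    gen-δ η ζ = ∑-cong (allFin n) (λ {j} _ → cong (c j *_) (sym (mean-δ (ring t η j) ζ)))

  stationary-linear : ∀ {c} α β d d′ → Stationary c d → Stationary c d′ → Stationary c (λ η → α * d η + β * d′ η)
  stationary-linear {c} α β d d′ s s′ g = begin
    ∑ S (λ η → (α * d η + β * d′ η) * gen c g η)                        ≡⟨ combine (gen c g) ⟩
    α * ∑ S (λ η → d η * gen c g η) + β * ∑ S (λ η → d′ η * gen c g η)  ≡⟨ cong₂ (λ x y → α * x + β * y) (s g) (s′ g) ⟩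
    α * (R * X) + β * (R * Y)                                           ≡⟨ solve 5 (λ α β r x y → α :* (r :* x) :+ β :* (r :* y) := r :* (α :* x :+ β :* y)) refl α β R X Y ⟩
    R * (α * X + β * Y)                                                 ≡⟨ cong (R *_) (sym (combine g)) ⟩
    R * ∑ S (λ η → (α * d η + β * d′ η) * g η)                          ∎
    where
    open ≡-Reasoning
    R = ∑ (allFin n) c
    X = ∑ S (λ η → d η * g η)
    Y = ∑ S (λ η → d′ η * g η)
    combine : ∀ f → ∑ S (λ η → (α * d η + β * d′ η) * f η) ≡ α * ∑ S (λ η → d η * f η) + β * ∑ S (λ η → d′ η * f η)
    combine f = trans
      (∑-cong S (λ {η} _ → solve 5 (λ α β a b f → (α :* a :+ β :* b) :* f := α :* (a :* f) :+ β :* (b :* f)) refl α β (d η) (d′ η) (f η)))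
      (∑-linear S α β (λ η → d η * f η) (λ η → d′ η * f η))

  module Uniqueness (c : Fin n → ℚ) (0<c : ∀ j → 0ℚ < c j) where

    gen-nonNeg : ∀ g → (∀ {η} → toList η ↭ L → 0ℚ ≤ g η) → ∀ {η} → η ∈ S → 0ℚ ≤ gen c g η
    gen-nonNeg g 0≤g η∈ = ∑-nonNeg (allFin n) (λ {j} _ → let U , W , e = cut j in
      *-nonNeg (ℚₚ.<⇒≤ (0<c j)) (BellAt.bell-nonNeg U W e g 0≤g (∈-States⁻ lam η∈)))

    module _ {d : Config n → ℚ} (stat : Stationary c d) where

      private
        pos rest : Config n → ℚ
        pos η = indicator (0ℚ ℚₚ.<? d η)
        rest η = 1ℚ * 1ℚ + (- 1ℚ) * pos η

        0≤pos : ∀ {η} → toList η ↭ L → 0ℚ ≤ pos η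
        0≤pos {η} _ = 0≤indicator (0ℚ ℚₚ.<? d η)

        0≤rest : ∀ {η} → toList η ↭ L → 0ℚ ≤ rest η
        0≤rest {η} _ = 0≤complement (0ℚ ℚₚ.<? d η)

        R = ∑ (allFin n) c

        -- The flow across the boundary of the set where d > 0, in a form that works for signed d.
        -- On the set it is d times the rate of leaving it, elsewhere -d times the rate of entering
        -- it. Both are nonnegative and stationarity makes the sum 0, so no transition leaves the
        -- set.
        excess : Config n → ℚ
        excess η = R * (d η * pos η) + (- 1ℚ) * (d η * gen c pos η)

        excess-sum : ∑ S excess ≡ 0ℚ
        excess-sum = trans (∑-linear S R (- 1ℚ) (λ η → d η * pos η) (λ η → d η * gen c pos η))
          (trans (cong (λ x → R * ∑ S (λ η → d η * pos η) + (- 1ℚ) * x) (stat pos))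
            (solve 2 (λ r x → r :* x :+ con (- 1ℚ) :* (r :* x) := con 0ℚ) refl R (∑ S (λ η → d η * pos η))))

        gen-rest : ∀ {η} → η ∈ S → gen c rest η ≡ R + (- 1ℚ) * gen c pos η
        gen-rest {η} η∈ = trans (Functional.linear (gen-functional c η∈) 1ℚ (- 1ℚ) (λ _ → 1ℚ) pos)
          (cong (_+ (- 1ℚ) * gen c pos η) (trans (ℚₚ.*-identityˡ (gen c (λ _ → 1ℚ) η)) (gen-one c η∈)))

        excess-pos : ∀ {η} → η ∈ S → 0ℚ < d η → excess η ≡ d η * gen c rest η
        excess-pos {η} η∈ 0<d = begin
          R * (d η * pos η) + (- 1ℚ) * (d η * G)  ≡⟨ cong (λ p → R * (d η * p) + (- 1ℚ) * (d η * G)) (indicator-yes (0ℚ ℚₚ.<? d η) 0<d) ⟩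
          R * (d η * 1ℚ) + (- 1ℚ) * (d η * G)     ≡⟨ solve 3 (λ r d g → r :* (d :* con 1ℚ) :+ con (- 1ℚ) :* (d :* g) := d :* (r :+ con (- 1ℚ) :* g)) refl R (d η) G ⟩
          d η * (R + (- 1ℚ) * G)                  ≡⟨ cong (d η *_) (sym (gen-rest η∈)) ⟩
          d η * gen c rest η                      ∎
          where
          open ≡-Reasoning
          G = gen c pos η

        0≤excess : ∀ {η} → η ∈ S → 0ℚ ≤ excess η
        0≤excess {η} η∈ = go (0ℚ ℚₚ.<? d η)
          where
          G = gen c pos η
          go : Dec (0ℚ < d η) → 0ℚ ≤ excess η
          go (yes 0<d) = subst (0ℚ ≤_) (sym (excess-pos η∈ 0<d)) (*-nonNeg (ℚₚ.<⇒≤ 0<d) (gen-nonNeg rest 0≤rest η∈))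
          go (no ¬0<d) = subst (0ℚ ≤_) (trans
            (solve 3 (λ r d g → (con 0ℚ :- d) :* g := r :* (d :* con 0ℚ) :+ con (- 1ℚ) :* (d :* g)) refl R (d η) G)
            (cong (λ p → R * (d η * p) + (- 1ℚ) * (d η * G)) (sym (indicator-no (0ℚ ℚₚ.<? d η) ¬0<d))))
            (*-nonNeg (p≤q⇒0≤q-p (ℚₚ.≮⇒≥ ¬0<d)) (gen-nonNeg pos 0≤pos η∈))

      positive-settle : ∀ {η j} U W → allFin n ≡ U ++ j ∷ W → toList η ↭ L × 0ℚ < d η →
        toList (settle j (W ++ U) η) ↭ L × 0ℚ < d (settle j (W ++ U) η)
      positive-settle {η} {j} U W e (p , 0<d) = BellAt.settle-content U W e p , positive (BellAt.bell-settle U W e rest 0≤rest p bell≡0)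
        where
        η∈ = ∈-States⁺ lam p
        gen≡0 : gen c rest η ≡ 0ℚ
        gen≡0 = *-cancel-zero {d η} (λ z → ℚₚ.<⇒≢ 0<d (sym z))
          (trans (sym (excess-pos η∈ 0<d)) (∑-zero⁻ S 0≤excess excess-sum η∈))
        bell≡0 : bell t j rest η ≡ 0ℚ
        bell≡0 = *-cancel-zero {c j} (λ z → ℚₚ.<⇒≢ (0<c j) (sym z)) (∑-zero⁻ (allFin n)
          (λ {i} _ → let U , W , e = cut i in *-nonNeg (ℚₚ.<⇒≤ (0<c i)) (BellAt.bell-nonNeg U W e rest 0≤rest p))
          gen≡0 (∈-allFin j))
        positive : ∀ {ξ} → rest ξ ≡ 0ℚ → 0ℚ < d ξ
        positive {ξ} = complement-zero (0ℚ ℚₚ.<? d ξ)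

      positive-lam : ∀ {η} → η ∈ S → 0ℚ < d η → 0ℚ < d lam
      positive-lam {η} η∈ 0<d = proj₂ (Sweep.reaches-lam lam part 0∈lam (λ η → toList η ↭ L × 0ℚ < d η)
        proj₁ positive-settle {η} (∈-States⁻ lam η∈ , 0<d))

    private
      zero-nonPos : ∀ {d} → Stationary c d → ∑ S d ≡ 0ℚ → ¬ 0ℚ < d lam → ∀ {η} → η ∈ S → d η ≡ 0ℚ
      zero-nonPos {d} stat sum≡0 ¬0<d η∈ = *-cancel-zero { - 1ℚ} (λ ()) (∑-zero⁻ S
        (λ {ξ} ξ∈ → subst (0ℚ ≤_) (solve 1 (λ x → con 0ℚ :- x := con (- 1ℚ) :* x) refl (d ξ))
                      (p≤q⇒0≤q-p (ℚₚ.≮⇒≥ (¬0<d ∘ positive-lam {d} stat ξ∈))))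
        (trans (∑-scale S (- 1ℚ) d) (cong ((- 1ℚ) *_) sum≡0)) η∈)

    -- If d is not positive at `lam` it is nowhere positive, since positivity anywhere spreads to
    -- `lam`; having sum 0, it vanishes. Otherwise the same applies to -d.
    stationary-zero : ∀ {d} → Stationary c d → ∑ S d ≡ 0ℚ → ∀ {η} → η ∈ S → d η ≡ 0ℚ
    stationary-zero {d} stat sum≡0 {η} η∈ with 0ℚ ℚₚ.<? d lam
    ... | no ¬0<d = zero-nonPos {d} stat sum≡0 ¬0<d η∈
    ... | yes 0<d = *-cancel-zero { - 1ℚ} (λ ()) (trans (negate (d η)) (zero-nonPos
        -- This is -d, written as a combination to which `stationary-linear` applies.
        {λ ξ → (- 1ℚ) * d ξ + 0ℚ * d ξ} (stationary-linear (- 1ℚ) 0ℚ d d stat stat)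
        (trans (∑-linear S (- 1ℚ) 0ℚ d d) (cong (λ x → (- 1ℚ) * x + 0ℚ * x) sum≡0))
        (λ 0<-d → ℚₚ.<-asym 0<d (subst (_< 0ℚ) (solve 1 (λ x → con 0ℚ :- (con 0ℚ :- x) := x) refl (d lam))
          (subst (0ℚ - (0ℚ - d lam) <_) (ℚₚ.+-inverseʳ 0ℚ) (ℚₚ.+-monoʳ-< 0ℚ (ℚₚ.neg-antimono-< (subst (0ℚ <_) (negated (d lam)) 0<-d)))))) η∈))
      where
      negate : ∀ x → (- 1ℚ) * x ≡ (- 1ℚ) * x + 0ℚ * x
      negate = solve 1 (λ x → con (- 1ℚ) :* x := con (- 1ℚ) :* x :+ con 0ℚ :* x) refl
      negated : ∀ x → (- 1ℚ) * x + 0ℚ * x ≡ 0ℚ - x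
      negated = solve 1 (λ x → con (- 1ℚ) :* x :+ con 0ℚ :* x := con 0ℚ :- x) refl

-- Exchanging two adjacent rates

hecke-local : ∀ t (Ψ Φ : ℕ → ℕ → ℚ) a b → Ψ a b ≡ Φ a b → Ψ b a ≡ Φ b a → hecke t Ψ a b ≡ hecke t Φ a b
hecke-local t Ψ Φ a b e e′ with a <ᵇ b
... | true  = cong₂ (λ x y → x - (1ℚ - t) * y) e′ e
... | false = cong (t *_) e′

hecke-symmetric : ∀ t (Ψ : ℕ → ℕ → ℚ) a b → Ψ b a ≡ Ψ a b → hecke t Ψ a b ≡ t * Ψ a b
hecke-symmetric t Ψ a b e with a <ᵇ b
... | true  = trans (cong (_- (1ℚ - t) * Ψ a b) e) (solve 2 (λ t x → x :- (con 1ℚ :- t) :* x := t :* x) refl t (Ψ a b))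
... | false = cong (t *_) e

functional-combine : ∀ {n} {xs : List (Config n)} α β {φ ψ : (Config n → ℚ) → ℚ} →
  Functional xs φ → Functional xs ψ → Functional xs (λ g → α * φ g + β * ψ g)
functional-combine α β {φ} {ψ} F G = record
  { linear = λ a b f g → trans (cong₂ (λ x y → α * x + β * y) (Functional.linear F a b f g) (Functional.linear G a b f g))
      (solve 8 (λ α β a b p q r s → α :* (a :* p :+ b :* q) :+ β :* (a :* r :+ b :* s)
                                 := a :* (α :* p :+ β :* r) :+ b :* (α :* q :+ β :* s))
        refl α β a b (φ f) (φ g) (ψ f) (ψ g))
  ; local = λ e → cong₂ (λ x y → α * x + β * y) (Functional.local F e) (Functional.local G e) }

∑-adjacent : ∀ {A : Set} C {i i′ : A} D {xs} → xs ≡ C ++ i ∷ i′ ∷ D → ∀ {f g : A → ℚ} →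
  (∀ {j} → j ∈ C ++ D → f j ≡ g j) → f i + f i′ ≡ g i + g i′ → ∑ xs f ≡ ∑ xs g
∑-adjacent C {i} {i′} D refl {f} {g} h e = begin
  ∑ (C ++ i ∷ i′ ∷ D) f             ≡⟨ rearrange f ⟩
  (f i + f i′) + (∑ C f + ∑ D f)    ≡⟨ cong₂ _+_ e (cong₂ _+_ (∑-cong C (h ∘ ∈-++⁺ˡ)) (∑-cong D (h ∘ ∈-++⁺ʳ C))) ⟩
  (g i + g i′) + (∑ C g + ∑ D g)    ≡⟨ sym (rearrange g) ⟩
  ∑ (C ++ i ∷ i′ ∷ D) g             ∎
  where
  open ≡-Reasoning
  rearrange : ∀ f → ∑ (C ++ i ∷ i′ ∷ D) f ≡ (f i + f i′) + (∑ C f + ∑ D f)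
  rearrange f = trans (∑-++ C (i ∷ i′ ∷ D) f)
    (solve 4 (λ c a b d → c :+ (a :+ (b :+ d)) := (a :+ b) :+ (c :+ d)) refl (∑ C f) (f i) (f i′) (∑ D f))

module SwapRates {n : ℕ} (t : ℚ) (0≤t : 0ℚ ≤ t) (t<1 : t < 1ℚ) (lam : Vec ℕ n) (0∈lam : 0 ∈ toList lam)
  (part : IsPartition lam)
  {i i′ : Fin n} (C D : List (Fin n)) (e : allFin n ≡ C ++ i ∷ i′ ∷ D)
  (x x′ : Fin n → ℚ) (0<x : ∀ j → 0ℚ < x j) (xi≤xi′ : x i ≤ x i′)
  (x′i : x′ i ≡ x i′) (x′i′ : x′ i′ ≡ x i) (x′-far : ∀ {j} → j ∈ C ++ D → x′ j ≡ x j) where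

  open Stationarity t 0≤t t<1 lam 0∈lam part
  open Adjacent t 0≤t t<1 (toList lam) 0∈lam C D e

  private
    y z w : ℚ
    y = x i
    z = x i′
    w = z - t * y

    c c′ : Fin n → ℚ
    c j = 1ℚ /' x j
    c′ j = 1ℚ /' x′ j

    w≢0 : w ≢ 0ℚ
    w≢0 w≡0 = ℚₚ.<⇒≢ (ℚₚ.<-≤-trans (*-pos (p<q⇒0<q-p t<1) (0<x i)) (begin
      (1ℚ - t) * y   ≡⟨ solve 2 (λ t y → (con 1ℚ :- t) :* y := y :- t :* y) refl t y ⟩
      y - t * y      ≤⟨ ℚₚ.+-monoˡ-≤ (- (t * y)) xi≤xi′ ⟩
      w              ∎)) (sym w≡0)
      where open ℚₚ.≤-Reasoning

    u*y : c i * y ≡ 1ℚ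
    u*y = /'-* 1ℚ (λ y≡0 → ℚₚ.<⇒≢ (0<x i) (sym y≡0))

    v*z : c i′ * z ≡ 1ℚ
    v*z = /'-* 1ℚ (λ z≡0 → ℚₚ.<⇒≢ (0<x i′) (sym z≡0))

  T-functional : ∀ {η} → η ∈ S → Functional S (λ g → T g η)
  T-functional {η} η∈ = record
    { linear = λ α β f g → hecke-linear t α β (λ a b → f ((η [ i ]≔ a) [ i′ ]≔ b)) (λ a b → g ((η [ i ]≔ a) [ i′ ]≔ b)) (lookup η i) (lookup η i′)
    ; local = λ {f} {g} f≡g → hecke-local t (λ a b → f ((η [ i ]≔ a) [ i′ ]≔ b)) (λ a b → g ((η [ i ]≔ a) [ i′ ]≔ b)) (lookup η i) (lookup η i′)
        (f≡g (subst (_∈ S) (sym (update-lookup t i≢i′ η)) η∈))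
        (f≡g (∈-States⁺ lam (↭-trans (toList-transpose η i i′) (∈-States⁻ lam η∈)))) }

  -- Up to the factor w, the exchange matrix relating the chains with rates x and x′.
  Λ : (Config n → ℚ) → Config n → ℚ
  Λ g η = ((1ℚ - t) * z) * g η + (z - y) * T g η

  private
    evaluation : ∀ {η} → η ∈ S → Functional S (λ g → g η)
    evaluation η∈ = record { linear = λ _ _ _ _ → refl ; local = λ f≡g → f≡g η∈ }

    Λ-functional : ∀ {η} → η ∈ S → Functional S (λ g → Λ g η)
    Λ-functional η∈ = functional-combine ((1ℚ - t) * z) (z - y) (evaluation η∈) (T-functional η∈)

  totalRate-swap : ∑ (allFin n) c ≡ ∑ (allFin n) c′
  totalRate-swap = ∑-adjacent C D e (λ j∈ → cong (1ℚ /'_) (sym (x′-far j∈)))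
    (trans (ℚₚ.+-comm (c i) (c i′)) (cong₂ (λ a b → 1ℚ /' a + 1ℚ /' b) (sym x′i) (sym x′i′)))

  -- At the other sites the rates agree and T commutes with the bell. At the pair, the relations
  -- leave the defect (1 - t)(b - a)(`c i′ * z - c i * y`), which vanishes because both products are
  -- 1: here the rates 1/x_j fix the coefficients of `Λ`.
  intertwine : ∀ g {η} → η ∈ S → gen c (Λ g) η ≡ Λ (gen c′ g) η
  intertwine g {η} η∈ = begin
    gen c (Λ g) η
      ≡⟨ ∑-cong (allFin n) (λ {j} _ → cong (c j *_) (mean-linear (ring t η j) K (z - y) g (T g))) ⟩
    ∑ (allFin n) (λ j → c j * (K * bell t j g η + (z - y) * bell t j (T g) η))
      ≡⟨ ∑-adjacent C D e far near ⟩
    ∑ (allFin n) (λ j → c′ j * (K * bell t j g η + (z - y) * T (bell t j g) η))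
      ≡⟨ ∑-cong (allFin n) (λ {j} _ → solve 5 (λ c k p d q → c :* (k :* p :+ d :* q) := k :* (c :* p) :+ d :* (c :* q))
           refl (c′ j) K (bell t j g η) (z - y) (T (bell t j g) η)) ⟩
    ∑ (allFin n) (λ j → K * (c′ j * bell t j g η) + (z - y) * (c′ j * T (bell t j g) η))
      ≡⟨ ∑-linear (allFin n) K (z - y) (λ j → c′ j * bell t j g η) (λ j → c′ j * T (bell t j g) η) ⟩
    K * gen c′ g η + (z - y) * ∑ (allFin n) (λ j → c′ j * T (bell t j g) η)
      ≡⟨ cong (λ s → K * gen c′ g η + (z - y) * s) (sym (Functional.commute-∑ (T-functional η∈) (allFin n) c′ (λ j → bell t j g))) ⟩
    Λ (gen c′ g) η ∎
    where
    open ≡-Reasoning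
    K = (1ℚ - t) * z
    d = ∈-States⁻ lam η∈
    far : ∀ {j} → j ∈ C ++ D → c j * (K * bell t j g η + (z - y) * bell t j (T g) η)
                               ≡ c′ j * (K * bell t j g η + (z - y) * T (bell t j g) η)
    far {j} j∈ = cong₂ (λ a b → a * (K * bell t j g η + (z - y) * b)) (cong (1ℚ /'_) (sym (x′-far j∈))) (bell-hecke-far j∈ g d)
    a = bell t i g η
    b = bell t i′ g η
    X = T (bell t i g) η
    Y = T (bell t i′ g) η
    near : c i * (K * a + (z - y) * bell t i (T g) η) + c i′ * (K * b + (z - y) * bell t i′ (T g) η)
         ≡ c′ i * (K * a + (z - y) * X) + c′ i′ * (K * b + (z - y) * Y)
    near = begin
      c i * (K * a + (z - y) * bell t i (T g) η) + c i′ * (K * b + (z - y) * bell t i′ (T g) η)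
        ≡⟨ cong₂ (λ p q → c i * (K * a + (z - y) * p) + c i′ * (K * b + (z - y) * q)) (bell-hecke-left g d) (bell-hecke-right g d) ⟩
      c i * (K * a + (z - y) * (Y + (1ℚ - t) * (b - a))) + c i′ * (K * b + (z - y) * X)
        ≡⟨ solve 9 (λ t y z u v a b X Y → let k = (con 1ℚ :- t) :* z in
             u :* (k :* a :+ (z :- y) :* (Y :+ (con 1ℚ :- t) :* (b :- a))) :+ v :* (k :* b :+ (z :- y) :* X)
             := (v :* (k :* a :+ (z :- y) :* X) :+ u :* (k :* b :+ (z :- y) :* Y))
                :+ (con 1ℚ :- t) :* (b :- a) :* (v :* z :- u :* y))
             refl t y z (c i) (c i′) a b X Y ⟩
      (c i′ * (K * a + (z - y) * X) + c i * (K * b + (z - y) * Y)) + (1ℚ - t) * (b - a) * (c i′ * z - c i * y)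
        ≡⟨ cong₂ (λ p q → M + (1ℚ - t) * (b - a) * (p - q)) v*z u*y ⟩
      M + (1ℚ - t) * (b - a) * (1ℚ - 1ℚ)
        ≡⟨ solve 2 (λ m k → m :+ k :* (con 1ℚ :- con 1ℚ) := m) refl M ((1ℚ - t) * (b - a)) ⟩
      M
        ≡⟨ cong₂ (λ p q → (1ℚ /' p) * (K * a + (z - y) * X) + (1ℚ /' q) * (K * b + (z - y) * Y)) (sym x′i) (sym x′i′) ⟩
      c′ i * (K * a + (z - y) * X) + c′ i′ * (K * b + (z - y) * Y) ∎
      where M = c i′ * (K * a + (z - y) * X) + c i * (K * b + (z - y) * Y)

  module _ (π : Config n → ℚ) where

    private
      Φ : (Config n → ℚ) → ℚ
      Φ g = ∑ S (λ η → π η * Λ g η)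

    -- The weights that represent `Φ` divided by w, read off on indicators. The division makes their
    -- total mass that of `π`.
    swapped : Config n → ℚ
    swapped ζ = (1ℚ /' w) * Φ (δ ζ)

    swapped-mean : ∀ g → ∑ S (λ ζ → swapped ζ * g ζ) ≡ (1ℚ /' w) * Φ g
    swapped-mean g = begin
      ∑ S (λ ζ → swapped ζ * g ζ)                ≡⟨ ∑-cong S (λ {ζ} _ → solve 3 (λ w p g → w :* p :* g := w :* (g :* p)) refl (1ℚ /' w) (Φ (δ ζ)) (g ζ)) ⟩
      ∑ S (λ ζ → (1ℚ /' w) * (g ζ * Φ (δ ζ)))    ≡⟨ ∑-scale S (1ℚ /' w) (λ ζ → g ζ * Φ (δ ζ)) ⟩
      (1ℚ /' w) * ∑ S (λ ζ → g ζ * Φ (δ ζ))      ≡⟨ cong ((1ℚ /' w) *_) (sym (Functional.expand (functional-∑ S π Λ-functional) S! g)) ⟩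
      (1ℚ /' w) * Φ g                            ∎
      where open ≡-Reasoning

    swapped-stationary : Stationary c π → Stationary c′ swapped
    swapped-stationary stat g = begin
      ∑ S (λ ζ → swapped ζ * gen c′ g ζ)                        ≡⟨ swapped-mean (gen c′ g) ⟩
      (1ℚ /' w) * ∑ S (λ η → π η * Λ (gen c′ g) η)              ≡⟨ cong ((1ℚ /' w) *_) (∑-cong S (λ {η} η∈ → cong (π η *_) (sym (intertwine g η∈)))) ⟩
      (1ℚ /' w) * ∑ S (λ η → π η * gen c (Λ g) η)               ≡⟨ cong ((1ℚ /' w) *_) (stat (Λ g)) ⟩
      (1ℚ /' w) * (∑ (allFin n) c * Φ g)                        ≡⟨ solve 3 (λ a b c → a :* (b :* c) := b :* (a :* c)) refl (1ℚ /' w) (∑ (allFin n) c) (Φ g) ⟩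
      ∑ (allFin n) c * ((1ℚ /' w) * Φ g)                        ≡⟨ cong₂ _*_ totalRate-swap (sym (swapped-mean g)) ⟩
      ∑ (allFin n) c′ * ∑ S (λ ζ → swapped ζ * g ζ)             ∎
      where open ≡-Reasoning

    -- An observable invariant under the exchange is an eigenvector of T for the eigenvalue t, so
    -- `Λ` multiplies it by (1 - t) z + (z - y) t = w, which cancels the normalisation.
    swapped-expect : ∀ O → (∀ η → O ((η [ i ]≔ lookup η i′) [ i′ ]≔ lookup η i) ≡ O η) →
      ∑ S (λ η → swapped η * O η) ≡ ∑ S (λ η → π η * O η)
    swapped-expect O sym-O = begin
      ∑ S (λ η → swapped η * O η)                    ≡⟨ swapped-mean O ⟩
      (1ℚ /' w) * ∑ S (λ η → π η * Λ O η)            ≡⟨ cong ((1ℚ /' w) *_) (∑-cong S (λ {η} _ → trans (cong (π η *_) (Λ-O η))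
                                                          (solve 3 (λ p w o → p :* (w :* o) := w :* (p :* o)) refl (π η) w (O η)))) ⟩
      (1ℚ /' w) * ∑ S (λ η → w * (π η * O η))        ≡⟨ cong ((1ℚ /' w) *_) (∑-scale S w (λ η → π η * O η)) ⟩
      (1ℚ /' w) * (w * ∑ S (λ η → π η * O η))        ≡⟨ sym (ℚₚ.*-assoc (1ℚ /' w) w _) ⟩
      (1ℚ /' w) * w * ∑ S (λ η → π η * O η)          ≡⟨ cong (_* ∑ S (λ η → π η * O η)) (/'-* 1ℚ w≢0) ⟩
      1ℚ * ∑ S (λ η → π η * O η)                     ≡⟨ ℚₚ.*-identityˡ _ ⟩
      ∑ S (λ η → π η * O η)                          ∎
      where
      open ≡-Reasoning
      T-O : ∀ η → T O η ≡ t * O η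
      T-O η = trans (hecke-symmetric t (λ a b → O ((η [ i ]≔ a) [ i′ ]≔ b)) (lookup η i) (lookup η i′)
          (trans (sym-O η) (cong O (sym (update-lookup t i≢i′ η)))))
        (cong (λ ξ → t * O ξ) (update-lookup t i≢i′ η))
      Λ-O : ∀ η → Λ O η ≡ w * O η
      Λ-O η = trans (cong (λ s → (1ℚ - t) * z * O η + (z - y) * s) (T-O η))
        (solve 4 (λ t y z o → (con 1ℚ :- t) :* z :* o :+ (z :- y) :* (t :* o) := (z :- t :* y) :* o) refl t y z (O η))

-- Sorting the rates

/'-positive : ∀ {q} → 0ℚ < q → 0ℚ < 1ℚ /' q
/'-positive {q} 0<q = ℚₚ.*-cancelʳ-<-nonNeg q {{ℚ.nonNegative (ℚₚ.<⇒≤ 0<q)}}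
  (subst₂ _<_ (sym (ℚₚ.*-zeroˡ q)) (sym (/'-* 1ℚ (λ q≡0 → ℚₚ.<⇒≢ 0<q (sym q≡0)))) (ℚₚ.positive⁻¹ 1ℚ))

map-++⁻ : ∀ {A B : Set} (f : A → B) xs ys {zs} → map f xs ≡ ys ++ zs →
  ∃ λ xs₁ → ∃ λ xs₂ → xs ≡ xs₁ ++ xs₂ × map f xs₁ ≡ ys × map f xs₂ ≡ zs
map-++⁻ f xs       []       e = [] , xs , refl , refl , e
map-++⁻ f (x ∷ xs) (y ∷ ys) e with map-++⁻ f xs ys (Listₚ.∷-injectiveʳ e)
... | xs₁ , xs₂ , refl , e₁ , e₂ = x ∷ xs₁ , xs₂ , refl , cong₂ _∷_ (Listₚ.∷-injectiveˡ e) e₁ , e₂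

++-cancelˡ-↭ : ∀ {A : Set} (xs : List A) {ys zs} → xs ++ ys ↭ xs ++ zs → ys ↭ zs
++-cancelˡ-↭ []       p = p
++-cancelˡ-↭ (x ∷ xs) p = ++-cancelˡ-↭ xs (Permₚ.drop-∷ p)

map-cong⁻ : ∀ {A B : Set} {f g : A → B} xs → map f xs ≡ map g xs → ∀ {x} → x ∈ xs → f x ≡ g x
map-cong⁻ (x ∷ xs) e (here refl) = Listₚ.∷-injectiveˡ e
map-cong⁻ (x ∷ xs) e (there x∈)  = map-cong⁻ xs (Listₚ.∷-injectiveʳ e) x∈

split-below : ∀ {n} k (xs : List (Fin n)) → AllPairs Fin._<_ xs →
  ∃ λ P → ∃ λ Q → xs ≡ P ++ Q × All (λ i → toℕ i ℕ.< k) P × All (λ i → k ℕ.≤ toℕ i) Q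
split-below k []       _        = [] , [] , refl , [] , []
split-below k (x ∷ xs) (r ∷ rs) with toℕ x ℕ.<? k
... | no x≮k  = [] , x ∷ xs , refl , [] , k≤x ∷ All.map (λ x<y → ℕₚ.≤-trans k≤x (ℕₚ.<⇒≤ x<y)) r
  where k≤x = ℕₚ.≮⇒≥ x≮k
... | yes x<k with split-below k xs rs
...   | P , Q , refl , hP , hQ = x ∷ P , Q , refl , x<k ∷ hP , hQ

-- Restricted to a ≤ b, where the factor b - t a acquired by observables is positive.
data Swaps : List ℚ → List ℚ → Set where
  done : ∀ {l} → Swaps l l
  swap : ∀ A {a b B l} → a ≤ b → Swaps (A ++ b ∷ a ∷ B) l → Swaps (A ++ a ∷ b ∷ B) l

swaps-trans : ∀ {l m o} → Swaps l m → Swaps m o → Swaps l o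
swaps-trans done           s = s
swaps-trans (swap A a≤b r) s = swap A a≤b (swaps-trans r s)

swaps-∷ : ∀ {l m} x → Swaps l m → Swaps (x ∷ l) (x ∷ m)
swaps-∷ x done           = done
swaps-∷ x (swap A a≤b r) = swap (x ∷ A) a≤b (swaps-∷ x r)

swaps-↭ : ∀ {l m} → Swaps l m → l ↭ m
swaps-↭ done                   = ↭-refl
swaps-↭ (swap A {a} {b} a≤b r) = ↭-trans (Permₚ.++⁺ˡ A (↭-swap a b ↭-refl)) (swaps-↭ r)

-- Insertion into a decreasing list moves an entry only past entries at least as large, so every
-- swap is of the admissible kind.
swaps-insert : ∀ a l → AllPairs ℚ._≥_ l → ∃ λ m → Swaps (a ∷ l) m × AllPairs ℚ._≥_ m
swaps-insert a []      _        = a ∷ [] , done , [] ∷ []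
swaps-insert a (b ∷ l) (r ∷ rs) with ℚₚ.≤-total b a
... | inj₁ b≤a = a ∷ b ∷ l , done , (b≤a ∷ All.map (λ x≤b → ℚₚ.≤-trans x≤b b≤a) r) ∷ r ∷ rs
... | inj₂ a≤b with swaps-insert a l rs
...   | m , s , sorted = b ∷ m , swap [] a≤b (swaps-∷ b s) , Permₚ.All-resp-↭ (swaps-↭ s) (a≤b ∷ r) ∷ sorted

swaps-sort : ∀ l → ∃ λ m → Swaps l m × AllPairs ℚ._≥_ m
swaps-sort []      = [] , done , []
swaps-sort (a ∷ l) with swaps-sort l
... | m , s , sorted with swaps-insert a m sorted
...   | o , s′ , sorted′ = o , swaps-trans (swaps-∷ a s) s′ , sorted′

exchange : ∀ {n} → Fin n → Fin n → (Fin n → ℚ) → Fin n → ℚ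
exchange i i′ x j with j Fin.≟ i | j Fin.≟ i′
... | yes _ | _     = x i′
... | no _  | yes _ = x i
... | no _  | no _  = x j

module _ {n : ℕ} {i i′ : Fin n} (x : Fin n → ℚ) where

  exchange-left : exchange i i′ x i ≡ x i′
  exchange-left with i Fin.≟ i
  ... | yes _ = refl
  ... | no c  = ⊥-elim (c refl)

  exchange-right : exchange i i′ x i′ ≡ x i
  exchange-right with i′ Fin.≟ i | i′ Fin.≟ i′
  ... | yes e | _     = cong x e
  ... | no _  | yes _ = refl
  ... | no _  | no c  = ⊥-elim (c refl)

  exchange-far : ∀ {j} → j ≢ i × j ≢ i′ → exchange i i′ x j ≡ x j
  exchange-far {j} (j≢i , j≢i′) with j Fin.≟ i | j Fin.≟ i′
  ... | yes e | _     = ⊥-elim (j≢i e)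
  ... | no _  | yes e = ⊥-elim (j≢i′ e)
  ... | no _  | no _  = refl

  exchange-positive : (∀ j → 0ℚ < x j) → ∀ j → 0ℚ < exchange i i′ x j
  exchange-positive 0<x j with j Fin.≟ i | j Fin.≟ i′
  ... | yes _ | _     = 0<x i′
  ... | no _  | yes _ = 0<x i
  ... | no _  | no _  = 0<x j

-- Comparison through the sorted chain

module Symmetry {n : ℕ} (t : ℚ) (0≤t : 0ℚ ≤ t) (t<1 : t < 1ℚ) (lam : Vec ℕ n) (0∈lam : 0 ∈ toList lam)
  (part : IsPartition lam)
  (k : ℕ) (P Q : List (Fin n)) (e : allFin n ≡ P ++ Q)
  (P<k : All (λ i → toℕ i ℕ.< k) P) (k≤Q : All (λ i → k ℕ.≤ toℕ i) Q) where

  open Stationarity t 0≤t t<1 lam 0∈lam part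

  rates : (Fin n → ℚ) → Fin n → ℚ
  rates x j = 1ℚ /' x j

  -- The weights π′ may be signed. The relation is one-way, because an exchange is made only when
  -- the parameter at the earlier site is at most that at the later one.
  Transport : (Fin n → ℚ) → (Fin n → ℚ) → Set
  Transport x x′ = ∀ π → Stationary (rates x) π → ∃ λ π′ → Stationary (rates x′) π′ ×
    (∀ O → DependsOnlyOnFirst k O → expect lam π′ O ≡ expect lam π O)

  transport-exchange : ∀ {i i′} Q₁ Q₂ → Q ≡ Q₁ ++ i ∷ i′ ∷ Q₂ → ∀ x → (∀ j → 0ℚ < x j) → x i ≤ x i′ →
    Transport x (exchange i i′ x) × map (exchange i i′ x) P ≡ map x P ×
    map (exchange i i′ x) Q ≡ map x Q₁ ++ x i′ ∷ x i ∷ map x Q₂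
  transport-exchange {i} {i′} Q₁ Q₂ refl x 0<x le =
    (λ π stat → swapped π , swapped-stationary π stat , λ O dep → swapped-expect π O (λ η → dep _ η (unaffected η))) ,
    Listₚ.map-cong-local (All.map (exchange-far x) (Allₚ.++⁻ˡ P C-far)) ,
    trans (Listₚ.map-++ x′ Q₁ (i ∷ i′ ∷ Q₂))
      (cong₂ _++_ (Listₚ.map-cong-local (All.map (exchange-far x) (Allₚ.++⁻ʳ P C-far)))
        (cong₂ _∷_ (exchange-left {i = i} {i′ = i′} x) (cong₂ _∷_ (exchange-right {i = i} {i′ = i′} x) (Listₚ.map-cong-local (All.map (exchange-far x) D-far)))))
    where
    x′ = exchange i i′ x
    e′ : allFin n ≡ (P ++ Q₁) ++ i ∷ i′ ∷ Q₂
    e′ = trans e (sym (Listₚ.++-assoc P Q₁ (i ∷ i′ ∷ Q₂)))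
    open Adjacent t 0≤t t<1 (toList lam) 0∈lam (P ++ Q₁) Q₂ e′ using (C-far; D-far)
    open SwapRates t 0≤t t<1 lam 0∈lam part (P ++ Q₁) Q₂ e′ x x′ 0<x le (exchange-left {i = i} {i′ = i′} x) (exchange-right {i = i} {i′ = i′} x)
      (λ j∈ → exchange-far x (All.lookup (Allₚ.++⁺ C-far D-far) j∈))
    tail≥k = Allₚ.++⁻ʳ Q₁ k≤Q
    unaffected : ∀ η (q : Fin n) → toℕ q ℕ.< k →
      lookup ((η [ i ]≔ lookup η i′) [ i′ ]≔ lookup η i) q ≡ lookup η q
    unaffected η q q<k = trans
      (lookup∘update′ (λ { refl → ℕₚ.<⇒≱ q<k (All.head (All.tail tail≥k)) }) (η [ i ]≔ lookup η i′) (lookup η i))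
      (lookup∘update′ (λ { refl → ℕₚ.<⇒≱ q<k (All.head tail≥k) }) η (lookup η i′))

  transport-swaps : ∀ {l m} → Swaps l m → ∀ x → (∀ j → 0ℚ < x j) → map x Q ≡ l →
    ∃ λ x′ → (∀ j → 0ℚ < x′ j) × map x′ P ≡ map x P × map x′ Q ≡ m × Transport x x′
  transport-swaps done           x 0<x eq = x , 0<x , refl , eq , λ π stat → π , stat , λ _ _ → refl
  transport-swaps (swap A a≤b s) x 0<x eq with map-++⁻ x Q A eq
  ... | Q₁ , i ∷ i′ ∷ Q₂ , Q≡ , refl , refl with transport-exchange Q₁ Q₂ Q≡ x 0<x a≤b
  ...   | tr , onP , onQ with transport-swaps s (exchange i i′ x) (exchange-positive x 0<x) onQ
  ...     | x″ , 0<x″ , onP′ , onQ′ , tr′ = x″ , 0<x″ , trans onP′ onP , onQ′ , λ π stat →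
    let π′ , stat′ , same = tr π stat ; π″ , stat″ , same′ = tr′ π′ stat′ in
    π″ , stat″ , λ O dep → trans (same′ O dep) (same O dep)

  stationary-cong : ∀ {c c′} d → (∀ j → c j ≡ c′ j) → Stationary c d → Stationary c′ d
  stationary-cong {c} {c′} d h stat g = trans
    (∑-cong S (λ {η} _ → cong (d η *_) (∑-cong (allFin n) (λ {j} _ → cong (_* bell t j g η) (sym (h j))))))
    (trans (stat g) (cong (_* ∑ S (λ η → d η * g η)) (∑-cong (allFin n) (λ {j} _ → h j))))

  one : Config n → ℚ
  one _ = 1ℚ

  expect-one : ∀ π → expect lam π one ≡ ∑ S π
  expect-one π = ∑-cong S (λ {η} _ → ℚₚ.*-identityʳ (π η))

  stationary-unique : ∀ x → (∀ j → 0ℚ < x j) → ∀ π π′ → Stationary (rates x) π → Stationary (rates x) π′ →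
    ∑ S π ≡ ∑ S π′ → ∀ O → expect lam π O ≡ expect lam π′ O
  stationary-unique x 0<x π π′ stat stat′ total O = ∑-cong S (λ {η} η∈ → cong (_* O η) (begin
    π η                                        ≡⟨ solve 2 (λ a b → a := (con 1ℚ :* a :+ con (- 1ℚ) :* b) :+ b) refl (π η) (π′ η) ⟩
    (1ℚ * π η + (- 1ℚ) * π′ η) + π′ η          ≡⟨ cong (_+ π′ η) (Uniqueness.stationary-zero (rates x) (λ j → /'-positive (0<x j))
                                                    (stationary-linear 1ℚ (- 1ℚ) π π′ stat stat′) sum≡0 η∈) ⟩
    0ℚ + π′ η                                  ≡⟨ ℚₚ.+-identityˡ (π′ η) ⟩
    π′ η                                       ∎))
    where
    open ≡-Reasoning
    sum≡0 : ∑ S (λ η → 1ℚ * π η + (- 1ℚ) * π′ η) ≡ 0ℚ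
    sum≡0 = trans (∑-linear S 1ℚ (- 1ℚ) π π′) (trans (cong (λ s → 1ℚ * s + (- 1ℚ) * ∑ S π′) total)
      (solve 1 (λ s → con 1ℚ :* s :+ con (- 1ℚ) :* s := con 0ℚ) refl (∑ S π′)))

  symmetry : ∀ x x′ → (∀ j → 0ℚ < x j) → (∀ j → 0ℚ < x′ j) → map x P ≡ map x′ P → map x Q ↭ map x′ Q →
    ∀ π π′ → Stationary (rates x) π → Stationary (rates x′) π′ → ∑ S π ≡ ∑ S π′ →
    ∀ O → DependsOnlyOnFirst k O → expect lam π O ≡ expect lam π′ O
  symmetry x x′ 0<x 0<x′ onP onQ π π′ stat stat′ total O dep
    with swaps-sort (map x Q) | swaps-sort (map x′ Q)
  ... | m , s , sorted | m′ , s′ , sorted′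
    with transport-swaps s x 0<x refl | transport-swaps s′ x′ 0<x′ refl
  ... | y , 0<y , yP , yQ , tr | y′ , 0<y′ , y′P , y′Q , tr′
    with tr π stat | tr′ π′ stat′
  ... | ρ , ρ-stat , ρ-same | ρ′ , ρ′-stat , ρ′-same = begin
    expect lam π O    ≡⟨ sym (ρ-same O dep) ⟩
    expect lam ρ O    ≡⟨ stationary-unique y 0<y ρ ρ′ ρ-stat
                           (stationary-cong ρ′ (λ j → cong (1ℚ /'_) (sym (y≗y′ j))) ρ′-stat) masses O ⟩
    expect lam ρ′ O   ≡⟨ ρ′-same O dep ⟩
    expect lam π′ O   ∎
    where
    open ≡-Reasoning
    m≡m′ : m ≡ m′
    m≡m′ = sorted-↭⇒≡ (λ y≤x x≤y → ℚₚ.≤-antisym x≤y y≤x) sorted sorted′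
      (↭-trans (↭-sym (swaps-↭ s)) (↭-trans onQ (swaps-↭ s′)))
    y≗y′ : ∀ j → y j ≡ y′ j
    y≗y′ j = map-cong⁻ (P ++ Q) (trans (Listₚ.map-++ y P Q) (trans
      (cong₂ _++_ (trans yP (trans onP (sym y′P))) (trans yQ (trans m≡m′ (sym y′Q))))
      (sym (Listₚ.map-++ y′ P Q)))) (subst (j ∈_) e (∈-allFin j))
    -- The constant observable depends on no site, so transport preserves the total mass.
    masses : ∑ S ρ ≡ ∑ S ρ′
    masses = trans (sym (expect-one ρ)) (trans (ρ-same one (λ _ _ _ → refl)) (trans (expect-one π)
      (trans total (trans (sym (expect-one π′)) (trans (sym (ρ′-same one (λ _ _ _ → refl))) (expect-one ρ′))))))

theorem1p4 : (n : ℕ) → 2 Data.Nat.≤ n →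
    (lam : Vec ℕ n) → IsPartition lam → VecAny.Any (_≡ 0) lam →
    (x : Fin n → ℚ) → ((j : Fin n) → 0ℚ < x j) →
    (t : ℚ) → 0ℚ ≤ t → t < 1ℚ →
    (k : ℕ) → k Data.Nat.< n →
    (O : Config n → ℚ) → DependsOnlyOnFirst k O →
    (σ : Permutation′ n) → FixesFirst k σ →
    (π π′ : Config n → ℚ) →
    IsStationary lam x t π →
    IsStationary lam (λ j → x (σ ⟨$⟩ʳ j)) t π′ →
    expect lam π O ≡ expect lam π′ O
theorem1p4 n _ lam part vacancy x 0<x t 0≤t t<1 k _ O dep σ fix π π′ stat stat′
  with split-below k (allFin n) (allFin-< n)
... | P , Q , e , P<k , k≤Q = symmetry x xσ 0<x (λ j → 0<x (σ ⟨$⟩ʳ j)) onP onQ π π′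
  (isStationary⇒stationary x π stat) (isStationary⇒stationary xσ π′ stat′)
  (trans (proj₁ (proj₂ stat)) (sym (proj₁ (proj₂ stat′)))) O dep
  where
  0∈lam : 0 ∈ toList lam
  0∈lam = ∈-toList⁺ (VecAny.map sym vacancy)
  open Stationarity t 0≤t t<1 lam 0∈lam part using (isStationary⇒stationary)
  open Symmetry t 0≤t t<1 lam 0∈lam part k P Q e P<k k≤Q using (symmetry)
  xσ : Fin n → ℚ
  xσ j = x (σ ⟨$⟩ʳ j)
  onP : map x P ≡ map xσ P
  onP = Listₚ.map-cong-local (All.map (λ {i} i<k → cong x (sym (fix i i<k))) P<k)
  permuted : map xσ (allFin n) ↭ map x (allFin n)
  permuted = subst (_↭ map x (allFin n)) (sym (Listₚ.map-∘ (allFin n)))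
    (Permₚ.map⁺ x (∼bag⇒↭ (unique∧set⇒bag
      (Uniqueₚ.map⁺ (λ {i} {j} eq → trans (sym (inverseˡ σ)) (trans (cong (σ ⟨$⟩ˡ_) eq) (inverseˡ σ))) (Uniqueₚ.allFin⁺ n))
      (Uniqueₚ.allFin⁺ n)
      (mk⇔ (λ _ → ∈-allFin _)
           (λ _ → subst (_∈ map (σ ⟨$⟩ʳ_) (allFin n)) (inverseʳ σ) (∈-map⁺ (σ ⟨$⟩ʳ_) (∈-allFin (σ ⟨$⟩ˡ _))))))))
  -- σ fixes the sites of `P`, so both lists of values begin with the same block, which is cancelled
  -- from `permuted`.
  onQ : map x Q ↭ map xσ Q
  onQ = ++-cancelˡ-↭ (map x P) (↭-sym (subst₂ _↭_
    (trans (cong (map xσ) e) (trans (Listₚ.map-++ xσ P Q) (cong (_++ map xσ Q) (sym onP))))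
    (trans (cong (map x) e) (Listₚ.map-++ x P Q)) permuted))
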